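{- Let $G$ be a simple subcubic graph, and suppose at most four edges of $G\square K_2$ are properly precolored with colors from $\{1,\dots,5\}$. Then the precoloring can be extended to a proper $5$-edge-coloring of $G\square K_2$.
   Context: A graph is subcubic if its maximum degree is at most $3$. A precoloring is a proper edge-coloring (adjacent edges receive distinct colors) of a subset of the edges; extending it means finding a proper edge-coloring of the whole graph with the given colors that agrees with it on the precolored edges. The Cartesian product $G\square H$ has vertex set $V(G)\times V(H)$, with $(u_1,u_2)\sim(v_1,v_2)$ iff either $u_1=v_1$ and $u_2v_2\in E(H)$, or $u_2=v_2$ and $u_1v_1\in E(G)$. -}

module Defs where

open import Data.Bool using (Bool; true; false; not; _∧_; _∨_)
open import Data.Nat using (ℕ; _≤_)
open import Data.Fin using (Fin)
open import Data.Fin.Properties using () renaming (_≟_ to _≟ᶠ_)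
open import Data.List using (List; length; filterᵇ; allFin)
open import Data.List.Membership.Propositional using (_∈_)
open import Data.Product using (_×_; _,_)
open import Data.Sum using (_⊎_)
open import Relation.Binary.PropositionalEquality using (_≡_)
open import Relation.Binary.Definitions using (DecidableEquality)
open import Relation.Nullary using (¬_; does)

record Graph (V : Set) : Set where
  field
    adj   : V → V → Bool
    sym   : ∀ u v → adj u v ≡ adj v u
    irrefl : ∀ u → adj u u ≡ false
open Graph public

degree : ∀ {n} → Graph (Fin n) → Fin n → ℕ
degree {n} G u = length (filterᵇ (λ v → adj G u v) (allFin n))

Subcubic : ∀ {n} → Graph (Fin n) → Set
Subcubic G = ∀ u → degree G u ≤ 3

K₂ : Graph (Fin 2)
K₂ = record { adj = λ i j → not (does (i ≟ᶠ j)) ; sym = s ; irrefl = r }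
  where
  open import Relation.Binary.PropositionalEquality using (refl)
  s : ∀ u v → not (does (u ≟ᶠ v)) ≡ not (does (v ≟ᶠ u))
  s Fin.zero Fin.zero = refl
  s Fin.zero (Fin.suc Fin.zero) = refl
  s (Fin.suc Fin.zero) Fin.zero = refl
  s (Fin.suc Fin.zero) (Fin.suc Fin.zero) = refl
  r : ∀ u → not (does (u ≟ᶠ u)) ≡ false
  r Fin.zero = refl
  r (Fin.suc Fin.zero) = refl

cartesian : ∀ {V W : Set} → DecidableEquality V → DecidableEquality W →
            Graph V → Graph W → Graph (V × W)
cartesian {V} {W} dV dW G H = record { adj = a ; sym = s ; irrefl = r }
  where
  open import Relation.Binary.PropositionalEquality using (refl; cong₂; trans)
  open import Data.Bool.Properties using (∨-comm)
  open import Relation.Nullary using (yes; no)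
  eqV : V → V → Bool
  eqV x y = does (dV x y)
  eqW : W → W → Bool
  eqW x y = does (dW x y)
  a : V × W → V × W → Bool
  a (u₁ , u₂) (v₁ , v₂) = (eqV u₁ v₁ ∧ adj H u₂ v₂) ∨ (eqW u₂ v₂ ∧ adj G u₁ v₁)
  eqV-sym : ∀ x y → eqV x y ≡ eqV y x
  eqV-sym x y with dV x y | dV y x
  ... | yes _ | yes _ = refl
  ... | no _  | no _  = refl
  ... | yes refl | no ¬p = Data.Empty.⊥-elim (¬p refl) where import Data.Empty
  ... | no ¬p | yes refl = Data.Empty.⊥-elim (¬p refl) where import Data.Empty
  eqW-sym : ∀ x y → eqW x y ≡ eqW y x
  eqW-sym x y with dW x y | dW y x
  ... | yes _ | yes _ = refl
  ... | no _  | no _  = refl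
  ... | yes refl | no ¬p = Data.Empty.⊥-elim (¬p refl) where import Data.Empty
  ... | no ¬p | yes refl = Data.Empty.⊥-elim (¬p refl) where import Data.Empty
  s : ∀ u v → a u v ≡ a v u
  s (u₁ , u₂) (v₁ , v₂) =
    cong₂ _∨_ (cong₂ _∧_ (eqV-sym u₁ v₁) (Graph.sym H u₂ v₂))
              (cong₂ _∧_ (eqW-sym u₂ v₂) (Graph.sym G u₁ v₁))
  r : ∀ u → a u u ≡ false
  r (u₁ , u₂) rewrite Graph.irrefl H u₂ | Graph.irrefl G u₁
    | Data.Bool.Properties.∧-zeroʳ (eqV u₁ u₁)
    | Data.Bool.Properties.∧-zeroʳ (eqW u₂ u₂) = refl
    where import Data.Bool.Properties

_□_ : ∀ {n m} → Graph (Fin n) → Graph (Fin m) → Graph (Fin n × Fin m)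
G □ H = cartesian _≟ᶠ_ _≟ᶠ_ G H

-- Edge colorings with k colours (colours Fin k, i.e. {1,…,k} relabelled).
-- A colouring assigns a colour c u v to each ordered pair; only its values on
-- edges matter, and it must be symmetric on edges.
record IsProperEdgeColoring {V : Set} (G : Graph V) (k : ℕ) (c : V → V → Fin k) : Set where
  field
    symmetric : ∀ u v → adj G u v ≡ true → c u v ≡ c v u
    proper    : ∀ u v w → adj G u v ≡ true → adj G u w ≡ true → ¬ (v ≡ w) →
                ¬ (c u v ≡ c u w)

SameEdge : {V : Set} → V × V → V × V → Set
SameEdge (a , b) (x , y) = (a ≡ x × b ≡ y) ⊎ (a ≡ y × b ≡ x)

Precoloring : Set → ℕ → Set
Precoloring V k = List ((V × V) × Fin k)

record IsProperPrecoloring {V : Set} (G : Graph V) {k : ℕ} (P : Precoloring V k) : Set where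
  field
    areEdges   : ∀ {u v i} → ((u , v) , i) ∈ P → adj G u v ≡ true
    consistent : ∀ {e e' i j} → (e , i) ∈ P → (e' , j) ∈ P → SameEdge e e' → i ≡ j
    proper     : ∀ {e e' i j} x y z → (e , i) ∈ P → (e' , j) ∈ P →
                 SameEdge e (x , y) → SameEdge e' (x , z) → ¬ (y ≡ z) → ¬ (i ≡ j)

Extends : {V : Set} {k : ℕ} → (V → V → Fin k) → Precoloring V k → Set
Extends {V} {k} c P = ∀ {u v : V} {i : Fin k} → ((u , v) , i) ∈ P → c u v ≡ i

-- Give every vertical edge a base colour, except over a matching M of G whose edges take the
-- base colour in both layers.  The vertical edges over M, like the prescribed ones, then act as
-- pendant edges of G − M, and each layer asks for a 4-edge-colouring of a subcubic graph that
-- extends a few precoloured edges.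
--
-- Such a colouring is built one edge at a time.  If the uncoloured edge (the hole) cannot be
-- coloured, its neighbours carry four distinct colours, so the hole can be pushed onto any of
-- them, and the palettes met at its front alternate between a set and its complement.  Pushing
-- it once around a cycle would break this alternation; hence a hole that is never filled runs
-- into leaves, vertices with two precoloured edges, and the palettes of two such leaves are equal
-- or complementary.  Three precoloured edges do not suffice for this obstruction, and for four
-- the base colour, M and the colours of the vertical edges over M are chosen to exclude it.

module Submission where

open import Defs
open import Data.Nat using (ℕ; _≤_)
open import Data.Fin using (Fin)
open import Data.List using (length)
open import Data.Product using (_×_; Σ)

open import Data.Bool using (Bool; true; false; not; _∧_; _∨_; _xor_; T?) renaming (_≟_ to _≟ᵇ_)
open import Data.Bool.Properties using (not-involutive; T-≡; ∧-zeroʳ)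
open import Data.Empty using (⊥; ⊥-elim)
open import Data.Fin using (zero; suc; punchIn; punchOut; toℕ)
open import Data.Fin.Properties using (punchInᵢ≢i; punchIn-injective; punchIn-punchOut) renaming (_≟_ to _≟ᶠ_)
open import Data.List using (List; []; _∷_; _++_; map; allFin; filter; filterᵇ; cartesianProduct)
open import Data.List.Membership.Propositional using (_∈_; _∉_; find; lose)
open import Data.List.Membership.Propositional.Properties
  using (∈-++⁺ˡ; ∈-++⁺ʳ; ∈-++⁻; ∈-∃++; ∈-map⁺; ∈-map⁻; ∈-filter⁺; ∈-filter⁻; ∈-allFin; ∈-cartesianProduct⁺)
open import Data.List.Properties using (length-++; length-map; length-filter; filter-notAll)
open import Data.List.Relation.Unary.All as All using (All; []; _∷_)
open import Data.List.Relation.Unary.AllPairs as AllPairs using (AllPairs; []; _∷_)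
open import Data.List.Relation.Unary.AllPairs.Properties as AllPairsₚ using ()
open import Data.List.Relation.Unary.Any as Any using (Any; here; there; any?; satisfied)
open import Data.List.Relation.Unary.Linked using (Linked; [-]; _∷_)
open import Data.List.Relation.Unary.Unique.Propositional using (Unique)
import Data.List.Relation.Unary.Unique.Propositional.Properties as Unique
open import Data.Nat using (zero; suc; _+_; _<_; z≤n; s≤s)
import Data.Nat.Properties as ℕ
open import Data.Product using (∃; ∃₂; _,_; proj₁; proj₂)
import Data.Product.Properties as Product
open import Data.Sum using (_⊎_; inj₁; inj₂; [_,_]′; map₂; swap)
open import Data.Sum.Properties using (inj₁-injective; inj₂-injective)
import Data.Sum.Properties as Sum
open import Function using (_∘_; id; case_of_)
open import Function.Bundles using (Equivalence)
open import Relation.Binary.Definitions using (DecidableEquality)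
open import Relation.Binary.PropositionalEquality
  using (_≡_; _≢_; refl; cong; cong₂; trans; subst; ≢-sym) renaming (sym to ≡-sym)
open import Relation.Nullary using (¬_; Dec; yes; no; does; contradiction)
open import Relation.Nullary.Decidable using (map′; _×-dec_; _⊎-dec_; ¬?; dec-true; dec-false; decidable-stable)

-- Four colours and maximum degree three are the tight case for pushing: each end of a hole shows at
-- most two colours, so an unfillable hole splits the four colours two against two. The alternation
-- of palettes rests on this equality. The case analysis is driven by a budget of three precoloured
-- edges per layer. A prescribed vertical edge whose colour is not the base needs a pendant, and a
-- vertex of degree three has room for one only after losing an edge of M. The other end of that
-- edge cannot take the base vertically either, so it gets a pendant too. One vertical edge can thus
-- cost two entries in both layers, and four prescribed edges overrun the budget. Savings come from
-- a vertical edge that has the base colour, from adjacent prescribed vertices that share an edge of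
-- M, and from an empty layer: then both layers take the same colouring, and spare colours remain
-- for the other vertical edges. Where the budget still fails, the obstruction is refuted from the
-- shape of the few precoloured edges.

unique-⊆-length : ∀ {A : Set} {xs ys : List A} → Unique xs → (∀ {x} → x ∈ xs → x ∈ ys) →
                  length xs ≤ length ys
unique-⊆-length {xs = []} _ _ = z≤n
unique-⊆-length {xs = x ∷ xs} (x∉xs ∷ uniq) sub with ∈-∃++ (sub (here refl))
... | ys , zs , refl = subst (suc (length xs) ≤_) (≡-sym size) (s≤s (unique-⊆-length uniq sub′))
  where
  size : length (ys ++ x ∷ zs) ≡ suc (length (ys ++ zs))
  size = trans (length-++ ys) (trans (ℕ.+-suc (length ys) (length zs)) (cong suc (≡-sym (length-++ ys))))
  sub′ : ∀ {y} → y ∈ xs → y ∈ ys ++ zs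
  sub′ y∈xs with ∈-++⁻ ys (sub (there y∈xs))
  ... | inj₁ y∈ys = ∈-++⁺ˡ y∈ys
  ... | inj₂ (here refl) = contradiction refl (All.lookup x∉xs y∈xs)
  ... | inj₂ (there y∈zs) = ∈-++⁺ʳ ys y∈zs

-- Finite vertex sets, degree bounds and edges without orientation

record Finite (V : Set) : Set where
  field
    _≟_ : DecidableEquality V
    elements : List V
    complete : ∀ v → v ∈ elements

  search : ∀ {P : V → Set} → (∀ v → Dec (P v)) → Dec (∃ P)
  search P? = map′ satisfied (λ (v , p) → lose (complete v) p) (any? P? elements)

  _∈?_ : ∀ v vs → Dec (v ∈ vs)
  v ∈? vs = any? (v ≟_) vs

private variable
  V : Set
  k : ℕ

fin-finite : ∀ n → Finite (Fin n)
fin-finite n = record { _≟_ = _≟ᶠ_ ; elements = allFin n ; complete = ∈-allFin }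

⊎-finite : ∀ {W} → Finite V → Finite W → Finite (V ⊎ W)
⊎-finite FV FW = record
  { _≟_ = Sum.≡-dec V._≟_ W._≟_
  ; elements = map inj₁ V.elements ++ map inj₂ W.elements
  ; complete = λ { (inj₁ v) → ∈-++⁺ˡ (∈-map⁺ inj₁ (V.complete v))
                 ; (inj₂ w) → ∈-++⁺ʳ (map inj₁ V.elements) (∈-map⁺ inj₂ (W.complete w)) } }
  where
  module V = Finite FV
  module W = Finite FW

Adj : Graph V → V → V → Set
Adj G u v = adj G u v ≡ true

adj? : (G : Graph V) → ∀ u v → Dec (Adj G u v)
adj? G u v = adj G u v ≟ᵇ true

adj-sym : (G : Graph V) → ∀ {u v} → Adj G u v → Adj G v u
adj-sym G {u} {v} uv = trans (sym G v u) uv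

adj⇒≢ : (G : Graph V) → ∀ {u v} → Adj G u v → u ≢ v
adj⇒≢ G {u} uu refl with trans (≡-sym uu) (irrefl G u)
... | ()

-- Stated through duplicate-free lists instead of a count: the bound then passes to subgraphs by
-- weakening the `All`, and it applies to derived vertex types without a chosen enumeration.
DegreeAtMost : ℕ → Graph V → V → Set
DegreeAtMost d G u = ∀ vs → Unique vs → All (Adj G u) vs → length vs ≤ d

neighbours≤3 : (G : Graph V) → ∀ {u a b c d} → DegreeAtMost 3 G u →
               Adj G u a → Adj G u b → Adj G u c → Adj G u d →
               a ≢ b → a ≢ c → a ≢ d → b ≢ c → b ≢ d → c ≢ d → ⊥
neighbours≤3 G deg ua ub uc ud ab ac ad bc bd cd =
  case deg _ ((ab ∷ ac ∷ ad ∷ []) ∷ (bc ∷ bd ∷ []) ∷ (cd ∷ []) ∷ [] ∷ []) (ua ∷ ub ∷ uc ∷ ud ∷ []) of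
    λ { (s≤s (s≤s (s≤s ()))) }

sameEdge-refl : ∀ {e : V × V} → SameEdge e e
sameEdge-refl = inj₁ (refl , refl)

sameEdge-flip : ∀ {e : V × V} {x y} → SameEdge e (x , y) → SameEdge e (y , x)
sameEdge-flip (inj₁ (p , q)) = inj₂ (p , q)
sameEdge-flip (inj₂ (p , q)) = inj₁ (p , q)

sameEdge-sym : ∀ {e e′ : V × V} → SameEdge e e′ → SameEdge e′ e
sameEdge-sym (inj₁ (refl , refl)) = inj₁ (refl , refl)
sameEdge-sym (inj₂ (refl , refl)) = inj₂ (refl , refl)

sameEdge-trans : ∀ {e e′ e″ : V × V} → SameEdge e e′ → SameEdge e′ e″ → SameEdge e e″
sameEdge-trans (inj₁ (refl , refl)) q = q
sameEdge-trans (inj₂ (refl , refl)) q = sameEdge-sym (sameEdge-flip (sameEdge-sym q))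

sameEdge-cancel : ∀ {x y z : V} → SameEdge (x , y) (x , z) → y ≡ z
sameEdge-cancel (inj₁ (_ , refl)) = refl
sameEdge-cancel (inj₂ (refl , refl)) = refl

sameEdge? : DecidableEquality V → (e e′ : V × V) → Dec (SameEdge e e′)
sameEdge? _≟_ (a , b) (x , y) = (a ≟ x ×-dec b ≟ y) ⊎-dec (a ≟ y ×-dec b ≟ x)

adj-sameEdge : (G : Graph V) → ∀ {e x y} → SameEdge e (x , y) → Adj G (proj₁ e) (proj₂ e) → Adj G x y
adj-sameEdge G (inj₁ (refl , refl)) a = a
adj-sameEdge G (inj₂ (refl , refl)) a = adj-sym G a

-- Entries of a precolouring are oriented pairs and may be repeated. This is the view up to
-- orientation in which the later arguments are phrased.
Coloured : Precoloring V k → V → V → Fin k → Set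
Coloured P u v i = ∃ λ e → (e , i) ∈ P × SameEdge e (u , v)

module _ {P : Precoloring V k} where

  coloured-flip : ∀ {u v i} → Coloured P u v i → Coloured P v u i
  coloured-flip (e , e∈P , s) = e , e∈P , sameEdge-flip s

  coloured? : DecidableEquality V → ∀ u v → Dec (∃ (Coloured P u v))
  coloured? _≟_ u v = map′ unpack (λ (i , e , m , s) → lose m s)
                           (any? (λ q → sameEdge? _≟_ (proj₁ q) (u , v)) P)
    where
    unpack : Any (λ q → SameEdge (proj₁ q) (u , v)) P → ∃ (Coloured P u v)
    unpack a with find a
    ... | (e , i) , m , s = i , e , m , s

  module _ {G : Graph V} (proper : IsProperPrecoloring G P) where

    coloured-adj : ∀ {u v i} → Coloured P u v i → Adj G u v
    coloured-adj (e , e∈P , s) = adj-sameEdge G s (IsProperPrecoloring.areEdges proper e∈P)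

    coloured-functional : ∀ {u v i j} → Coloured P u v i → Coloured P u v j → i ≡ j
    coloured-functional (e , m , s) (e′ , m′ , s′) =
      IsProperPrecoloring.consistent proper m m′ (sameEdge-trans s (sameEdge-sym s′))

    coloured-proper : ∀ {u v w i j} → Coloured P u v i → Coloured P u w j → v ≢ w → i ≢ j
    coloured-proper (e , m , s) (e′ , m′ , s′) = IsProperPrecoloring.proper proper _ _ _ m m′ s s′

does⇒ : ∀ {A : Set} (a? : Dec A) → does a? ≡ true → A
does⇒ (yes a) _ = a

does-⇔ : ∀ {A B : Set} (a? : Dec A) (b? : Dec B) → (A → B) → (B → A) → does a? ≡ does b?
does-⇔ (yes a) b? f g = ≡-sym (dec-true b? (f a))
does-⇔ (no ¬a) b? f g = ≡-sym (dec-false b? (λ b → ¬a (g b)))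

-- Pushing a hole through a subcubic graph

Extension : {V : Set} {k : ℕ} → Graph V → Precoloring V k → Set
Extension {V} {k} G P = Σ (V → V → Fin k) λ φ → IsProperEdgeColoring G k φ × Extends φ P

-- At most two colours, said without counting; the degree bound yields it for the colours next to a
-- hole.
NoThree : (Fin 4 → Set) → Set
NoThree A = ∀ {i j k} → i ≢ j → i ≢ k → j ≢ k → A i → A j → A k → ⊥

pick : ∀ {A B : Fin 4 → Set} → (∀ i → A i ⊎ B i) → NoThree A →
       (f : Fin 3 → Fin 4) → (∀ {s t} → f s ≡ f t → s ≡ t) → ∃ λ t → B (f t)
pick cover noA f inj with cover (f zero) | cover (f (suc zero)) | cover (f (suc (suc zero)))
... | inj₂ b | _ | _ = _ , b
... | _ | inj₂ b | _ = _ , b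
... | _ | _ | inj₂ b = _ , b
... | inj₁ a | inj₁ a′ | inj₁ a″ = ⊥-elim
  (noA (λ e → case inj e of λ ()) (λ e → case inj e of λ ()) (λ e → case inj e of λ ()) a a′ a″)

-- At most two of four colours lie in `A`, so any three colours contain one of `B`: the first is
-- sought among the colours other than `zero`, the second among those other than the first.
pick-two : ∀ {A B : Fin 4 → Set} → (∀ i → A i ⊎ B i) → NoThree A →
           ∃₂ λ i j → i ≢ j × B i × B j
pick-two cover noA =
  let i , bi = pick cover noA (punchIn zero) (punchIn-injective zero _ _)
      t , bj = pick cover noA (punchIn (punchIn zero i)) (punchIn-injective (punchIn zero i) _ _)
  in punchIn zero i , punchIn (punchIn zero i) t , ≢-sym (punchInᵢ≢i _ t) , bi , bj

-- Two sets of size at most two cover four colours only if they are disjoint: of the three colours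
-- other than a common `i`, two fall into the same set and make three with `i`.
cover-disjoint : ∀ {A B : Fin 4 → Set} → (∀ i → A i ⊎ B i) → NoThree A → NoThree B →
                 ∀ i → A i → B i → ⊥
cover-disjoint cover noA noB i a b =
  case cover (punchIn i zero) , cover (punchIn i (suc zero)) , cover (punchIn i (suc (suc zero))) of λ where
    (inj₁ x , inj₁ y , _) → noA away away (apart λ ()) a x y
    (inj₁ x , _ , inj₁ y) → noA away away (apart λ ()) a x y
    (_ , inj₁ x , inj₁ y) → noA away away (apart λ ()) a x y
    (inj₂ x , inj₂ y , _) → noB away away (apart λ ()) b x y
    (inj₂ x , _ , inj₂ y) → noB away away (apart λ ()) b x y
    (_ , inj₂ x , inj₂ y) → noB away away (apart λ ()) b x y
  where
  away : ∀ {t} → i ≢ punchIn i t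
  away {t} = ≢-sym (punchInᵢ≢i i t)
  apart : ∀ {s t} → s ≢ t → punchIn i s ≢ punchIn i t
  apart s≢t e = s≢t (punchIn-injective i _ _ e)

module Hole {V : Set} (F : Finite V) (H : Graph V) (deg : ∀ u → DegreeAtMost 3 H u)
            {P : Precoloring V 4} (precoloring : IsProperPrecoloring H P) where
  open Finite F

  Colouring : Set
  Colouring = V → V → Fin 4

  Open : V → V → Set
  Open u v = Adj H u v × ¬ ∃ (Coloured P u v)

  open-flip : ∀ {u v} → Open u v → Open v u
  open-flip (uv , ¬c) = adj-sym H uv , λ (i , c) → ¬c (i , coloured-flip c)

  -- `φ` stays a total function, so the hole keeps a symmetric value; only properness ignores it.
  -- This spares a separate type of partial colourings.
  record Partial (φ : Colouring) (p q : V) : Set where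
    field
      hole : Open p q
      symmetric : ∀ {u v} → Adj H u v → φ u v ≡ φ v u
      extends : ∀ {u v i} → Coloured P u v i → φ u v ≡ i
      proper : ∀ {u v w} → Adj H u v → Adj H u w → v ≢ w →
               ¬ SameEdge (p , q) (u , v) → ¬ SameEdge (p , q) (u , w) → φ u v ≢ φ u w
  open Partial

  private variable
    φ : Colouring
    p q r u v w : V

  partial-flip : Partial φ p q → Partial φ q p
  partial-flip π = record
    { hole = open-flip (hole π) ; symmetric = symmetric π ; extends = extends π
    ; proper = λ uv uw v≢w n n′ → proper π uv uw v≢w (λ s → n (flip s)) (λ s → n′ (flip s)) }
    where
    flip : ∀ {a b e} → SameEdge {V} (a , b) e → SameEdge (b , a) e
    flip s = sameEdge-sym (sameEdge-flip (sameEdge-sym s))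

  paint : Colouring → V → V → Fin 4 → Colouring
  paint φ p q i u v with sameEdge? _≟_ (p , q) (u , v)
  ... | yes _ = i
  ... | no _ = φ u v

  paint-on : ∀ {i} → SameEdge (p , q) (u , v) → paint φ p q i u v ≡ i
  paint-on {p = p} {q} {u} {v} s with sameEdge? _≟_ (p , q) (u , v)
  ... | yes _ = refl
  ... | no ¬s = contradiction s ¬s

  paint-off : ∀ {i} → ¬ SameEdge (p , q) (u , v) → paint φ p q i u v ≡ φ u v
  paint-off {p = p} {q} {u} {v} ¬s with sameEdge? _≟_ (p , q) (u , v)
  ... | yes s = contradiction s ¬s
  ... | no _ = refl

  paint-symmetric : ∀ {i} → Partial φ p q → Adj H u v → paint φ p q i u v ≡ paint φ p q i v u
  paint-symmetric {φ} {p} {q} {u} {v} π uv = case sameEdge? _≟_ (p , q) (u , v) of λ where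
    (yes s) → trans (paint-on {φ = φ} s) (≡-sym (paint-on {φ = φ} (sameEdge-flip s)))
    (no ¬s) → trans (paint-off ¬s) (trans (symmetric π uv)
                (≡-sym (paint-off {φ = φ} (λ s → ¬s (sameEdge-flip s)))))

  paint-extends : ∀ {i j} → Partial φ p q → Coloured P u v j → paint φ p q i u v ≡ j
  paint-extends π c = trans (paint-off λ s → proj₂ (hole π) (_ , restrict s c)) (extends π c)
    where
    restrict : ∀ {e u v j} → SameEdge e (u , v) → Coloured P u v j → Coloured P (proj₁ e) (proj₂ e) j
    restrict (inj₁ (refl , refl)) c = c
    restrict (inj₂ (refl , refl)) c = coloured-flip c

  -- The palette at `u` apart from the edge `uv`. For a hole `uv` these are the colours forbidden at
  -- this end. The Boolean form `seen` lets palettes be complemented and compared pointwise.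
  record Seen (φ : Colouring) (u v : V) (i : Fin 4) : Set where
    constructor via
    field
      other : V
      edge : Adj H u other
      away : other ≢ v
      colour : φ u other ≡ i

  seen? : ∀ φ u v i → Dec (Seen φ u v i)
  seen? φ u v i = map′ (λ (x , ux , x≢v , e) → via x ux x≢v e) (λ (via x ux x≢v e) → x , ux , x≢v , e)
                       (search λ x → adj? H u x ×-dec (¬? (x ≟ v) ×-dec (φ u x ≟ᶠ i)))

  seen : Colouring → V → V → Fin 4 → Bool
  seen φ u v i = does (seen? φ u v i)

  see : ∀ {i} → Seen φ u v i → seen φ u v i ≡ true
  see s = dec-true (seen? _ _ _ _) s

  unsee : ∀ {i} → seen φ u v i ≡ true → Seen φ u v i
  unsee = does⇒ (seen? _ _ _ _)

  fill : ∀ {i} → Partial φ p q → ¬ Seen φ p q i → ¬ Seen φ q p i → Extension H P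
  fill {φ} {p} {q} {i} π ¬sp ¬sq = ψ , record { symmetric = λ _ _ → paint-symmetric π ; proper = ok }
                                 , λ m → paint-extends π (_ , m , sameEdge-refl)
    where
    ψ = paint φ p q i
    clash : ∀ {u v w} → Adj H u w → v ≢ w → SameEdge (p , q) (u , v) → φ u w ≢ i
    clash uw v≢w (inj₁ (refl , refl)) e = ¬sp (via _ uw (≢-sym v≢w) e)
    clash uw v≢w (inj₂ (refl , refl)) e = ¬sq (via _ uw (≢-sym v≢w) e)
    ok : ∀ u v w → Adj H u v → Adj H u w → v ≢ w → ψ u v ≢ ψ u w
    ok u v w uv uw v≢w e with sameEdge? _≟_ (p , q) (u , v) | sameEdge? _≟_ (p , q) (u , w)
    ... | yes s | yes s′ = v≢w (sameEdge-cancel (sameEdge-trans (sameEdge-sym s) s′))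
    ... | yes s | no _ = clash uw v≢w s (≡-sym e)
    ... | no _ | yes s = clash uv (≢-sym v≢w) s e
    ... | no n | no n′ = proper π uv uw v≢w n n′ e

  seen-noThree : Adj H u v → NoThree (Seen φ u v)
  seen-noThree {u} {φ = φ} uv i≢j i≢k j≢k (via x ux x≢ refl) (via y uy y≢ refl) (via z uz z≢ refl) =
    neighbours≤3 H (deg u) uv ux uy uz (≢-sym x≢) (≢-sym y≢) (≢-sym z≢) (ne i≢j) (ne i≢k) (ne j≢k)
    where
    ne : ∀ {x y} → φ u x ≢ φ u y → x ≢ y
    ne n refl = n refl

  record Blocked (φ : Colouring) (p q : V) : Set where
    constructor blocked
    field
      cover : ∀ i → Seen φ p q i ⊎ Seen φ q p i
      disjoint : ∀ i → Seen φ p q i → Seen φ q p i → ⊥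

  -- Without a free colour the two palettes cover all four colours; the degree bound allows at most
  -- two in each, so `cover-disjoint` makes them complementary.
  fill-or-blocked : Partial φ p q → Extension H P ⊎ Blocked φ p q
  fill-or-blocked {φ} {p} {q} π
    with Finite.search (fin-finite 4) (λ i → ¬? (seen? φ p q i) ×-dec ¬? (seen? φ q p i))
  ... | yes (i , ¬sp , ¬sq) = inj₁ (fill π ¬sp ¬sq)
  ... | no none = inj₂ (blocked cover (cover-disjoint cover (seen-noThree pq) (seen-noThree (adj-sym H pq))))
    where
    pq = proj₁ (hole π)
    cover : ∀ i → Seen φ p q i ⊎ Seen φ q p i
    cover i with seen? φ p q i | seen? φ q p i
    ... | yes s | _ = inj₁ s
    ... | no _ | yes s = inj₂ s
    ... | no ¬s | no ¬s′ = contradiction (i , ¬s , ¬s′) none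

  blocked-flip : Blocked φ p q → Blocked φ q p
  blocked-flip (blocked cover disj) = blocked (λ i → swap (cover i)) λ i s s′ → disj i s′ s

  blocked-seen : Blocked φ p q → ∀ i → seen φ q p i ≡ not (seen φ p q i)
  blocked-seen {φ} {p} {q} (blocked cover disj) i with cover i
  ... | inj₁ s = trans (dec-false (seen? φ q p i) (disj i s)) (cong not (≡-sym (see s)))
  ... | inj₂ s = trans (see s) (cong not (≡-sym (dec-false (seen? φ p q i) (λ s′ → disj i s′ s))))

  -- The neighbours of a blocked hole carry four distinct colours, so the hole can be
  -- pushed along the path p q w: the edge pq takes over the colour of qw.
  record Moved (φ : Colouring) (p q w : V) : Set where
    field
      ψ : Colouring
      partial : Partial ψ q w
      front : ∀ i → seen ψ w q i ≡ not (seen φ q p i)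
      shifted : ψ p q ≡ φ q w
      unchanged : ∀ {u v} → ¬ SameEdge (p , q) (u , v) → ψ u v ≡ φ u v

  module _ {φ : Colouring} {p q w : V} (π : Partial φ p q) (qw : Open q w) (w≢p : w ≢ p) where
    private
      pq = proj₁ (hole π)
      ψ = paint φ p q (φ q w)

      notHole : ∀ {x} → x ≢ p → ¬ SameEdge (p , q) (q , x)
      notHole x≢p (inj₁ (p≡q , _)) = adj⇒≢ H pq p≡q
      notHole x≢p (inj₂ (p≡x , _)) = x≢p (≡-sym p≡x)

    -- The colour of `qw` is seen at `q`, hence by disjointness absent at `p`, so `pq` may take it
    -- over.
    push-partial : Blocked φ p q → Partial ψ q w
    push-partial (blocked _ disj) =
      record { hole = qw ; symmetric = paint-symmetric π ; extends = paint-extends π ; proper = ok }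
      where
      clash : ∀ {u v x} → Adj H u x → v ≢ x → SameEdge (p , q) (u , v) →
              ¬ SameEdge (q , w) (u , x) → φ u x ≢ φ q w
      clash ux v≢x (inj₁ (refl , refl)) n e =
        disj _ (via _ ux (≢-sym v≢x) e) (via w (proj₁ qw) w≢p refl)
      clash ux v≢x (inj₂ (refl , refl)) n e =
        proper π ux (proj₁ qw) (λ { refl → n sameEdge-refl }) (notHole (≢-sym v≢x)) (notHole w≢p) e
      ok : ∀ {u v x} → Adj H u v → Adj H u x → v ≢ x →
           ¬ SameEdge (q , w) (u , v) → ¬ SameEdge (q , w) (u , x) → ψ u v ≢ ψ u x
      ok {u} {v} {x} uv ux v≢x n n′ e with sameEdge? _≟_ (p , q) (u , v) | sameEdge? _≟_ (p , q) (u , x)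
      ... | yes s | yes s′ = v≢x (sameEdge-cancel (sameEdge-trans (sameEdge-sym s) s′))
      ... | yes s | no _ = clash ux v≢x s n′ (≡-sym e)
      ... | no _ | yes s = clash uv (≢-sym v≢x) s n e
      ... | no m | no m′ = proper π uv ux v≢x m m′ e

    -- At `q` the colour of `qw` merely moves to `pq`, while the edge left out changes from `pq` to
    -- `qw`.
    seen-push : ∀ i → seen ψ q w i ≡ seen φ q p i
    seen-push i = does-⇔ (seen? ψ q w i) (seen? φ q p i) forth back
      where
      forth : Seen ψ q w i → Seen φ q p i
      forth (via x qx x≢w e) with x ≟ p
      ... | yes refl = via w (proj₁ qw) w≢p (trans (≡-sym (paint-on {φ = φ} (inj₂ (refl , refl)))) e)
      ... | no x≢p = via x qx x≢p (trans (≡-sym (paint-off (notHole x≢p))) e)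
      back : Seen φ q p i → Seen ψ q w i
      back (via x qx x≢p e) with x ≟ w
      ... | yes refl = via p (adj-sym H pq) (≢-sym w≢p) (trans (paint-on {φ = φ} (inj₂ (refl , refl))) e)
      ... | no x≢w = via x qx x≢w (trans (paint-off (notHole x≢p)) e)

    -- If the new hole is blocked as well, the palette at `w` is the complement of the one at `q`,
    -- which has not changed; this is the alternation recorded in `front`.
    push : Extension H P ⊎ Moved φ p q w
    push with fill-or-blocked π
    ... | inj₁ done = inj₁ done
    ... | inj₂ stuck with fill-or-blocked (push-partial stuck)
    ... | inj₁ done = inj₁ done
    ... | inj₂ stuck′ = inj₂ record
      { ψ = ψ ; partial = push-partial stuck
      ; front = λ i → trans (blocked-seen stuck′ i) (cong not (seen-push i))
      ; shifted = paint-on {φ = φ} sameEdge-refl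
      ; unchanged = paint-off }

-- What stops a hole: leaves, feet and obstructions

record Leaf {V : Set} {k : ℕ} (P : Precoloring V k) (l : V) : Set where
  field
    {a b} : V
    {α β} : Fin k
    a≢b : a ≢ b
    α≢β : α ≢ β
    la : Coloured P l a α
    lb : Coloured P l b β

-- When the hole rests on the edge from `k′` to the leaf, the palettes of its ends are disjoint; so
-- a precoloured edge at `k′` has a colour outside the palette of the leaf.
record Foot {V : Set} {k : ℕ} (G : Graph V) (P : Precoloring V k) {l : V} (leaf : Leaf P l) : Set where
  field
    {k′ x} : V
    {i} : Fin k
    adjacent : Adj G l k′
    uncoloured : ¬ ∃ (Coloured P l k′)
    coloured : Coloured P k′ x i
    i≢α : i ≢ Leaf.α leaf
    i≢β : i ≢ Leaf.β leaf

-- Equal as sets, in either order, or disjoint. Among four colours disjoint pairs are complementary;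
-- the form without complements survives the passage to five colours, one of them the base.
data Compatible {k : ℕ} (α β α′ β′ : Fin k) : Set where
  same : α′ ≡ α → β′ ≡ β → Compatible α β α′ β′
  crossed : α′ ≡ β → β′ ≡ α → Compatible α β α′ β′
  disjoint : α′ ≢ α → α′ ≢ β → β′ ≢ α → β′ ≢ β → Compatible α β α′ β′

-- Compatible leaves alone can arise from three precoloured edges, a path coloured `q`, `p`, `q`.
-- The `obstacle` is what such a path cannot provide.
record Obstruction {V : Set} {k : ℕ} (G : Graph V) (P : Precoloring V k) : Set where
  field
    {l₁ l₂} : V
    l₁≢l₂ : l₁ ≢ l₂
    leaf₁ : Leaf P l₁
    leaf₂ : Leaf P l₂
    compatible : Compatible (Leaf.α leaf₁) (Leaf.β leaf₁) (Leaf.α leaf₂) (Leaf.β leaf₂)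
    obstacle : (∃ λ l₃ → l₃ ≢ l₁ × l₃ ≢ l₂ × Leaf P l₃) ⊎ (Foot G P leaf₁ × Foot G P leaf₂)

-- Cycles of uncoloured edges and walks of the hole

module Walk {V : Set} (F : Finite V) (H : Graph V) (deg : ∀ u → DegreeAtMost 3 H u)
            {P : Precoloring V 4} (precoloring : IsProperPrecoloring H P) where
  open Finite F
  open Hole F H deg precoloring
  open Partial

  private
    xor-clash : ∀ b → not (b xor true) ≡ true → not (b xor false) ≡ true → ⊥
    xor-clash false ()
    xor-clash true _ ()

    not-xor : ∀ b c → not (b xor c) ≡ not b xor c
    not-xor false c = refl
    not-xor true c = not-involutive c

    off-path : ∀ {p q w x : V} {vs} → w ∉ p ∷ q ∷ vs → ¬ SameEdge (p , q) (w , x)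
    off-path w∉ (inj₁ (refl , _)) = w∉ (here refl)
    off-path w∉ (inj₂ (_ , refl)) = w∉ (there (here refl))

  -- Pushing the hole once around a cycle of uncoloured edges through w returns it to w, where
  -- the colour shifted onto wa then violates the alternation of the palettes A and not A.
  rotate : ∀ rest {ψ p q w y a z b} (A : Fin 4 → Bool) → Partial ψ p q → Linked Open (q ∷ rest) →
           Unique (p ∷ q ∷ rest) → w ∉ p ∷ q ∷ rest → y ∈ q ∷ rest → Open y w →
           (∀ i → seen ψ q p i ≡ b xor A i) →
           Adj H w a → a ≢ y → A (ψ w a) ≡ true → Adj H w z → z ≢ y → A (ψ w z) ≡ false →
           Extension H P
  rotate rest {ψ} {q = q} {w} {b = b} A π _ _ w∉ (here refl) yw front wa a≢y Aa wz z≢y Az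
    with push π yw (λ { refl → w∉ (here refl) })
  ... | inj₁ done = done
  ... | inj₂ m = ⊥-elim (xor-clash b (subst (λ t → not (b xor t) ≡ true) Aa (marked wa a≢y))
                                     (subst (λ t → not (b xor t) ≡ true) Az (marked wz z≢y)))
    where
    marked : ∀ {x} → Adj H w x → x ≢ q → not (b xor A (ψ w x)) ≡ true
    marked wx x≢q = trans (cong not (≡-sym (front _))) (trans (≡-sym (Moved.front m _))
      (see {φ = Moved.ψ m} (via _ wx x≢q (Moved.unchanged m (off-path w∉)))))
  rotate (r ∷ rest) {b = b} A π (qr ∷ link) ((p≢q ∷ p≢r ∷ p∉) ∷ uniq) w∉ (there y∈) yw front wa a≢y Aa wz z≢y Az
    with push π qr (≢-sym p≢r)
  ... | inj₁ done = done
  ... | inj₂ m = rotate rest {b = not b} A (Moved.partial m) link uniq (λ w∈ → w∉ (there w∈)) y∈ yw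
                   (λ i → trans (Moved.front m i) (trans (cong not (front i)) (not-xor b (A i))))
                   wa a≢y (trans (cong A (Moved.unchanged m (off-path w∉))) Aa)
                   wz z≢y (trans (cong A (Moved.unchanged m (off-path w∉))) Az)

  record Fork (φ : Colouring) (p q : V) : Set where
    field
      {a b} : V
      qa : Adj H q a
      qb : Adj H q b
      a≢p : a ≢ p
      b≢p : b ≢ p
      colours≢ : φ q a ≢ φ q b

    a≢b : a ≢ b
    a≢b e = colours≢ (cong (φ q) e)

  -- The palette at `p` has at most two colours, so the complementary one at `q` has at least two.
  fork : ∀ {φ p q} → Partial φ p q → Blocked φ p q → Fork φ p q
  fork π (blocked cover _) with pick-two cover (seen-noThree (proj₁ (hole π)))
  ... | i , j , i≢j , via x qx x≢p refl , via y qy y≢p refl =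
    record { qa = qx ; qb = qy ; a≢p = x≢p ; b≢p = y≢p ; colours≢ = i≢j }

  -- With the first push `wq` takes the colour of `qr`, which lies in the palette `A` of `q`. Every
  -- other edge at `w` has a colour outside `A`, because `wq` was blocked. The fork at `w` has a
  -- branch other than `wy`, and `rotate` brings this branch and `wq` into conflict.
  cycle : ∀ rest {φ w q y} → Partial φ w q → Linked Open (q ∷ rest) → Unique (w ∷ q ∷ rest) →
          y ∈ rest → Open w y → Extension H P
  cycle (r ∷ rest) {φ} {w} {q} {y} π (qr ∷ link) ((w≢q ∷ w≢r ∷ w∉) ∷ q∉ ∷ uniq) y∈ wy
    with fill-or-blocked π
  ... | inj₁ done = done
  ... | inj₂ stuck with push π qr (≢-sym w≢r)
  ... | inj₁ done = done
  -- One push has already complemented `A`, hence the parity `true`.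
  ... | inj₂ m = rotate rest {b = true} A (Moved.partial m) link (q∉ ∷ uniq) w∉qr y∈ (open-flip wy)
      (Moved.front m) (proj₁ (hole π)) (λ q≡y → All.lookup q∉ y∈ q≡y)
      (trans (cong A (Moved.shifted m)) (see {φ = φ} (via r (proj₁ qr) (≢-sym w≢r) refl)))
      (third .proj₂ .proj₁) (third .proj₂ .proj₂ .proj₁) (third .proj₂ .proj₂ .proj₂)
    where
    A = seen φ q w
    w∉qr : w ∉ q ∷ r ∷ rest
    w∉qr w∈ = All.lookup (w≢q ∷ w≢r ∷ w∉) w∈ refl
    absent : ∀ {z} → Adj H w z → z ≢ q → A (Moved.ψ m w z) ≡ false
    absent {z} wz z≢q = trans (cong A (Moved.unchanged m λ
      { (inj₁ (_ , q≡z)) → z≢q (≡-sym q≡z) ; (inj₂ (_ , q≡w)) → w≢q (≡-sym q≡w) }))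
      (trans (blocked-seen stuck _) (cong not (see {φ = φ} (via z wz z≢q refl))))
    third : ∃ λ z → Adj H w z × z ≢ y × A (Moved.ψ m w z) ≡ false
    third with fork (partial-flip π) (blocked-flip stuck)
    ... | record { a = a ; b = b ; qa = wa ; qb = wb ; a≢p = a≢q ; b≢p = b≢q ; colours≢ = ne } with a ≟ y
    ... | yes refl = b , wb , (λ { refl → ne refl }) , absent wb b≢q
    ... | no a≢y = a , wa , a≢y , absent wa a≢q

  -- The route is stored backwards, from the front `q` through `p` to the oldest vertex, so that a
  -- step of the hole is a cons.
  record Path (φ : Colouring) (p q : V) (rest : List V) : Set where
    field
      partial : Partial φ p q
      linked : Linked Open (q ∷ p ∷ rest)
      unique : Unique (q ∷ p ∷ rest)

  advance : ∀ {φ p q w rest} → Path φ p q rest → (qw : Open q w) → w ∉ q ∷ p ∷ rest →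
            (m : Moved φ p q w) → Path (Moved.ψ m) q w (p ∷ rest)
  advance path qw w∉ m = record
    { partial = Moved.partial m
    ; linked = open-flip qw ∷ Path.linked path
    ; unique = All.tabulate (λ { x∈ refl → w∉ x∈ }) ∷ Path.unique path }

  DeadEnd : V → V → Set
  DeadEnd p q = ∀ {w} → Adj H q w → w ≢ p → ∃ (Coloured P q w)

  -- `L` is a vertex left behind and `Avoid` a set of forbidden ends; with the uniqueness of the
  -- path they make the final vertex new. `parity` compares its palette with the reference `A`.
  record Walked (A : Fin 4 → Bool) (Avoid : V → Set) (L : V) : Set where
    field
      {φ} : Colouring
      {p q} : V
      {rest} : List V
      path : Path φ p q rest
      deadEnd : DeadEnd p q
      {parity} : Bool
      front : ∀ i → seen φ q p i ≡ parity xor A i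
      passed : L ∈ p ∷ rest
      avoided : ¬ Avoid q

  -- A path of distinct vertices outgrows `elements` before the fuel runs out. A step onto an
  -- earlier vertex closes a cycle. A vertex of `Avoid` is never entered, because its uncoloured
  -- neighbours all lie behind the front.
  walk : ∀ fuel {φ p q rest A b Avoid L} → length elements ≤ length rest + fuel → Path φ p q rest →
         (∀ i → seen φ q p i ≡ b xor A i) → L ∈ p ∷ rest →
         (∀ {u v} → Avoid v → Open u v → u ∈ p ∷ rest) → ¬ Avoid q →
         Extension H P ⊎ Walked A Avoid L
  walk zero {rest = rest} short path _ _ _ _ = ⊥-elim (ℕ.<⇒≱
    (ℕ.<-≤-trans (s≤s (ℕ.n≤1+n _)) (unique-⊆-length (Path.unique path) (λ _ → complete _)))
    (subst (_ ≤_) (ℕ.+-identityʳ (length rest)) short))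
  walk (suc fuel) {φ} {p} {q} {rest} {A} {b} {Avoid} short path front passed closed ¬avoid
    with search (λ w → adj? H q w ×-dec (¬? (w ≟ p) ×-dec ¬? (coloured? _≟_ q w)))
  ... | no stop = inj₂ record
    { path = path ; deadEnd = dead ; parity = b ; front = front ; passed = passed ; avoided = ¬avoid }
    where
    dead : DeadEnd p q
    dead {w} qw w≢p with coloured? {P = P} _≟_ q w
    ... | yes c = c
    ... | no ¬c = contradiction (w , qw , w≢p , ¬c) stop
  ... | yes (w , qw , w≢p , ¬c) with w ∈? rest
  ... | yes w∈ with Path.linked path | Path.unique path
  -- The cycle consists of a stretch of the route and the edge from `q` to `w`; the hole is turned
  -- round to run through it backwards.
  ... | _ ∷ link | uniq = inj₁ (cycle rest (partial-flip (Path.partial path)) link uniq w∈ (qw , ¬c))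
  walk (suc fuel) {φ} {p} {q} {rest} {A} {b} {Avoid} short path front passed closed ¬avoid
      | yes (w , qw , w≢p , ¬c) | no w∉ with push (Path.partial path) (qw , ¬c) w≢p
  ... | inj₁ done = inj₁ done
  ... | inj₂ m = walk fuel {b = not b} (subst (length elements ≤_) (ℕ.+-suc (length rest) fuel) short)
      (advance path (qw , ¬c) w∉path m)
      (λ i → trans (Moved.front m i) (trans (cong not (front i)) (not-xor b (A i))))
      (there passed) (λ av o → there (closed av o))
      (λ av → All.lookup (q∉ (Path.unique path)) (closed av (qw , ¬c)) refl)
    where
    w∉path : w ∉ q ∷ p ∷ rest
    w∉path (here refl) = adj⇒≢ H qw refl
    w∉path (there (here refl)) = w≢p refl
    w∉path (there (there w∈)) = w∉ w∈
    q∉ : Unique (q ∷ p ∷ rest) → All (q ≢_) (p ∷ rest)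
    q∉ (q∉ ∷ _) = q∉

-- From an unfillable hole to an obstruction

module Obstruct {V : Set} (F : Finite V) (H : Graph V) (deg : ∀ u → DegreeAtMost 3 H u)
            {P : Precoloring V 4} (precoloring : IsProperPrecoloring H P) where
  open Finite F
  open Hole F H deg precoloring
  open Partial
  open Walk F H deg precoloring

  record Docked (φ : Colouring) (k l : V) : Set where
    field
      partial : Partial φ k l
      stuck : Blocked φ k l
      deadEnd : DeadEnd k l
      leaf : Leaf P l
      seenα : seen φ l k (Leaf.α leaf) ≡ true
      seenβ : seen φ l k (Leaf.β leaf) ≡ true

    ahead : Open l k
    ahead = open-flip (hole partial)

    seen-only : ∀ {i} → seen φ l k i ≡ true → i ≢ Leaf.α leaf → i ≢ Leaf.β leaf → ⊥
    seen-only s i≢α i≢β = seen-noThree {φ = φ} (proj₁ ahead) i≢α i≢β (Leaf.α≢β leaf) (unsee s) (unsee seenα) (unsee seenβ)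

  -- A blocked hole forks at `l`, and at a dead end both branches of the fork are precoloured.
  dock : ∀ {φ k l} → Partial φ k l → DeadEnd k l → Extension H P ⊎ Docked φ k l
  dock {φ} {k} {l} π dead with fill-or-blocked π
  ... | inj₁ done = inj₁ done
  ... | inj₂ stuck = inj₂ record
      { partial = π ; stuck = stuck ; deadEnd = dead
      ; leaf = record { a≢b = f.a≢b ; α≢β = f.colours≢ ; la = coloured f.qa f.a≢p ; lb = coloured f.qb f.b≢p }
      ; seenα = see {φ = φ} (via f.a f.qa f.a≢p refl) ; seenβ = see {φ = φ} (via f.b f.qb f.b≢p refl) }
    where
    module f = Fork (fork π stuck)
    coloured : ∀ {x} → Adj H l x → x ≢ k → Coloured P l x (φ l x)
    coloured lx x≢k with dead lx x≢k
    ... | i , c = subst (Coloured P l _) (≡-sym (extends π c)) c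

  record Stage {φ : Colouring} {k l : V} (start : Docked φ k l) : Set where
    open Docked
    field
      {φ′} : Colouring
      {k′ l′} : V
      end : Docked φ′ k′ l′
      l′≢l : l′ ≢ l
      compatible : Compatible (Leaf.α (leaf start)) (Leaf.β (leaf start)) (Leaf.α (leaf end)) (Leaf.β (leaf end))
      obstacle : (∃ λ l₃ → l₃ ≢ l × l₃ ≢ l′ × Leaf P l₃) ⊎ Foot H P (leaf end)

  -- The hole is pulled back from `l′` to `kk′` and sent out along a further uncoloured edge `kx`,
  -- with the old route behind it. The only uncoloured edge at `l′` leads to `k`, which is then
  -- behind the front, so the new walk cannot end in `l′`; nor in `l`, which it has passed.
  third : ∀ {φ k l l′ rest} → Path φ k l′ rest → DeadEnd k l′ → l ∈ k ∷ rest → Leaf P l →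
          ∀ {x} → Open k x → x ≢ l′ → (∀ {k′ rest′} → rest ≡ k′ ∷ rest′ → x ≢ k′) → rest ≢ [] →
          Extension H P ⊎ (∃ λ l₃ → l₃ ≢ l × l₃ ≢ l′ × Leaf P l₃)
  third {rest = []} _ _ _ _ _ _ _ ne = ⊥-elim (ne refl)
  third {φ} {k} {l} {l′} {k′ ∷ rest} path dead l∈ leaf {x} kx x≢l′ x≢k′ _
    with Path.linked path | Path.unique path
  ... | l′k ∷ kk′ ∷ link | (l′≢k ∷ l′≢k′ ∷ l′∉) ∷ (k≢k′ ∷ k∉) ∷ uniq
    with push (partial-flip (Path.partial path)) kk′ (≢-sym l′≢k′)
  ... | inj₁ done = inj₁ done
  ... | inj₂ m with x ∈? rest
  ... | yes x∈ = inj₁ (cycle rest (Moved.partial m) link ((k≢k′ ∷ k∉) ∷ uniq) x∈ kx)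
  ... | no x∉ with push (partial-flip (Moved.partial m)) kx (x≢k′ refl)
  ... | inj₁ done = inj₁ done
  ... | inj₂ m′ with walk (length elements) {A = seen (Moved.ψ m′) x k} {b = false} {Avoid = _≡ l′}
                       (ℕ.m≤n+m (length elements) _)
                       (advance back kx x∉path m′) (λ _ → refl) l∈ closed x≢l′
    where
    back : Path (Moved.ψ m) k′ k rest
    back = record { partial = partial-flip (Moved.partial m) ; linked = kk′ ∷ link ; unique = (k≢k′ ∷ k∉) ∷ uniq }
    x∉path : x ∉ k ∷ k′ ∷ rest
    x∉path (here refl) = adj⇒≢ H (proj₁ kx) refl
    x∉path (there (here refl)) = x≢k′ refl refl
    x∉path (there (there x∈)) = x∉ x∈
    closed : ∀ {u v} → v ≡ l′ → Open u v → u ∈ k ∷ k′ ∷ rest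
    closed {u} refl ul′ with u ≟ k
    ... | yes refl = here refl
    ... | no u≢k = ⊥-elim (proj₂ (open-flip ul′) (dead (proj₁ (open-flip ul′)) u≢k))
  ... | inj₁ done = inj₁ done
  ... | inj₂ w with dock (Path.partial (Walked.path w)) (Walked.deadEnd w)
  ... | inj₁ done = inj₁ done
  ... | inj₂ d = inj₂ (Walked.q w , fresh , Walked.avoided w , Docked.leaf d)
    where
    fresh : Walked.q w ≢ l
    fresh refl with Path.unique (Walked.path w)
    ... | q∉ ∷ _ = All.lookup q∉ (Walked.passed w) refl

  -- Parity `false` means equal palettes, `true` complementary ones; a docked leaf sees just its two
  -- precoloured colours, so the comparison descends to them.
  compatible-palettes : ∀ {φ k l φ′ k′ l′} (d : Docked φ k l) (d′ : Docked φ′ k′ l′) b →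
    (∀ i → seen φ′ l′ k′ i ≡ b xor seen φ l k i) →
    let open Docked in Compatible (Leaf.α (leaf d)) (Leaf.β (leaf d)) (Leaf.α (leaf d′)) (Leaf.β (leaf d′))
  compatible-palettes d d′ false eq
    with Leaf.α (Docked.leaf d′) ≟ᶠ Leaf.α (Docked.leaf d) | Leaf.α (Docked.leaf d′) ≟ᶠ Leaf.β (Docked.leaf d)
       | Leaf.β (Docked.leaf d′) ≟ᶠ Leaf.α (Docked.leaf d) | Leaf.β (Docked.leaf d′) ≟ᶠ Leaf.β (Docked.leaf d)
  ... | yes p | _ | _ | yes q = same p q
  ... | _ | yes p | yes q | _ = crossed p q
  ... | yes p | _ | yes q | _ = ⊥-elim (Leaf.α≢β (Docked.leaf d′) (trans p (≡-sym q)))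
  ... | _ | yes p | _ | yes q = ⊥-elim (Leaf.α≢β (Docked.leaf d′) (trans p (≡-sym q)))
  ... | no p | no q | _ | _ = ⊥-elim (Docked.seen-only d (trans (≡-sym (eq _)) (Docked.seenα d′)) p q)
  ... | _ | _ | no p | no q = ⊥-elim (Docked.seen-only d (trans (≡-sym (eq _)) (Docked.seenβ d′)) p q)
  compatible-palettes {φ} {k} {l} {φ′} {k′} {l′} d d′ true eq =
    disjoint (apart (Docked.seenα d′) (Docked.seenα d)) (apart (Docked.seenα d′) (Docked.seenβ d))
             (apart (Docked.seenβ d′) (Docked.seenα d)) (apart (Docked.seenβ d′) (Docked.seenβ d))
    where
    apart : ∀ {i j} → seen φ′ l′ k′ i ≡ true → seen φ l k j ≡ true → i ≢ j
    apart s t refl with trans (≡-sym s) (trans (eq _) (cong not t))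
    ... | ()

  -- The vertex `k` before the leaf forks. A precoloured branch is a foot, since blocked palettes
  -- are disjoint. If both branches are uncoloured, one of them differs from the edge by which the
  -- route came, and `third` follows it.
  obstacle-at : ∀ {φ k l l′ rest} → Path φ k l′ rest → l ∈ k ∷ rest → Leaf P l → (d : Docked φ k l′) →
    Extension H P ⊎ (∃ λ l₃ → l₃ ≢ l × l₃ ≢ l′ × Leaf P l₃) ⊎ Foot H P (Docked.leaf d)
  obstacle-at {φ} {k} {l} {l′} {rest} path l∈ leaf d =
    split (coloured? _≟_ k f.a) (coloured? _≟_ k f.b)
    where
    open Docked d using (stuck; ahead; seenα; seenβ; deadEnd) renaming (partial to π)
    module f = Fork (fork (partial-flip π) (blocked-flip stuck))
    foot : ∀ {x i} → Adj H k x → x ≢ l′ → Coloured P k x i → Foot H P (Docked.leaf d)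
    foot {x} {i} kx x≢l′ c = record
      { adjacent = proj₁ ahead ; uncoloured = proj₂ ahead ; coloured = c ; i≢α = absent seenα ; i≢β = absent seenβ }
      where
      absent : ∀ {j} → seen φ l′ k j ≡ true → i ≢ j
      absent s refl = Blocked.disjoint stuck i (via x kx x≢l′ (extends π c)) (unsee s)
    Result = Extension H P ⊎ (∃ λ l₃ → l₃ ≢ l × l₃ ≢ l′ × Leaf P l₃) ⊎ Foot H P (Docked.leaf d)
    branch : ∀ {rest} → Path φ k l′ rest → l ∈ k ∷ rest → ¬ ∃ (Coloured P k f.a) → ¬ ∃ (Coloured P k f.b) → Result
    -- Here `k` is the starting leaf, which would have four neighbours: `l′`, the uncoloured branch
    -- and the ends of two precoloured edges.
    branch {[]} _ (here refl) ¬a ¬b = ⊥-elim (neighbours≤3 H (deg l) (adj-sym H (proj₁ ahead)) f.qa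
      (coloured-adj precoloring (Leaf.la leaf)) (coloured-adj precoloring (Leaf.lb leaf))
      (≢-sym f.a≢p) (apart (proj₂ (hole π)) (Leaf.la leaf)) (apart (proj₂ (hole π)) (Leaf.lb leaf))
      (apart ¬a (Leaf.la leaf)) (apart ¬a (Leaf.lb leaf)) (Leaf.a≢b leaf))
      where
      apart : ∀ {x y i} → ¬ ∃ (Coloured P l x) → Coloured P l y i → x ≢ y
      apart ¬c c refl = ¬c (_ , c)
    branch {k′ ∷ _} path l∈ ¬a ¬b = case f.a ≟ k′ of λ where
      (no a≢k′) → map₂ inj₁ (third path deadEnd l∈ leaf (f.qa , ¬a) f.a≢p (λ { refl → a≢k′ }) λ ())
      (yes a≡k′) → map₂ inj₁ (third path deadEnd l∈ leaf (f.qb , ¬b) f.b≢p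
                     (λ { refl b≡k′ → f.a≢b (trans a≡k′ (≡-sym b≡k′)) }) λ ())
    split : Dec (∃ (Coloured P k f.a)) → Dec (∃ (Coloured P k f.b)) → Result
    split (yes (_ , c)) _ = inj₂ (inj₂ (foot f.qa f.a≢p c))
    split (no _) (yes (_ , c)) = inj₂ (inj₂ (foot f.qb f.b≢p c))
    split (no ¬a) (no ¬b) = branch path l∈ ¬a ¬b

  start-path : ∀ {φ p q} → Partial φ p q → Path φ p q []
  start-path π = record { partial = π ; linked = open-flip (hole π) ∷ [-]
                        ; unique = (≢-sym (adj⇒≢ H (proj₁ (hole π))) ∷ []) ∷ [] ∷ [] }

  -- The hole is turned round and leaves its leaf through `k`. The reference is the palette of `l`,
  -- and `k` shows its complement, so the walk starts with parity `true`.
  stage : ∀ {φ k l} (d : Docked φ k l) → Extension H P ⊎ Stage d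
  stage {φ} {k} {l} d with walk (length elements) {A = seen φ l k} {b = true} {Avoid = λ _ → ⊥} (ℕ.m≤n+m _ 0)
      (start-path (partial-flip (Docked.partial d))) (blocked-seen (blocked-flip (Docked.stuck d))) (here refl) (λ ()) (λ ())
  ... | inj₁ done = inj₁ done
  ... | inj₂ w with dock (Path.partial (Walked.path w)) (Walked.deadEnd w)
  ... | inj₁ done = inj₁ done
  ... | inj₂ d′ with obstacle-at (Walked.path w) (Walked.passed w) (Docked.leaf d) d′
  ... | inj₁ done = inj₁ done
  ... | inj₂ obstacle = inj₂ record
      { end = d′ ; l′≢l = λ { refl → fresh (Path.unique (Walked.path w)) (Walked.passed w) }
      ; compatible = compatible-palettes d d′ (Walked.parity w) (Walked.front w) ; obstacle = obstacle }
    where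
    fresh : ∀ {x vs} → Unique (x ∷ vs) → x ∉ vs
    fresh (x∉ ∷ _) x∈ = All.lookup x∉ x∈ refl

  -- A foot is produced only at the end of a stage. The first leaf is reached by a plain walk, so
  -- the hole goes from it to a second leaf and, if that has a foot, on to another one: the last two
  -- leaves then both have feet unless a third leaf has turned up.
  fill-or-obstruct : ∀ {φ p q} → Partial φ p q → Extension H P ⊎ Obstruction H P
  fill-or-obstruct {φ} {p} {q} π with walk (length elements) {A = seen φ q p} {b = false} {Avoid = λ _ → ⊥} (ℕ.m≤n+m _ 0)
      (start-path π) (λ _ → refl) (here refl) (λ ()) (λ ())
  ... | inj₁ done = inj₁ done
  ... | inj₂ w with dock (Path.partial (Walked.path w)) (Walked.deadEnd w)
  ... | inj₁ done = inj₁ done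
  ... | inj₂ d with stage d
  ... | inj₁ done = inj₁ done
  ... | inj₂ s with Stage.obstacle s
  ... | inj₁ l₃ = inj₂ record { l₁≢l₂ = ≢-sym (Stage.l′≢l s) ; leaf₁ = Docked.leaf d
          ; leaf₂ = Docked.leaf (Stage.end s) ; compatible = Stage.compatible s ; obstacle = inj₁ l₃ }
  ... | inj₂ foot with stage (Stage.end s)
  ... | inj₁ done = inj₁ done
  ... | inj₂ s′ = inj₂ record { l₁≢l₂ = ≢-sym (Stage.l′≢l s′) ; leaf₁ = Docked.leaf (Stage.end s)
          ; leaf₂ = Docked.leaf (Stage.end s′) ; compatible = Stage.compatible s′
          ; obstacle = map₂ (foot ,_) (Stage.obstacle s′) }

-- Colouring a graph edge by edge

∧-true : ∀ {a b} → a ∧ b ≡ true → a ≡ true × b ≡ true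
∧-true {true} {true} _ = refl , refl

true-∧ : ∀ {a b} → a ≡ true → b ≡ true → a ∧ b ≡ true
true-∧ refl refl = refl

extension-mono : {V : Set} {k : ℕ} {G H : Graph V} {P : Precoloring V k} →
                 (∀ {u v} → Adj H u v → Adj G u v) → Extension G P → Extension H P
extension-mono H⊆G (φ , ok , ext) =
  φ , record { symmetric = λ u v uv → symmetric u v (H⊆G uv)
             ; proper = λ u v w uv uw → proper u v w (H⊆G uv) (H⊆G uw) } , ext
  where open IsProperEdgeColoring ok

foot-mono : {V : Set} {k : ℕ} {G H : Graph V} {P : Precoloring V k} {l : V} {leaf : Leaf P l} →
            (∀ {u v} → Adj H u v → Adj G u v) → Foot H P leaf → Foot G P leaf
foot-mono H⊆G f = record
  { adjacent = H⊆G adjacent ; uncoloured = uncoloured ; coloured = coloured ; i≢α = i≢α ; i≢β = i≢β }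
  where open Foot f

obstruction-mono : {V : Set} {k : ℕ} {G H : Graph V} {P : Precoloring V k} →
                   (∀ {u v} → Adj H u v → Adj G u v) → Obstruction H P → Obstruction G P
obstruction-mono H⊆G o = record
  { l₁≢l₂ = l₁≢l₂ ; leaf₁ = leaf₁ ; leaf₂ = leaf₂ ; compatible = compatible
  ; obstacle = map₂ (λ (f , f′) → foot-mono H⊆G f , foot-mono H⊆G f′) obstacle }
  where open Obstruction o

module Build {V : Set} (F : Finite V) (G : Graph V) (deg : ∀ u → DegreeAtMost 3 G u)
             {P : Precoloring V 4} (precoloring : IsProperPrecoloring G P) where
  open Finite F

  Kept : List (V × V) → V → V → Set
  Kept L u v = ∃ (Coloured P u v) ⊎ Any (λ e → SameEdge e (u , v)) L

  kept? : ∀ L u v → Dec (Kept L u v)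
  kept? L u v = coloured? _≟_ u v ⊎-dec any? (λ e → sameEdge? _≟_ e (u , v)) L

  kept-flip : ∀ {L u v} → Kept L u v → Kept L v u
  kept-flip (inj₁ (i , c)) = inj₁ (i , coloured-flip c)
  kept-flip (inj₂ m) = inj₂ (Any.map sameEdge-flip m)

  -- The precoloured edges belong to every stage, so that the precolouring is proper in each of
  -- them.
  sub : List (V × V) → Graph V
  sub L = record
    { adj = λ u v → adj G u v ∧ does (kept? L u v)
    ; sym = λ u v → cong₂ _∧_ (sym G u v) (does-⇔ (kept? L u v) (kept? L v u) kept-flip kept-flip)
    ; irrefl = λ u → cong (_∧ does (kept? L u u)) (irrefl G u) }

  sub-adj : ∀ L {u v} → Adj G u v → Kept L u v → Adj (sub L) u v
  sub-adj L {u} {v} uv m = true-∧ uv (dec-true (kept? L u v) m)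

  sub-⊆ : ∀ {L u v} → Adj (sub L) u v → Adj G u v
  sub-⊆ {u = u} {v} a = proj₁ (∧-true {adj G u v} a)

  sub-kept : ∀ {L u v} → Adj (sub L) u v → Kept L u v
  sub-kept {L} {u} {v} a = does⇒ (kept? L u v) (proj₂ (∧-true {adj G u v} a))

  sub-degree : ∀ L u → DegreeAtMost 3 (sub L) u
  sub-degree L u vs uniq adjs = deg u vs uniq (All.map (sub-⊆ {L}) adjs)

  sub-precoloring : ∀ L → IsProperPrecoloring (sub L) P
  sub-precoloring L = record
    { areEdges = λ m → sub-adj L (IsProperPrecoloring.areEdges precoloring m) (inj₁ (_ , _ , m , sameEdge-refl))
    ; consistent = IsProperPrecoloring.consistent precoloring
    ; proper = IsProperPrecoloring.proper precoloring }

  none : Extension (sub []) P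
  none = φ , record { symmetric = λ u v uv → flat (colour uv) ; proper = λ u v w uv uw v≢w → apart (colour uv) (colour uw) v≢w }
           , λ m → agrees (_ , m , sameEdge-refl)
    where
    φ : V → V → Fin 4
    φ u v with coloured? {P = P} _≟_ u v
    ... | yes (i , _) = i
    ... | no _ = zero
    agrees : ∀ {u v i} → Coloured P u v i → φ u v ≡ i
    agrees {u} {v} c with coloured? {P = P} _≟_ u v
    ... | yes (i , c′) = coloured-functional precoloring c′ c
    ... | no ¬c = contradiction (_ , c) ¬c
    colour : ∀ {u v} → Adj (sub []) u v → ∃ (Coloured P u v)
    colour a with sub-kept {[]} a
    ... | inj₁ c = c
    flat : ∀ {u v} → ∃ (Coloured P u v) → φ u v ≡ φ v u
    flat (i , c) = trans (agrees c) (≡-sym (agrees (coloured-flip c)))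
    apart : ∀ {u v w} → ∃ (Coloured P u v) → ∃ (Coloured P u w) → v ≢ w → φ u v ≢ φ u w
    apart (i , c) (j , c′) v≢w e =
      coloured-proper precoloring c c′ v≢w (trans (≡-sym (agrees c)) (trans e (agrees c′)))

  -- The edge added is the hole of the next stage. An obstruction found in a subgraph is one of `G`,
  -- since it only asks for edges to be present.
  build : ∀ L → Extension (sub L) P ⊎ Obstruction G P
  build [] = inj₁ none
  build ((a , b) ∷ L) with build L
  ... | inj₂ o = inj₂ o
  ... | inj₁ ext with adj? G a b ×-dec ¬? (kept? L a b)
  ... | no old = inj₁ (extension-mono shrink ext)
    where
    shrink : ∀ {u v} → Adj (sub ((a , b) ∷ L)) u v → Adj (sub L) u v
    shrink {u} {v} uv with sub-kept {(a , b) ∷ L} uv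
    ... | inj₁ c = sub-adj L (sub-⊆ {(a , b) ∷ L} uv) (inj₁ c)
    ... | inj₂ (there m) = sub-adj L (sub-⊆ {(a , b) ∷ L} uv) (inj₂ m)
    ... | inj₂ (here s) = sub-adj L (sub-⊆ {(a , b) ∷ L} uv) (along s (decidable-stable (kept? L a b)
            λ n → old (adj-sameEdge G (sameEdge-sym s) (sub-⊆ {(a , b) ∷ L} uv) , n)))
      where
      along : ∀ {x y} → SameEdge (a , b) (x , y) → Kept L a b → Kept L x y
      along (inj₁ (refl , refl)) m = m
      along (inj₂ (refl , refl)) m = kept-flip m
  ... | yes (ab , new) = map₂ (obstruction-mono (sub-⊆ {(a , b) ∷ L})) (fill-or-obstruct π)
    where
    H = sub ((a , b) ∷ L)
    open Hole F H (sub-degree ((a , b) ∷ L)) (sub-precoloring ((a , b) ∷ L))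
    open Obstruct F H (sub-degree ((a , b) ∷ L)) (sub-precoloring ((a , b) ∷ L))
    φ = proj₁ ext
    φ-ok = proj₁ (proj₂ ext)
    older : ∀ {u v} → Adj H u v → ¬ SameEdge (a , b) (u , v) → Adj (sub L) u v
    older uv n with sub-kept {(a , b) ∷ L} uv
    ... | inj₁ c = sub-adj L (sub-⊆ {(a , b) ∷ L} uv) (inj₁ c)
    ... | inj₂ (there m) = sub-adj L (sub-⊆ {(a , b) ∷ L} uv) (inj₂ m)
    ... | inj₂ (here s) = contradiction s n
    off : ∀ {u v i} → Coloured P u v i → ¬ SameEdge (a , b) (u , v)
    off c (inj₁ (refl , refl)) = new (inj₁ (_ , c))
    off c (inj₂ (refl , refl)) = new (inj₁ (_ , coloured-flip c))
    given : ∀ {u v i} → Coloured P u v i → φ u v ≡ i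
    given (e , m , inj₁ (refl , refl)) = proj₂ (proj₂ ext) m
    given c@(e , m , inj₂ (refl , refl)) =
      trans (IsProperEdgeColoring.symmetric φ-ok _ _ (coloured-adj (sub-precoloring L) c)) (proj₂ (proj₂ ext) m)
    symm : ∀ {u v} → Adj H u v → paint φ a b zero u v ≡ paint φ a b zero v u
    symm {u} {v} uv = case sameEdge? _≟_ (a , b) (u , v) of λ where
      (yes s) → trans (paint-on {φ = φ} s) (≡-sym (paint-on {φ = φ} (sameEdge-flip s)))
      (no n) → trans (paint-off n) (trans (IsProperEdgeColoring.symmetric φ-ok _ _ (older uv n))
                 (≡-sym (paint-off {φ = φ} (λ s → n (sameEdge-flip s)))))
    -- `φ` need not be symmetric on the new edge, which the previous stage lacks; painting it with
    -- an arbitrary colour repairs this.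
    π : Partial (paint φ a b zero) a b
    π = record
      { hole = sub-adj ((a , b) ∷ L) ab (inj₂ (here sameEdge-refl)) , λ c → new (inj₁ c)
      ; symmetric = symm
      ; extends = λ c → trans (paint-off (off c)) (given c)
      ; proper = λ uv uw v≢w n n′ e → IsProperEdgeColoring.proper φ-ok _ _ _ (older uv n) (older uw n′) v≢w
          (trans (≡-sym (paint-off n)) (trans e (paint-off n′))) }

  extend-or-obstruct : Extension G P ⊎ Obstruction G P
  extend-or-obstruct with build (cartesianProduct elements elements)
  ... | inj₂ o = inj₂ o
  ... | inj₁ ext = inj₁ (extension-mono (λ uv → sub-adj (cartesianProduct elements elements) uv
    (inj₂ (lose (∈-cartesianProduct⁺ (complete _) (complete _)) sameEdge-refl))) ext)

-- Counting precoloured edges: three do not obstruct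

record Entry {V : Set} {k : ℕ} (P : Precoloring V k) : Set where
  constructor entry
  field
    {u v} : V
    {i} : Fin k
    coloured : Coloured P u v i

Distinct : {V : Set} {k : ℕ} {P : Precoloring V k} → Entry P → Entry P → Set
Distinct x y = ¬ SameEdge (Entry.u x , Entry.v x) (Entry.u y , Entry.v y)

distinct-entries : {V : Set} {k : ℕ} {P : Precoloring V k} (xs : List (Entry P)) →
                   AllPairs Distinct xs → length xs ≤ length P
distinct-entries {P = P} xs pairs = subst (_≤ length P) (length-map source xs)
  (unique-⊆-length (AllPairsₚ.map⁺ (AllPairs.map (λ {x} {y} → apart {x} {y}) pairs)) member)
  where
  source = λ (x : Entry P) → proj₁ (Entry.coloured x) , Entry.i x
  member : ∀ {q} → q ∈ map source xs → q ∈ P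
  member q∈ with ∈-map⁻ source q∈
  ... | x , _ , refl = proj₁ (proj₂ (Entry.coloured x))
  apart : ∀ {x y} → Distinct x y → source x ≢ source y
  apart {x} {y} d e = d (sameEdge-trans (sameEdge-sym (proj₂ (proj₂ (Entry.coloured x))))
    (subst (λ e → SameEdge e (Entry.u y , Entry.v y)) (≡-sym (cong proj₁ e)) (proj₂ (proj₂ (Entry.coloured y)))))

flipˡ : ∀ {k} {α β α′ β′ : Fin k} → Compatible α β α′ β′ → Compatible β α α′ β′
flipˡ (same p q) = crossed p q
flipˡ (crossed p q) = same p q
flipˡ (disjoint p q r s) = disjoint q p s r

flipʳ : ∀ {k} {α β α′ β′ : Fin k} → Compatible α β α′ β′ → Compatible α β β′ α′
flipʳ (same p q) = crossed q p
flipʳ (crossed p q) = same q p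
flipʳ (disjoint p q r s) = disjoint r s p q

shared-colour : ∀ {k} {p α β : Fin k} → Compatible p α p β → p ≢ α → α ≡ β
shared-colour (same _ q) _ = ≡-sym q
shared-colour (crossed p _) p≢α = contradiction p p≢α
shared-colour (disjoint n _ _ _) _ = contradiction refl n

module _ {V : Set} {k : ℕ} {G : Graph V} {P : Precoloring V k} (_≟_ : DecidableEquality V)
         (precoloring : IsProperPrecoloring G P) where

  coloured-along : ∀ {u v x y i j} → SameEdge (u , v) (x , y) → Coloured P u v i → Coloured P x y j → i ≡ j
  coloured-along s (e , m , s′) c = coloured-functional precoloring (e , m , sameEdge-trans s′ s) c

  module _ (few : length P ≤ 3) (o : Obstruction G P) where
    open Obstruction o
    private
      module L₁ = Leaf leaf₁
      module L₂ = Leaf leaf₂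

      apart : ∀ {a b l} → a ≢ b → ¬ SameEdge {V} (l , a) (l , b)
      apart a≢b s = a≢b (sameEdge-cancel s)

      -- The three entries are used up by `l₁l₂`, `l₁b₁` and `l₂b₂`, coloured `p`, `q` and `q`. A
      -- third leaf is off `l₁l₂` and would see only `q`; a foot needs a colour other than `p` and
      -- `q`.
      finish : ∀ {b₁ b₂ p q₁ q₂} → Coloured P l₁ l₂ p → Coloured P l₁ b₁ q₁ → Coloured P l₂ b₂ q₂ →
               b₁ ≢ l₂ → b₂ ≢ l₁ → q₁ ≡ q₂ →
               (∀ {i} → i ≢ L₁.α → i ≢ L₁.β → i ≢ p × i ≢ q₁) → ⊥
      finish {b₁} {b₂} {p} {q} c c₁ c₂ b₁≢ b₂≢ refl palette = final obstacle
        where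
        known : ∀ {x y i} → Coloured P x y i → SameEdge (l₁ , l₂) (x , y) ⊎ i ≡ q
        known {x} {y} d with sameEdge? _≟_ (l₁ , l₂) (x , y) | sameEdge? _≟_ (l₁ , b₁) (x , y) | sameEdge? _≟_ (l₂ , b₂) (x , y)
        ... | yes s | _ | _ = inj₁ s
        ... | no _ | yes s | _ = inj₂ (≡-sym (coloured-along s c₁ d))
        ... | no _ | no _ | yes s = inj₂ (≡-sym (coloured-along s c₂ d))
        ... | no n | no n₁ | no n₂ = ⊥-elim (ℕ.<⇒≱ (s≤s few) (distinct-entries (entry c ∷ entry c₁ ∷ entry c₂ ∷ entry d ∷ [])
                (((λ s → b₁≢ (≡-sym (sameEdge-cancel s))) ∷ (λ s → b₂≢ (≡-sym (sameEdge-cancel (sameEdge-trans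
                      (sameEdge-sym (sameEdge-flip sameEdge-refl)) s)))) ∷ n ∷ []) ∷
                 ((λ { (inj₁ (e , _)) → l₁≢l₂ e ; (inj₂ (e , _)) → b₂≢ (≡-sym e) }) ∷ n₁ ∷ []) ∷ (n₂ ∷ []) ∷ [] ∷ [])))
        at-third : ∀ {l₃ x i} → l₃ ≢ l₁ → l₃ ≢ l₂ → Coloured P l₃ x i → i ≡ q
        at-third n n′ d with known d
        ... | inj₂ e = e
        ... | inj₁ (inj₁ (e , _)) = contradiction (≡-sym e) n
        ... | inj₁ (inj₂ (_ , e)) = contradiction (≡-sym e) n′
        final : (∃ λ l₃ → l₃ ≢ l₁ × l₃ ≢ l₂ × Leaf P l₃) ⊎ (Foot G P leaf₁ × Foot G P leaf₂) → ⊥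
        final (inj₁ (l₃ , n , n′ , leaf)) = Leaf.α≢β leaf (trans (at-third n n′ (Leaf.la leaf)) (≡-sym (at-third n n′ (Leaf.lb leaf))))
        final (inj₂ (foot , _)) with known (Foot.coloured foot) | palette (Foot.i≢α foot) (Foot.i≢β foot)
        ... | inj₂ e | _ , n = n e
        ... | inj₁ s | n , _ = n (≡-sym (coloured-along s c (Foot.coloured foot)))

      back : ∀ {x i} → x ≡ l₁ → Coloured P l₂ x i → Coloured P l₁ l₂ i
      back refl c = coloured-flip c

    -- Two leaves take four precoloured edges unless `l₁l₂` is one of them. In that case the
    -- palettes meet, so compatibility makes them equal.
    few⇒unobstructed : ⊥
    few⇒unobstructed with L₁.a ≟ l₂ | L₁.b ≟ l₂ | L₂.a ≟ l₁ | L₂.b ≟ l₁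
    ... | yes refl | _ | yes refl | _ with refl ← coloured-functional precoloring L₁.la (back refl L₂.la) =
      finish L₁.la L₁.lb L₂.lb (≢-sym L₁.a≢b) (≢-sym L₂.a≢b) (shared-colour compatible L₁.α≢β) _,_
    ... | yes refl | _ | _ | yes refl with refl ← coloured-functional precoloring L₁.la (back refl L₂.lb) =
      finish L₁.la L₁.lb L₂.la (≢-sym L₁.a≢b) L₂.a≢b (shared-colour (flipʳ compatible) L₁.α≢β) _,_
    ... | _ | yes refl | yes refl | _ with refl ← coloured-functional precoloring L₁.lb (back refl L₂.la) =
      finish L₁.lb L₁.la L₂.lb L₁.a≢b (≢-sym L₂.a≢b) (shared-colour (flipˡ compatible) (≢-sym L₁.α≢β)) (λ p q → q , p)
    ... | _ | yes refl | _ | yes refl with refl ← coloured-functional precoloring L₁.lb (back refl L₂.lb) =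
      finish L₁.lb L₁.la L₂.la L₁.a≢b L₂.a≢b (shared-colour (flipˡ (flipʳ compatible)) (≢-sym L₁.α≢β)) (λ p q → q , p)
    ... | no p | no q | _ | _ = ⊥-elim (ℕ.<⇒≱ (s≤s few) (distinct-entries
      (entry L₁.la ∷ entry L₁.lb ∷ entry L₂.la ∷ entry L₂.lb ∷ [])
      ((apart L₁.a≢b ∷ cross p ∷ cross p ∷ []) ∷ (cross q ∷ cross q ∷ []) ∷ (apart L₂.a≢b ∷ []) ∷ [] ∷ [])))
      where
      cross : ∀ {x y} → x ≢ l₂ → ¬ SameEdge (l₁ , x) (l₂ , y)
      cross n (inj₁ (e , _)) = l₁≢l₂ e
      cross n (inj₂ (_ , e)) = n e
    ... | _ | _ | no p | no q = ⊥-elim (ℕ.<⇒≱ (s≤s few) (distinct-entries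
      (entry L₁.la ∷ entry L₁.lb ∷ entry L₂.la ∷ entry L₂.lb ∷ [])
      ((apart L₁.a≢b ∷ cross p ∷ cross q ∷ []) ∷ (cross p ∷ cross q ∷ []) ∷ (apart L₂.a≢b ∷ []) ∷ [] ∷ [])))
      where
      cross : ∀ {x y} → y ≢ l₁ → ¬ SameEdge (l₁ , x) (l₂ , y)
      cross n (inj₁ (e , _)) = l₁≢l₂ e
      cross n (inj₂ (e , _)) = n (≡-sym e)

-- Matchings and pendant edges

On : {V : Set} → List (V × V) → V → V → Set
On M u v = Any (λ e → SameEdge e (u , v)) M

on-flip : {V : Set} {M : List (V × V)} {u v : V} → On M u v → On M v u
on-flip = Any.map sameEdge-flip

on? : {V : Set} → DecidableEquality V → (M : List (V × V)) → ∀ u v → Dec (On M u v)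
on? _≟_ M u v = any? (λ e → sameEdge? _≟_ e (u , v)) M

module _ {V : Set} (R : V → V → Set) (R? : ∀ u v → Dec (R u v))
         (R-sym : ∀ {u v} → R u v → R v u) (R-irrefl : ∀ {u} → ¬ R u u) where

  relationGraph : Graph V
  relationGraph = record
    { adj = λ u v → does (R? u v)
    ; sym = λ u v → does-⇔ (R? u v) (R? v u) R-sym R-sym
    ; irrefl = λ u → dec-false (R? u u) R-irrefl }

-- The inverse of `punchIn c` on the colours other than `c`; its value at `c` is a default.
squeeze : Fin 5 → Fin 5 → Fin 4
squeeze c i with c ≟ᶠ i
... | yes _ = zero
... | no c≢i = punchOut c≢i

punchIn-squeeze : ∀ {c i} → i ≢ c → punchIn c (squeeze c i) ≡ i
punchIn-squeeze {c} {i} i≢c with c ≟ᶠ i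
... | yes c≡i = contradiction (≡-sym c≡i) i≢c
... | no c≢i = punchIn-punchOut c≢i

squeeze-injective : ∀ {c i j} → i ≢ c → j ≢ c → squeeze c i ≡ squeeze c j → i ≡ j
squeeze-injective {c} i≢c j≢c e =
  trans (≡-sym (punchIn-squeeze i≢c)) (trans (cong (punchIn c) e) (punchIn-squeeze j≢c))

-- `(u , t) ∈ D` stands for a pendant edge of colour `t` at `u`, that is, for the demand that no
-- edge of the layer at `u` gets `t`. `D-degree` makes room for it: a neighbour is missing, or an
-- edge of `M` will be removed.
record Pendants {V : Set} (G : Graph V) (base : Fin 5) (M : List (V × V))
                (D : List (V × Fin 5)) (P : Precoloring V 5) : Set where
  field
    M-edges : ∀ {u v} → On M u v → Adj G u v
    M-matching : ∀ {u v w} → On M u v → On M u w → v ≡ w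
    D-colours : ∀ {u t} → (u , t) ∈ D → t ≢ base
    D-functional : ∀ {u t t′} → (u , t) ∈ D → (u , t′) ∈ D → t ≡ t′
    D-degree : ∀ {u t} → (u , t) ∈ D → DegreeAtMost 2 G u ⊎ ∃ (On M u)
    P-proper : IsProperPrecoloring G P
    P-colours : ∀ {e i} → (e , i) ∈ P → i ≢ base
    P-off-M : ∀ {u v i} → Coloured P u v i → ¬ On M u v
    P-D : ∀ {u v i t} → Coloured P u v i → (u , t) ∈ D → t ≢ i

record LayerColouring {V : Set} (G : Graph V) (base : Fin 5) (M : List (V × V))
                      (D : List (V × Fin 5)) (P : Precoloring V 5) : Set where
  field
    φ : V → V → Fin 5
    proper : IsProperEdgeColoring G 5 φ
    extends : Extends φ P
    on-M : ∀ {u v} → On M u v → φ u v ≡ base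
    off-M : ∀ {u v} → ¬ On M u v → φ u v ≢ base
    avoids : ∀ {u v t} → (u , t) ∈ D → Adj G u v → φ u v ≢ t

-- A vertex carries at most one pendant edge, so of the two precoloured edges of a leaf at least one
-- lies in `G`. The pendant colour is listed first.
PendantKind : {V : Set} → List (V × Fin 5) → Precoloring V 5 → V → Fin 5 → Fin 5 → Set
PendantKind D P l α β = ((l , α) ∈ D × ∃ λ b → Coloured P l b β) ⊎
                        (∃₂ λ a b → a ≢ b × Coloured P l a α × Coloured P l b β)

record PendantLeaf {V : Set} (D : List (V × Fin 5)) (P : Precoloring V 5) (l : V) : Set where
  field
    {α β} : Fin 5
    α≢β : α ≢ β
    kind : PendantKind D P l α β

record PendantFoot {V : Set} (G : Graph V) (M : List (V × V)) {D : List (V × Fin 5)} {P : Precoloring V 5}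
                   {l : V} (leaf : PendantLeaf D P l) : Set where
  field
    {next} : V
    {i} : Fin 5
    adjacent : Adj G l next
    off-M : ¬ On M l next
    uncoloured : ¬ ∃ (Coloured P l next)
    coloured : (next , i) ∈ D ⊎ ∃ λ x → Coloured P next x i
    i≢α : i ≢ PendantLeaf.α leaf
    i≢β : i ≢ PendantLeaf.β leaf

record PendantObstruction {V : Set} (G : Graph V) (M : List (V × V)) (D : List (V × Fin 5)) (P : Precoloring V 5) : Set where
  field
    {l₁ l₂} : V
    l₁≢l₂ : l₁ ≢ l₂
    leaf₁ : PendantLeaf D P l₁
    leaf₂ : PendantLeaf D P l₂
    compatible : let open PendantLeaf in Compatible (α leaf₁) (β leaf₁) (α leaf₂) (β leaf₂)
    obstacle : (∃ λ l₃ → l₃ ≢ l₁ × l₃ ≢ l₂ × PendantLeaf D P l₃) ⊎ (PendantFoot G M leaf₁ × PendantFoot G M leaf₂)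

-- The matching M takes the colour base and is removed; a vertex that must avoid a colour
-- gets a pendant edge precoloured with it.
module Layer {V : Set} (F : Finite V) (G : Graph V) (deg : ∀ u → DegreeAtMost 3 G u)
             {base : Fin 5} {M : List (V × V)} {D : List (V × Fin 5)} {P : Precoloring V 5}
             (pendants : Pendants G base M D P) where
  open Finite F
  open Pendants pendants

  data Link : V ⊎ V → V ⊎ V → Set where
    within : ∀ {u v} → Adj G u v → ¬ On M u v → Link (inj₁ u) (inj₁ v)
    out : ∀ {u t} → (u , t) ∈ D → Link (inj₁ u) (inj₂ u)
    back : ∀ {u t} → (u , t) ∈ D → Link (inj₂ u) (inj₁ u)

  pendant? : ∀ u → Dec (∃ λ t → (u , t) ∈ D)
  pendant? u = Finite.search (fin-finite 5) λ t → any? (Product.≡-dec _≟_ _≟ᶠ_ (u , t)) D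

  link? : ∀ x y → Dec (Link x y)
  link? (inj₁ u) (inj₁ v) = map′ (λ (a , n) → within a n) (λ { (within a n) → a , n })
                                 (adj? G u v ×-dec ¬? (on? _≟_ M u v))
  link? (inj₁ u) (inj₂ v) with u ≟ v
  ... | no u≢v = no λ { (out _) → u≢v refl }
  ... | yes refl = map′ (λ (t , m) → out m) (λ { (out m) → _ , m }) (pendant? u)
  link? (inj₂ u) (inj₁ v) with u ≟ v
  ... | no u≢v = no λ { (back _) → u≢v refl }
  ... | yes refl = map′ (λ (t , m) → back m) (λ { (back m) → _ , m }) (pendant? u)
  link? (inj₂ u) (inj₂ v) = no λ ()

  link-sym : ∀ {x y} → Link x y → Link y x
  link-sym (within a n) = within (adj-sym G a) (λ m → n (on-flip m))
  link-sym (out m) = back m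
  link-sym (back m) = out m

  link-irrefl : ∀ {x} → ¬ Link x x
  link-irrefl (within a _) = adj⇒≢ G a refl

  G⁺ : Graph (V ⊎ V)
  G⁺ = relationGraph Link link? link-sym link-irrefl

  link : ∀ {x y} → Adj G⁺ x y → Link x y
  link {x} {y} = does⇒ (link? x y)

  adj⁺ : ∀ {x y} → Link x y → Adj G⁺ x y
  adj⁺ {x} {y} = dec-true (link? x y)

  inner : List (V ⊎ V) → List V
  inner [] = []
  inner (inj₁ v ∷ xs) = v ∷ inner xs
  inner (inj₂ _ ∷ xs) = inner xs

  ∈-inner : ∀ xs {v} → v ∈ inner xs → inj₁ v ∈ xs
  ∈-inner (inj₁ _ ∷ xs) (here refl) = here refl
  ∈-inner (inj₁ _ ∷ xs) (there v∈) = there (∈-inner xs v∈)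
  ∈-inner (inj₂ _ ∷ xs) v∈ = there (∈-inner xs v∈)

  inner-∈ : ∀ xs {v} → inj₁ v ∈ xs → v ∈ inner xs
  inner-∈ (inj₁ _ ∷ xs) (here refl) = here refl
  inner-∈ (inj₁ _ ∷ xs) (there v∈) = there (inner-∈ xs v∈)
  inner-∈ (inj₂ _ ∷ xs) (there v∈) = inner-∈ xs v∈

  inner-unique : ∀ {xs} → Unique xs → Unique (inner xs)
  inner-unique {[]} [] = []
  inner-unique {inj₁ v ∷ xs} (v∉ ∷ uniq) =
    All.tabulate (λ { w∈ refl → All.lookup v∉ (∈-inner xs w∈) refl }) ∷ inner-unique uniq
  inner-unique {inj₂ v ∷ xs} (_ ∷ uniq) = inner-unique uniq

  degree⁺ : ∀ x → DegreeAtMost 3 G⁺ x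
  degree⁺ (inj₂ u) xs uniq adjs = ℕ.≤-trans (unique-⊆-length {ys = inj₁ u ∷ []} uniq
    λ x∈ → leaves (link (All.lookup adjs x∈))) (s≤s z≤n)
    where
    leaves : ∀ {x} → Link (inj₂ u) x → x ∈ inj₁ u ∷ []
    leaves (back _) = here refl
  degree⁺ (inj₁ u) xs uniq adjs with pendant? u
  ... | no ¬d = ℕ.≤-trans (unique-⊆-length {ys = map inj₁ (inner xs)} uniq sub)
                  (subst (_≤ 3) (≡-sym (length-map inj₁ (inner xs))) (deg u (inner xs) (inner-unique uniq)
                    (All.tabulate λ v∈ → inside (link (All.lookup adjs (∈-inner xs v∈))))))
    where
    inside : ∀ {v} → Link (inj₁ u) (inj₁ v) → Adj G u v
    inside (within a _) = a
    sub : ∀ {x} → x ∈ xs → x ∈ map inj₁ (inner xs)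
    sub {x} x∈ with link {inj₁ u} {x} (All.lookup adjs x∈)
    ... | within _ _ = ∈-map⁺ inj₁ (inner-∈ xs x∈)
    ... | out m = contradiction (_ , m) ¬d
  ... | yes (t , m) = ℕ.≤-trans (unique-⊆-length {ys = inj₂ u ∷ map inj₁ (inner xs)} uniq sub)
                  (s≤s (subst (_≤ 2) (≡-sym (length-map inj₁ (inner xs))) (few (D-degree m))))
    where
    inside : ∀ {v} → Link (inj₁ u) (inj₁ v) → Adj G u v × ¬ On M u v
    inside (within a n) = a , n
    inside-all : ∀ {v} → v ∈ inner xs → Adj G u v × ¬ On M u v
    inside-all v∈ = inside (link (All.lookup adjs (∈-inner xs v∈)))
    sub : ∀ {x} → x ∈ xs → x ∈ inj₂ u ∷ map inj₁ (inner xs)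
    sub {x} x∈ with link {inj₁ u} {x} (All.lookup adjs x∈)
    ... | within _ _ = there (∈-map⁺ inj₁ (inner-∈ xs x∈))
    ... | out _ = here refl
    few : DegreeAtMost 2 G u ⊎ ∃ (On M u) → length (inner xs) ≤ 2
    few (inj₁ low) = low _ (inner-unique uniq) (All.tabulate λ v∈ → proj₁ (inside-all v∈))
    few (inj₂ (y , uy)) = ℕ.≤-pred (deg u (y ∷ inner xs)
      (All.tabulate (λ { v∈ refl → proj₂ (inside-all v∈) uy }) ∷ inner-unique uniq)
      (M-edges uy ∷ All.tabulate λ v∈ → proj₁ (inside-all v∈)))

  fromP : (V × V) × Fin 5 → ((V ⊎ V) × (V ⊎ V)) × Fin 4
  fromP ((u , v) , i) = (inj₁ u , inj₁ v) , squeeze base i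

  fromD : V × Fin 5 → ((V ⊎ V) × (V ⊎ V)) × Fin 4
  fromD (u , t) = (inj₁ u , inj₂ u) , squeeze base t

  P⁺ : Precoloring (V ⊎ V) 4
  P⁺ = map fromP P ++ map fromD D

  data Origin : (V ⊎ V) × (V ⊎ V) → Fin 4 → Set where
    real : ∀ {u v i} → ((u , v) , i) ∈ P → Origin (inj₁ u , inj₁ v) (squeeze base i)
    pendant : ∀ {u t} → (u , t) ∈ D → Origin (inj₁ u , inj₂ u) (squeeze base t)

  origin : ∀ {e j} → (e , j) ∈ P⁺ → Origin e j
  origin m with ∈-++⁻ (map fromP P) m
  ... | inj₁ m′ with ∈-map⁻ fromP m′
  ...   | _ , m″ , refl = real m″
  origin m | inj₂ m′ with ∈-map⁻ fromD m′
  ...   | _ , m″ , refl = pendant m″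

  real∈ : ∀ {e i} → (e , i) ∈ P → fromP (e , i) ∈ P⁺
  real∈ m = ∈-++⁺ˡ (∈-map⁺ fromP m)

  pendant∈ : ∀ {u t} → (u , t) ∈ D → fromD (u , t) ∈ P⁺
  pendant∈ m = ∈-++⁺ʳ (map fromP P) (∈-map⁺ fromD m)

  -- `Origin` read along either orientation, so that the vertex where two entries meet is the first
  -- index of both.
  data Origin⁺ : V ⊎ V → V ⊎ V → Fin 4 → Set where
    real : ∀ {u v i} → i ≢ base → Coloured P u v i → Origin⁺ (inj₁ u) (inj₁ v) (squeeze base i)
    out : ∀ {u t} → (u , t) ∈ D → Origin⁺ (inj₁ u) (inj₂ u) (squeeze base t)
    back : ∀ {u t} → (u , t) ∈ D → Origin⁺ (inj₂ u) (inj₁ u) (squeeze base t)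

  origin⁺ : ∀ {x y e j} → (e , j) ∈ P⁺ → SameEdge e (x , y) → Origin⁺ x y j
  origin⁺ m s with origin m
  origin⁺ m (inj₁ (refl , refl)) | real m′ = real (P-colours m′) (_ , m′ , sameEdge-refl)
  origin⁺ m (inj₂ (refl , refl)) | real m′ = real (P-colours m′) (_ , m′ , inj₂ (refl , refl))
  origin⁺ m (inj₁ (refl , refl)) | pendant m′ = out m′
  origin⁺ m (inj₂ (refl , refl)) | pendant m′ = back m′

  P⁺-proper : IsProperPrecoloring G⁺ P⁺
  P⁺-proper = record
    { areEdges = λ m → edge (origin m)
    ; consistent = λ m m′ s → agree (origin⁺ m sameEdge-refl) (origin⁺ m′ (sameEdge-sym s))
    ; proper = λ _ _ _ m m′ s s′ → differ (origin⁺ m s) (origin⁺ m′ s′) }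
    where
    edge : ∀ {x y j} → Origin (x , y) j → Adj G⁺ x y
    edge (real m) = adj⁺ (within (IsProperPrecoloring.areEdges P-proper m) (P-off-M (_ , m , sameEdge-refl)))
    edge (pendant m) = adj⁺ (out m)
    agree : ∀ {x y i j} → Origin⁺ x y i → Origin⁺ x y j → i ≡ j
    agree (real _ c) (real _ c′) = cong (squeeze base) (coloured-functional P-proper c c′)
    agree (out m) (out m′) = cong (squeeze base) (D-functional m m′)
    agree (back m) (back m′) = cong (squeeze base) (D-functional m m′)
    differ : ∀ {x y z i j} → Origin⁺ x y i → Origin⁺ x z j → y ≢ z → i ≢ j
    differ (real n c) (real n′ c′) y≢z e =
      coloured-proper P-proper c c′ (λ { refl → y≢z refl }) (squeeze-injective n n′ e)
    differ (real n c) (out m) _ e = P-D c m (≡-sym (squeeze-injective n (D-colours m) e))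
    differ (out m) (real n c) _ e = P-D c m (squeeze-injective (D-colours m) n e)
    differ (out _) (out _) y≢z = contradiction refl y≢z
    differ (back _) (back _) y≢z = contradiction refl y≢z

  finish : Extension G⁺ P⁺ → LayerColouring G base M D P
  finish (φ⁺ , ok , ext) = record
    { φ = φ ; proper = record { symmetric = φ-sym ; proper = φ-proper } ; extends = φ-ext
    ; on-M = φ-on ; off-M = φ-off ; avoids = φ-avoids }
    where
    φ : V → V → Fin 5
    φ u v with on? _≟_ M u v
    ... | yes _ = base
    ... | no _ = punchIn base (φ⁺ (inj₁ u) (inj₁ v))
    φ-on : ∀ {u v} → On M u v → φ u v ≡ base
    φ-on {u} {v} m with on? _≟_ M u v
    ... | yes _ = refl
    ... | no n = contradiction m n
    φ-off : ∀ {u v} → ¬ On M u v → φ u v ≢ base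
    φ-off {u} {v} n with on? _≟_ M u v
    ... | yes m = contradiction m n
    ... | no _ = punchInᵢ≢i base _
    φ-sym : ∀ u v → Adj G u v → φ u v ≡ φ v u
    φ-sym u v a with on? _≟_ M u v | on? _≟_ M v u
    ... | yes _ | yes _ = refl
    ... | yes m | no n = contradiction (on-flip m) n
    ... | no n | yes m = contradiction (on-flip m) n
    ... | no n | no _ = cong (punchIn base) (IsProperEdgeColoring.symmetric ok _ _ (adj⁺ (within a n)))
    φ-proper : ∀ u v w → Adj G u v → Adj G u w → v ≢ w → φ u v ≢ φ u w
    φ-proper u v w a a′ v≢w e with on? _≟_ M u v | on? _≟_ M u w
    ... | yes m | yes m′ = v≢w (M-matching m m′)
    ... | yes _ | no _ = punchInᵢ≢i base _ (≡-sym e)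
    ... | no _ | yes _ = punchInᵢ≢i base _ e
    ... | no n | no n′ = IsProperEdgeColoring.proper ok _ _ _ (adj⁺ (within a n)) (adj⁺ (within a′ n′))
                           (λ { refl → v≢w refl }) (punchIn-injective base _ _ e)
    φ-ext : Extends φ P
    φ-ext {u} {v} m with on? _≟_ M u v
    ... | yes m′ = contradiction m′ (P-off-M (_ , m , sameEdge-refl))
    ... | no _ = trans (cong (punchIn base) (ext (real∈ m))) (punchIn-squeeze (P-colours m))
    φ-avoids : ∀ {u v t} → (u , t) ∈ D → Adj G u v → φ u v ≢ t
    φ-avoids {u} {v} m a e with on? _≟_ M u v
    ... | yes _ = D-colours m (≡-sym e)
    ... | no n = IsProperEdgeColoring.proper ok _ _ _ (adj⁺ (within a n)) (adj⁺ (out m)) (λ ())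
      (trans (punchIn-injective base _ _ (trans e (≡-sym (punchIn-squeeze (D-colours m))))) (≡-sym (ext (pendant∈ m))))

  -- Since `PendantKind` puts the pendant colour first, translating a leaf may interchange its
  -- colours.
  data SamePalette (α β : Fin 4) (α′ β′ : Fin 5) : Set where
    straight : α ≡ squeeze base α′ → β ≡ squeeze base β′ → SamePalette α β α′ β′
    twisted : α ≡ squeeze base β′ → β ≡ squeeze base α′ → SamePalette α β α′ β′

  record Translated {x : V ⊎ V} (leaf : Leaf P⁺ x) : Set where
    constructor translated
    field
      {l} : V
      at : x ≡ inj₁ l
      image : PendantLeaf D P l
      α≢base : PendantLeaf.α image ≢ base
      β≢base : PendantLeaf.β image ≢ base
      palette : SamePalette (Leaf.α leaf) (Leaf.β leaf) (PendantLeaf.α image) (PendantLeaf.β image)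

  translate : ∀ {x} (leaf : Leaf P⁺ x) → Translated leaf
  translate record { a≢b = a≢b ; α≢β = α≢β ; la = _ , m , s ; lb = _ , m′ , s′ } with origin⁺ m s | origin⁺ m′ s′
  ... | real n c | real n′ c′ = translated refl
          record { α≢β = λ { refl → α≢β refl } ; kind = inj₂ (_ , _ , (λ { refl → a≢b refl }) , c , c′) }
          n n′ (straight refl refl)
  ... | real n c | out d = translated refl
          record { α≢β = λ { refl → α≢β refl } ; kind = inj₁ (d , _ , c) } (D-colours d) n (twisted refl refl)
  ... | out d | real n c = translated refl
          record { α≢β = λ { refl → α≢β refl } ; kind = inj₁ (d , _ , c) } (D-colours d) n (straight refl refl)
  ... | out _ | out _ = contradiction refl a≢b
  ... | back _ | back _ = contradiction refl a≢b

  unsqueeze : ∀ {α β α′ β′} → α ≢ base → β ≢ base → α′ ≢ base → β′ ≢ base →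
    Compatible (squeeze base α) (squeeze base β) (squeeze base α′) (squeeze base β′) → Compatible α β α′ β′
  unsqueeze a b a′ b′ (same p q) = same (squeeze-injective a′ a p) (squeeze-injective b′ b q)
  unsqueeze a b a′ b′ (crossed p q) = crossed (squeeze-injective a′ b p) (squeeze-injective b′ a q)
  unsqueeze a b a′ b′ (disjoint p q r s) =
    disjoint (p ∘ cong _) (q ∘ cong _) (r ∘ cong _) (s ∘ cong _)

  translate-compatible : ∀ {x y} {leaf : Leaf P⁺ x} {leaf′ : Leaf P⁺ y} (τ : Translated leaf) (τ′ : Translated leaf′) →
    Compatible (Leaf.α leaf) (Leaf.β leaf) (Leaf.α leaf′) (Leaf.β leaf′) →
    Compatible (PendantLeaf.α (Translated.image τ)) (PendantLeaf.β (Translated.image τ))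
               (PendantLeaf.α (Translated.image τ′)) (PendantLeaf.β (Translated.image τ′))
  translate-compatible (translated _ _ a b p) (translated _ _ a′ b′ p′) c = go p p′ c
    where
    go : ∀ {α β α′ β′} → SamePalette α β _ _ → SamePalette α′ β′ _ _ → Compatible α β α′ β′ → _
    go (straight refl refl) (straight refl refl) c = unsqueeze a b a′ b′ c
    go (straight refl refl) (twisted refl refl) c = unsqueeze a b a′ b′ (flipʳ c)
    go (twisted refl refl) (straight refl refl) c = unsqueeze a b a′ b′ (flipˡ c)
    go (twisted refl refl) (twisted refl refl) c = unsqueeze a b a′ b′ (flipˡ (flipʳ c))

  translate-foot : ∀ {x} {leaf : Leaf P⁺ x} (τ : Translated leaf) → Foot G⁺ P⁺ leaf →
                   PendantFoot G M (Translated.image τ)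
  translate-foot (translated {l} refl leaf′ a b p) record
    { k′ = k′ ; adjacent = adjacent ; uncoloured = uncoloured ; coloured = _ , m , s ; i≢α = i≢α ; i≢β = i≢β }
    with link {inj₁ l} {k′} adjacent
  ... | out d = contradiction (_ , _ , pendant∈ d , sameEdge-refl) uncoloured
  ... | within lk n = foot (origin⁺ m s) i≢α i≢β p
    where
    lifted : ¬ ∃ (Coloured P l _)
    lifted (_ , _ , m , inj₁ (refl , refl)) = uncoloured (_ , _ , real∈ m , inj₁ (refl , refl))
    lifted (_ , _ , m , inj₂ (refl , refl)) = uncoloured (_ , _ , real∈ m , inj₂ (refl , refl))
    away : ∀ {α β α′ β′ i} → SamePalette α β α′ β′ → squeeze base i ≢ α → squeeze base i ≢ β → i ≢ α′ × i ≢ β′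
    away (straight refl refl) n n′ = (n ∘ cong _) , (n′ ∘ cong _)
    away (twisted refl refl) n n′ = (n′ ∘ cong _) , (n ∘ cong _)
    foot : ∀ {y j α β} → Origin⁺ (inj₁ _) y j → j ≢ α → j ≢ β →
           SamePalette α β (PendantLeaf.α leaf′) (PendantLeaf.β leaf′) → PendantFoot G M leaf′
    foot (real _ c) i≢α i≢β p = record
      { adjacent = lk ; off-M = n ; uncoloured = lifted ; coloured = inj₂ (_ , c)
      ; i≢α = proj₁ (away p i≢α i≢β) ; i≢β = proj₂ (away p i≢α i≢β) }
    foot (out d) i≢α i≢β p = record
      { adjacent = lk ; off-M = n ; uncoloured = lifted ; coloured = inj₁ d
      ; i≢α = proj₁ (away p i≢α i≢β) ; i≢β = proj₂ (away p i≢α i≢β) }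

  translate-obstruction : Obstruction G⁺ P⁺ → PendantObstruction G M D P
  translate-obstruction o = record
    { l₁≢l₂ = apart τ₁ τ₂ l₁≢l₂ ; leaf₁ = Translated.image τ₁ ; leaf₂ = Translated.image τ₂
    ; compatible = translate-compatible τ₁ τ₂ compatible
    ; obstacle = [ (λ { (_ , n , n′ , leaf) → let τ = translate leaf in
                        inj₁ (Translated.l τ , apart τ τ₁ n , apart τ τ₂ n′ , Translated.image τ) })
                 , (λ (f , f′) → inj₂ (translate-foot τ₁ f , translate-foot τ₂ f′)) ]′ obstacle }
    where
    open Obstruction o
    τ₁ = translate leaf₁
    τ₂ = translate leaf₂
    apart : ∀ {x y} {leaf : Leaf P⁺ x} {leaf′ : Leaf P⁺ y} (τ : Translated leaf) (τ′ : Translated leaf′) →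
            x ≢ y → Translated.l τ ≢ Translated.l τ′
    apart (translated refl _ _ _ _) (translated refl _ _ _ _) n e = n (cong inj₁ e)

  open Build (⊎-finite F F) G⁺ degree⁺ P⁺-proper using (extend-or-obstruct)

  layer-unobstructed : ¬ PendantObstruction G M D P → LayerColouring G base M D P
  layer-unobstructed free with extend-or-obstruct
  ... | inj₁ ext = finish ext
  ... | inj₂ o = contradiction (translate-obstruction o) free

  layer-few : length P + length D ≤ 3 → LayerColouring G base M D P
  layer-few few with extend-or-obstruct
  ... | inj₁ ext = finish ext
  ... | inj₂ o = ⊥-elim (few⇒unobstructed (Finite._≟_ (⊎-finite F F)) P⁺-proper
    (subst (_≤ 3) (≡-sym (trans (length-++ (map fromP P)) (cong₂ _+_ (length-map fromP P) (length-map fromD D)))) few) o)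

-- Colouring two layers and the edges between them

abstract
  fresh : (cs : List (Fin 5)) → length cs ≤ 4 → ∃ λ c → c ∉ cs
  fresh cs short with Finite.search (fin-finite 5) (λ c → ¬? (any? (c ≟ᶠ_) cs))
  ... | yes found = found
  ... | no none = ⊥-elim (ℕ.<⇒≱ (s≤s short) (unique-⊆-length (Unique.allFin⁺ 5)
    λ {c} _ → decidable-stable (any? (c ≟ᶠ_) cs) λ c∉ → none (c , c∉)))

allPairs-lookup : {A : Set} {R : A → A → Set} {xs : List A} {x y : A} → AllPairs R xs →
                  x ∈ xs → y ∈ xs → x ≡ y ⊎ R x y ⊎ R y x
allPairs-lookup (_ ∷ _) (here refl) (here refl) = inj₁ refl
allPairs-lookup (r ∷ _) (here refl) (there y∈) = inj₂ (inj₁ (All.lookup r y∈))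
allPairs-lookup (r ∷ _) (there x∈) (here refl) = inj₂ (inj₂ (All.lookup r x∈))
allPairs-lookup (_ ∷ rs) (there x∈) (there y∈) = allPairs-lookup rs x∈ y∈

module _ {V : Set} where

  Meet : V × V → V × V → Set
  Meet (a , b) (c , d) = (a ≡ c ⊎ a ≡ d) ⊎ (b ≡ c ⊎ b ≡ d)

  meet : ∀ {e e′ x y z} → SameEdge e (x , y) → SameEdge e′ (x , z) → Meet e e′
  meet (inj₁ (refl , _)) (inj₁ (refl , _)) = inj₁ (inj₁ refl)
  meet (inj₁ (refl , _)) (inj₂ (_ , refl)) = inj₁ (inj₂ refl)
  meet (inj₂ (_ , refl)) (inj₁ (refl , _)) = inj₂ (inj₁ refl)
  meet (inj₂ (_ , refl)) (inj₂ (_ , refl)) = inj₂ (inj₂ refl)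

  matching : ∀ {M : List (V × V)} → AllPairs (λ e e′ → ¬ Meet e e′) M →
             ∀ {u v w} → On M u v → On M u w → v ≡ w
  matching apart m m′ with find m | find m′
  ... | e , e∈ , s | e′ , e′∈ , s′ with allPairs-lookup apart e∈ e′∈
  ... | inj₁ refl = sameEdge-cancel (sameEdge-trans (sameEdge-sym s) s′)
  ... | inj₂ (inj₁ n) = contradiction (meet s s′) n
  ... | inj₂ (inj₂ n) = contradiction (meet s′ s) n

  -- The conditions on `M` and `D` that do not mention the precolouring and hence serve both layers.
  -- Pendants sit on vertices of `M`, where the removed edge makes room.
  record Matched (G : Graph V) (base : Fin 5) (M : List (V × V)) (D : List (V × Fin 5)) : Set where
    field
      edges : All (λ e → Adj G (proj₁ e) (proj₂ e)) M
      apart : AllPairs (λ e e′ → ¬ Meet e e′) M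
      colours : All (λ d → proj₂ d ≢ base) D
      keys : AllPairs (λ d d′ → proj₁ d ≢ proj₁ d′) D
      covered : All (λ d → ∃ (On M (proj₁ d))) D

    functional : ∀ {u t t′} → (u , t) ∈ D → (u , t′) ∈ D → t ≡ t′
    functional d d′ with allPairs-lookup keys d d′
    ... | inj₁ refl = refl
    ... | inj₂ (inj₁ n) = contradiction refl n
    ... | inj₂ (inj₂ n) = contradiction refl n

  pendants : ∀ {G : Graph V} {base M D P} → Matched G base M D → IsProperPrecoloring G P →
             (∀ {u v} → ¬ Coloured P u v base) → All (λ e → ¬ ∃ (Coloured P (proj₁ e) (proj₂ e))) M →
             All (λ d → ∀ {v} → ¬ Coloured P (proj₁ d) v (proj₂ d)) D → Pendants G base M D P
  pendants {G} {P = P} matched proper no-base off avoid = record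
    { M-edges = λ m → let e , e∈ , s = find m in adj-sameEdge G s (All.lookup edges e∈)
    ; M-matching = matching apart
    ; D-colours = All.lookup colours
    ; D-functional = functional
    ; D-degree = λ d → inj₂ (All.lookup covered d)
    ; P-proper = proper
    ; P-colours = λ { m refl → no-base (_ , m , sameEdge-refl) }
    ; P-off-M = λ c m → let e , e∈ , s = find m in All.lookup off e∈ (_ , along (sameEdge-sym s) c)
    ; P-D = λ { c d refl → All.lookup avoid d c } }
    where
    open Matched matched
    along : ∀ {x y e i} → SameEdge (x , y) e → Coloured P x y i → Coloured P (proj₁ e) (proj₂ e) i
    along s (e , m , s′) = e , m , sameEdge-trans s′ s

module _ {V : Set} {G : Graph V} {P : Precoloring V 5}
         (_≟_ : DecidableEquality V) (proper : IsProperPrecoloring G P) where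

  two-known : length P ≤ 2 → ∀ {u v x y p q i j k} → ¬ SameEdge (u , v) (x , y) →
              Coloured P u v i → Coloured P x y j → Coloured P p q k →
              (SameEdge (u , v) (p , q) × k ≡ i) ⊎ (SameEdge (x , y) (p , q) × k ≡ j)
  two-known two {u} {v} {x} {y} {p} {q} n c c′ c″
    with sameEdge? _≟_ (u , v) (p , q) | sameEdge? _≟_ (x , y) (p , q)
  ... | yes s | _ = inj₁ (s , ≡-sym (coloured-along _≟_ proper s c c″))
  ... | no _ | yes s = inj₂ (s , ≡-sym (coloured-along _≟_ proper s c′ c″))
  ... | no m | no m′ = ⊥-elim (ℕ.<⇒≱ (s≤s two)
    (distinct-entries (entry c ∷ entry c′ ∷ entry c″ ∷ []) ((n ∷ m ∷ []) ∷ (m′ ∷ []) ∷ [] ∷ [])))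

module _ {V : Set} {G : Graph V} {M : List (V × V)} {D : List (V × Fin 5)} {P : Precoloring V 5}
         (_≟_ : DecidableEquality V) (proper : IsProperPrecoloring G P) where

  -- With a single precoloured edge every leaf combines it with a pendant, so the two leaves are its
  -- ends. Their palettes share its colour and must be equal; then the pendant colours at its ends
  -- agree, against the assumption on `D`.
  unobstructed-one : length P ≤ 1 →
    AllPairs (λ d d′ → proj₂ d ≢ proj₂ d′ ⊎ ¬ ∃ (Coloured P (proj₁ d) (proj₁ d′))) D →
    ¬ PendantObstruction G M D P
  unobstructed-one one clean o = go (PendantLeaf.kind leaf₁) (PendantLeaf.kind leaf₂)
    where
    open PendantObstruction o
    one-edge : ∀ {u v x y i j} → Coloured P u v i → Coloured P x y j → SameEdge (u , v) (x , y)
    one-edge {u} {v} {x} {y} c c′ = decidable-stable (sameEdge? _≟_ (u , v) (x , y)) λ n →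
      ℕ.<⇒≱ (s≤s one) (distinct-entries (entry c ∷ entry c′ ∷ []) ((n ∷ []) ∷ [] ∷ []))
    go : PendantKind D P l₁ _ _ → PendantKind D P l₂ _ _ → ⊥
    go (inj₂ (_ , _ , a≢b , c , c′)) _ = a≢b (sameEdge-cancel (one-edge c c′))
    go (inj₁ _) (inj₂ (_ , _ , a≢b , c , c′)) = a≢b (sameEdge-cancel (one-edge c c′))
    go (inj₁ (d₁ , _ , c₁)) (inj₁ (d₂ , _ , c₂)) with one-edge c₁ c₂
    ... | inj₁ (e , _) = l₁≢l₂ e
    ... | inj₂ (refl , refl) with coloured-functional proper c₁ (coloured-flip c₂)
    ... | β≡ with compatible
    ... | disjoint _ _ _ n = n (≡-sym β≡)
    ... | crossed _ q = PendantLeaf.α≢β leaf₁ (≡-sym (trans β≡ q))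
    ... | same p _ with allPairs-lookup clean d₁ d₂
    ... | inj₁ refl = l₁≢l₂ refl
    ... | inj₂ (inj₁ (inj₁ n)) = n (≡-sym p)
    ... | inj₂ (inj₁ (inj₂ n)) = n (_ , c₁)
    ... | inj₂ (inj₂ (inj₁ n)) = n p
    ... | inj₂ (inj₂ (inj₂ n)) = n (_ , c₂)

  -- Only `v` can combine a pendant, of colour `s`, with a precoloured edge. As `s` is absent from
  -- `P`, a leaf on two precoloured edges cannot have the same palette, and it shares the colour of
  -- the edge at `v`. Two leaves on two precoloured edges each would make these edges parallel.
  unobstructed-two : length P ≤ 2 → ∀ v s → (∀ {x y} → ¬ Coloured P x y s) →
    All (λ d → (∀ {y i} → ¬ Coloured P (proj₁ d) y i) ⊎ (d ≡ (v , s))) D → ¬ PendantObstruction G M D P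
  unobstructed-two two v s no-s clean o = go (PendantLeaf.kind leaf₁) (PendantLeaf.kind leaf₂) compatible
    where
    open PendantObstruction o
    other : ∀ {l l′ a b : V} → l ≢ l′ → SameEdge (l , a) (l′ , b) → b ≡ l
    other n (inj₁ (e , _)) = contradiction e n
    other n (inj₂ (e , _)) = ≡-sym e
    mixed : ∀ {l α b β} → (l , α) ∈ D → Coloured P l b β → l ≡ v × α ≡ s
    mixed d c with All.lookup clean d
    ... | inj₁ n = contradiction c n
    ... | inj₂ refl = refl , refl
    go : ∀ {α β α′ β′} → PendantKind D P l₁ α β → PendantKind D P l₂ α′ β′ → Compatible α β α′ β′ → ⊥
    go (inj₁ (d , _ , c)) (inj₁ (d′ , _ , c′)) _ = l₁≢l₂ (trans (proj₁ (mixed d c)) (≡-sym (proj₁ (mixed d′ c′))))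
    go (inj₁ (d , _ , c)) (inj₂ (_ , _ , a≢b , ca , cb)) k with mixed d c
    go (inj₁ (d , _ , c)) (inj₂ (_ , _ , a≢b , ca , cb)) (same refl _) | refl , refl = no-s ca
    go (inj₁ (d , _ , c)) (inj₂ (_ , _ , a≢b , ca , cb)) (crossed _ refl) | refl , refl = no-s cb
    go (inj₁ (d , _ , c)) (inj₂ (_ , _ , a≢b , ca , cb)) (disjoint _ n _ n′) | refl , refl
      with two-known _≟_ proper two (λ e → a≢b (sameEdge-cancel e)) ca cb c
    ... | inj₁ (_ , e) = n (≡-sym e)
    ... | inj₂ (_ , e) = n′ (≡-sym e)
    go (inj₂ (_ , _ , a≢b , ca , cb)) (inj₁ (d , _ , c)) k with mixed d c
    go (inj₂ (_ , _ , a≢b , ca , cb)) (inj₁ (d , _ , c)) (same refl _) | refl , refl = no-s ca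
    go (inj₂ (_ , _ , a≢b , ca , cb)) (inj₁ (d , _ , c)) (crossed refl _) | refl , refl = no-s cb
    go (inj₂ (_ , _ , a≢b , ca , cb)) (inj₁ (d , _ , c)) (disjoint _ _ n n′) | refl , refl
      with two-known _≟_ proper two (λ e → a≢b (sameEdge-cancel e)) ca cb c
    ... | inj₁ (_ , e) = n e
    ... | inj₂ (_ , e) = n′ e
    go (inj₂ (_ , _ , a≢b , ca , cb)) (inj₂ (_ , _ , a′≢b′ , ca′ , cb′)) _
      = a′≢b′ (trans (back ca′) (≡-sym (back cb′)))
      where
      back : ∀ {x i} → Coloured P l₂ x i → x ≡ l₁
      back c with two-known _≟_ proper two (λ e → a≢b (sameEdge-cancel e)) ca cb c
      ... | inj₁ (e , _) = other l₁≢l₂ e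
      ... | inj₂ (e , _) = other l₁≢l₂ e

-- At least three neighbours, in the form that is needed: one can be chosen outside any two given
-- vertices.
Rich : {V : Set} → Graph V → V → Set
Rich G u = ∀ xs → length xs ≤ 2 → ∃ λ v → Adj G u v × v ∉ xs

-- `B` lists the prescribed vertical edges by the vertex of `G` below them; `P₀` and `P₁` are the
-- prescriptions inside the two layers.
record Consistent {V : Set} (G : Graph V) (B : List (V × Fin 5)) (P₀ P₁ : Precoloring V 5) : Set where
  field
    functional : ∀ {u c c′} → (u , c) ∈ B → (u , c′) ∈ B → c ≡ c′
    rich : ∀ {u c} → (u , c) ∈ B → Rich G u
    proper₀ : IsProperPrecoloring G P₀
    proper₁ : IsProperPrecoloring G P₁
    clear₀ : ∀ {u v c} → (u , c) ∈ B → ¬ Coloured P₀ u v c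
    clear₁ : ∀ {u v c} → (u , c) ∈ B → ¬ Coloured P₁ u v c

record Solution {V : Set} (G : Graph V) (B : List (V × Fin 5)) (P₀ P₁ : Precoloring V 5) : Set where
  field
    φ₀ φ₁ : V → V → Fin 5
    τ : V → Fin 5
    proper₀ : IsProperEdgeColoring G 5 φ₀
    proper₁ : IsProperEdgeColoring G 5 φ₁
    extends₀ : Extends φ₀ P₀
    extends₁ : Extends φ₁ P₁
    extends : ∀ {u c} → (u , c) ∈ B → τ u ≡ c
    free₀ : ∀ {u v} → Adj G u v → φ₀ u v ≢ τ u
    free₁ : ∀ {u v} → Adj G u v → φ₁ u v ≢ τ u

module _ {V : Set} {G : Graph V} {B : List (V × Fin 5)} {P₀ P₁ : Precoloring V 5} where

  consistent-swap : Consistent G B P₀ P₁ → Consistent G B P₁ P₀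
  consistent-swap c = record { functional = functional ; rich = rich ; proper₀ = proper₁ ; proper₁ = proper₀
                             ; clear₀ = clear₁ ; clear₁ = clear₀ }
    where open Consistent c

  solution-swap : Solution G B P₀ P₁ → Solution G B P₁ P₀
  solution-swap s = record { φ₀ = φ₁ ; φ₁ = φ₀ ; τ = τ ; proper₀ = proper₁ ; proper₁ = proper₀ ; extends₀ = extends₁
                           ; extends₁ = extends₀ ; extends = extends ; free₀ = free₁ ; free₁ = free₀ }
    where open Solution s

module _ {V : Set} (F : Finite V) {G : Graph V} where
  open Finite F

  private
    key? : ∀ (D : List (V × Fin 5)) u → Dec (∃ λ t → (u , t) ∈ D)
    key? D u = Finite.search (fin-finite 5) λ t → any? (Product.≡-dec _≟_ _≟ᶠ_ (u , t)) D

  -- The ends of an edge of `M` see the base in both layers, so their vertical edges must get their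
  -- colours from `D`. A vertex without an entry in `D` is off `M`, and its vertical edge takes the
  -- base.
  stack : ∀ {base M D B P₀ P₁} → LayerColouring G base M D P₀ → LayerColouring G base M D P₁ →
          (∀ {u t t′} → (u , t) ∈ D → (u , t′) ∈ D → t ≡ t′) →
          (∀ {u v} → On M u v → ∃ λ t → (u , t) ∈ D) →
          (∀ {u c} → (u , c) ∈ B → (u , c) ∈ D ⊎ (c ≡ base × ∀ {t} → (u , t) ∉ D)) → Solution G B P₀ P₁
  stack {base} {M} {D} {B} L₀ L₁ functional covered B⊆ = record
    { φ₀ = φ L₀ ; φ₁ = φ L₁ ; τ = τ ; proper₀ = proper L₀ ; proper₁ = proper L₁
    ; extends₀ = extends L₀ ; extends₁ = extends L₁ ; extends = τ-B ; free₀ = free L₀ ; free₁ = free L₁ }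
    where
    open LayerColouring
    τ : V → Fin 5
    τ u with key? D u
    ... | yes (t , _) = t
    ... | no _ = base
    τ-B : ∀ {u c} → (u , c) ∈ B → τ u ≡ c
    τ-B {u} b with key? D u | B⊆ b
    ... | yes (_ , d) | inj₁ d′ = functional d d′
    ... | no n | inj₁ d = contradiction (_ , d) n
    ... | yes (_ , d) | inj₂ (_ , n) = contradiction d n
    ... | no _ | inj₂ (e , _) = ≡-sym e
    free : ∀ {P} (L : LayerColouring G base M D P) → ∀ {u v} → Adj G u v → φ L u v ≢ τ u
    free L {u} uv with key? D u
    ... | yes (_ , d) = avoids L d uv
    ... | no n = off-M L λ m → n (covered m)

  missing : (∀ u → DegreeAtMost 3 G u) → ∀ (φ : V → V → Fin 5) u →
            ∃ λ c → ∀ {v} → Adj G u v → φ u v ≢ c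
  missing deg φ u with Finite.search (fin-finite 5) (λ c → ¬? (search λ v → adj? G u v ×-dec (φ u v ≟ᶠ c)))
  ... | yes (c , n) = c , λ uv e → n (_ , uv , e)
  ... | no full = ⊥-elim (neighbours≤3 G (deg u) (proj₁ (proj₂ (used c0))) (proj₁ (proj₂ (used c1)))
        (proj₁ (proj₂ (used c2))) (proj₁ (proj₂ (used c3)))
        (apart λ ()) (apart λ ()) (apart λ ()) (apart λ ()) (apart λ ()) (apart λ ()))
    where
    c0 c1 c2 c3 : Fin 5
    c0 = zero
    c1 = suc zero
    c2 = suc (suc zero)
    c3 = suc (suc (suc zero))
    used : ∀ c → ∃ λ v → Adj G u v × φ u v ≡ c
    used c = decidable-stable (search λ v → adj? G u v ×-dec (φ u v ≟ᶠ c)) λ n → full (c , n)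
    apart : ∀ {c c′} → c ≢ c′ → proj₁ (used c) ≢ proj₁ (used c′)
    apart {c} {c′} n e = n (trans (≡-sym (proj₂ (proj₂ (used c)))) (trans (cong (φ u) e) (proj₂ (proj₂ (used c′)))))

  -- With nothing prescribed in the second layer both layers get the same colouring, which
  -- leaves at least two colours for every vertical edge.
  mirror : (∀ u → DegreeAtMost 3 G u) → ∀ {base M D B P} →
           LayerColouring G base M D (filter (λ q → ¬? (proj₂ q ≟ᶠ base)) P) →
           (∀ {u c c′} → (u , c) ∈ B → (u , c′) ∈ B → c ≡ c′) →
           (∀ {u v} → ((u , v) , base) ∈ P → On M u v) →
           (∀ {u c} → (u , c) ∈ B → (u , c) ∈ D ⊎ (c ≡ base × ∀ {v} → ¬ On M u v)) → Solution G B P []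
  mirror deg {base} {M} {D} {B} {P} L functional on B⊆ = record
    { φ₀ = φ ; φ₁ = φ ; τ = τ ; proper₀ = proper ; proper₁ = proper ; extends₀ = ext ; extends₁ = λ ()
    ; extends = τ-B ; free₀ = free ; free₁ = free }
    where
    open LayerColouring L
    ext : Extends φ P
    ext {i = i} m with i ≟ᶠ base
    ... | yes refl = on-M (on m)
    ... | no i≢ = extends (∈-filter⁺ (λ q → ¬? (proj₂ q ≟ᶠ base)) m i≢)
    τ : V → Fin 5
    τ u with key? B u
    ... | yes (c , _) = c
    ... | no _ = proj₁ (missing deg φ u)
    τ-B : ∀ {u c} → (u , c) ∈ B → τ u ≡ c
    τ-B {u} b with key? B u
    ... | yes (_ , b′) = functional b′ b
    ... | no n = contradiction (_ , b) n
    free : ∀ {u v} → Adj G u v → φ u v ≢ τ u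
    free {u} uv with key? B u
    ... | no _ = proj₂ (missing deg φ u) uv
    ... | yes (c , b) with B⊆ b
    ... | inj₁ d = avoids d uv
    ... | inj₂ (refl , n) = off-M n

sole : {V : Set} (F : Finite V) {P : Precoloring V 5} → length P ≤ 1 → ∀ u →
       ∃ λ w → ∀ {v i} → Coloured P u v i → v ≡ w
sole F {P} one u with Finite.search F (λ w → coloured? {P = P} (Finite._≟_ F) u w)
... | no none = u , λ c → contradiction (_ , _ , c) none
... | yes (w , _ , c) = w , λ {v} c′ → decidable-stable (Finite._≟_ F v w) λ v≢w → ℕ.<⇒≱ (s≤s one)
  (distinct-entries (entry c′ ∷ entry c ∷ []) (((λ s → v≢w (sameEdge-cancel s)) ∷ []) ∷ [] ∷ []))

nonmeeting : {V : Set} {a b c d : V} → a ≢ c → a ≢ d → b ≢ c → b ≢ d → ¬ Meet (a , b) (c , d)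
nonmeeting p q r s (inj₁ (inj₁ e)) = p e
nonmeeting p q r s (inj₁ (inj₂ e)) = q e
nonmeeting p q r s (inj₂ (inj₁ e)) = r e
nonmeeting p q r s (inj₂ (inj₂ e)) = s e

ends-one : {V : Set} {u v : V} {c t : Fin 5} {x y : V} → On ((u , v) ∷ []) x y →
           ∃ λ s → (x , s) ∈ (u , c) ∷ (v , t) ∷ []
ends-one (here (inj₁ (refl , refl))) = _ , here refl
ends-one (here (inj₂ (refl , refl))) = _ , there (here refl)

module _ {V : Set} {G : Graph V} {base : Fin 5} where

  matched-one : ∀ {u v c t} → Adj G u v → c ≢ base → t ≢ base →
                Matched G base ((u , v) ∷ []) ((u , c) ∷ (v , t) ∷ [])
  matched-one uv c≢ t≢ = record
    { edges = uv ∷ [] ; apart = [] ∷ [] ; colours = c≢ ∷ t≢ ∷ [] ; keys = (adj⇒≢ G uv ∷ []) ∷ [] ∷ []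
    ; covered = (_ , here sameEdge-refl) ∷ (_ , here (sameEdge-flip sameEdge-refl)) ∷ [] }

recast : ∀ {k} {α β α′ β′ γ δ γ′ δ′ : Fin k} → α ≡ γ → β ≡ δ → α′ ≡ γ′ → β′ ≡ δ′ →
         Compatible α β α′ β′ → Compatible γ δ γ′ δ′
recast refl refl refl refl k = k

-- Case analysis on the prescribed vertical edges

module Cases {V : Set} (F : Finite V) (G : Graph V) (deg : ∀ u → DegreeAtMost 3 G u) where
  open Finite F

  clash : ∀ {i : Fin 5} {cs c} → c ∉ cs → i ∈ cs → i ≢ c
  clash c∉ i∈ refl = c∉ i∈

  -- One vertical edge, with at most two precoloured edges in `A` and one in `A′`. An edge `uv` of
  -- `M` brings two pendants, which `A′` can afford but `A` cannot; so `v` and its pendant colour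
  -- are chosen against the obstruction in `A`.
  module _ {u c a₁ a₂ y A A′} (given : Consistent G ((u , c) ∷ []) A A′) (two : length A ≤ 2) (one : length A′ ≤ 1)
           (cₐ : Coloured A a₁ a₂ y) (a₁≢u : a₁ ≢ u) (a₂≢u : a₂ ≢ u)
           (off-u : ∀ {v i} → ¬ Coloured A′ u v i)
           (shape : y ≡ c ⊎ (∀ {x z i} → Coloured A′ x z i → i ≡ c))
           (z₁ z₂ : Fin 5) (palette : ∀ {x z i} → Coloured A x z i ⊎ Coloured A′ x z i → i ∈ c ∷ z₁ ∷ z₂ ∷ []) where
    open Consistent given
    private
      -- At most three colours are prescribed; of the rest one becomes the base and another the
      -- spare colour `s`.
      base = proj₁ (fresh (c ∷ z₁ ∷ z₂ ∷ []) (s≤s (s≤s (s≤s z≤n))))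
      base∉ = proj₂ (fresh (c ∷ z₁ ∷ z₂ ∷ []) (s≤s (s≤s (s≤s z≤n))))
      s = proj₁ (fresh (base ∷ c ∷ z₁ ∷ z₂ ∷ []) (s≤s (s≤s (s≤s (s≤s z≤n)))))
      s∉ = proj₂ (fresh (base ∷ c ∷ z₁ ∷ z₂ ∷ []) (s≤s (s≤s (s≤s (s≤s z≤n)))))

      no-base : ∀ {x z} → Coloured A x z base ⊎ Coloured A′ x z base → ⊥
      no-base m = base∉ (palette m)

      no-s : ∀ {x z} → Coloured A x z s ⊎ Coloured A′ x z s → ⊥
      no-s m = s∉ (there (palette m))

      assemble : ∀ {v t} → Adj G u v → t ≢ base → ¬ ∃ (Coloured A u v) →
        (∀ {x} → ¬ Coloured A v x t) → (∀ {x} → ¬ Coloured A′ v x t) →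
        ¬ PendantObstruction G ((u , v) ∷ []) ((u , c) ∷ (v , t) ∷ []) A → Solution G ((u , c) ∷ []) A A′
      assemble uv t≢base off avoid avoid′ free = stack F
        (Layer.layer-unobstructed F G deg (pendants matched proper₀ (no-base ∘ inj₁) (off ∷ [])
          (clear₀ (here refl) ∷ avoid ∷ [])) free)
        (Layer.layer-few F G deg (pendants matched proper₁ (no-base ∘ inj₂) ((λ (_ , d) → off-u d) ∷ [])
          (clear₁ (here refl) ∷ avoid′ ∷ [])) (ℕ.+-monoˡ-≤ 2 one))
        (Matched.functional matched) ends-one (λ { (here refl) → inj₁ (here refl) })
        where matched = matched-one uv (clash base∉ (here refl)) t≢base

      untouched : (∀ {v i} → ¬ Coloured A u v i) → Solution G ((u , c) ∷ []) A A′
      untouched none with rich (here refl) [] z≤n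
      ... | v , uv , _ = assemble uv (λ e → s∉ (here e)) (λ (_ , d) → none d) (no-s ∘ inj₁) (no-s ∘ inj₂)
              (unobstructed-two _≟_ proper₀ two v s (no-s ∘ inj₁) (inj₁ (λ {y} {i} → none {y} {i}) ∷ inj₂ refl ∷ []))

      module _ {w q} (cᵤ : Coloured A u w q) where
        OnA : V → Set
        OnA x = x ≡ a₁ ⊎ x ≡ a₂

        q≢c : q ≢ c
        q≢c refl = clear₀ (here refl) cᵤ

        known : ∀ {x z i} → Coloured A x z i → (SameEdge (a₁ , a₂) (x , z) × i ≡ y) ⊎ (SameEdge (u , w) (x , z) × i ≡ q)
        known = two-known _≟_ proper₀ two
          (λ { (inj₁ (e , _)) → a₁≢u e ; (inj₂ (_ , e)) → a₂≢u e }) cₐ cᵤ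

        on-a : ∀ {x z} → SameEdge (a₁ , a₂) (x , z) → OnA x
        on-a (inj₁ (e , _)) = inj₁ (≡-sym e)
        on-a (inj₂ (_ , e)) = inj₂ (≡-sym e)

        u-off-a : ∀ {z} → ¬ SameEdge (a₁ , a₂) (u , z)
        u-off-a s with on-a s
        ... | inj₁ e = a₁≢u (≡-sym e)
        ... | inj₂ e = a₂≢u (≡-sym e)

        on-uw : ∀ {x z} → SameEdge (u , w) (x , z) → x ≡ u ⊎ x ≡ w
        on-uw (inj₁ (e , _)) = inj₁ (≡-sym e)
        on-uw (inj₂ (_ , e)) = inj₂ (≡-sym e)

        -- The possible leaves are `u` with palette `c`, `q`, then `v` with `t`, `y` if `v` lies on
        -- `a₁a₂`, and `w` with `y`, `q` if `w` does. `exclusive` keeps the last two from occurring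
        -- together; `t≢c`, `tame` and `bound` make the first two palettes incompatible.
        module _ {v t} (uv : Adj G u v) (v≢w : v ≢ w) (exclusive : OnA v → ¬ OnA w)
                 (t≢c : t ≢ c) (tame : t ≡ q → y ≢ c) (bound : y ≡ c ⊎ y ≡ q ⊎ t ≡ q) where
          D : List (V × Fin 5)
          D = (u , c) ∷ (v , t) ∷ []

          data Class (l : V) (α β : Fin 5) : Set where
            at-u : l ≡ u → α ≡ c → β ≡ q → Class l α β
            at-v : l ≡ v → OnA v → α ≡ t → β ≡ y → Class l α β
            at-w : l ≡ w → OnA w → (α ≡ y × β ≡ q) ⊎ (α ≡ q × β ≡ y) → Class l α β

          v-off-uw : ∀ {z} → ¬ SameEdge (u , w) (v , z)
          v-off-uw s with on-uw s
          ... | inj₁ e = adj⇒≢ G uv (≡-sym e)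
          ... | inj₂ e = v≢w e

          both : ∀ {l z z′} → SameEdge (a₁ , a₂) (l , z) → SameEdge (u , w) (l , z′) → l ≡ w × OnA w
          both s s′ with on-uw s′
          ... | inj₁ refl = ⊥-elim (u-off-a s)
          ... | inj₂ refl = refl , on-a s

          classify : ∀ {l} (leaf : PendantLeaf D A l) → Class l (PendantLeaf.α leaf) (PendantLeaf.β leaf)
          classify record { kind = inj₁ (here refl , _ , c₁) } with known c₁
          ... | inj₁ (s , _) = ⊥-elim (u-off-a s)
          ... | inj₂ (_ , e) = at-u refl refl e
          classify record { kind = inj₁ (there (here refl) , _ , c₁) } with known c₁
          ... | inj₁ (s , e) = at-v refl (on-a s) refl e
          ... | inj₂ (s , _) = ⊥-elim (v-off-uw s)
          classify record { kind = inj₂ (_ , _ , a≢b , c₁ , c₂) } with known c₁ | known c₂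
          ... | inj₁ (s , _) | inj₁ (s′ , _) = ⊥-elim (a≢b (sameEdge-cancel (sameEdge-trans (sameEdge-sym s) s′)))
          ... | inj₂ (s , _) | inj₂ (s′ , _) = ⊥-elim (a≢b (sameEdge-cancel (sameEdge-trans (sameEdge-sym s) s′)))
          ... | inj₁ (s , e) | inj₂ (s′ , e′) = at-w (proj₁ (both s s′)) (proj₂ (both s s′)) (inj₁ (e , e′))
          ... | inj₂ (s′ , e) | inj₁ (s , e′) = at-w (proj₁ (both s s′)) (proj₂ (both s s′)) (inj₂ (e , e′))

          u-v : Compatible c q t y → ⊥
          u-v (same e _) = t≢c e
          u-v (crossed e e′) = tame e e′
          u-v (disjoint _ n n′ n″) = [ n′ , [ n″ , n ]′ ]′ bound

          v-u : Compatible t y c q → ⊥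
          v-u (same e _) = t≢c (≡-sym e)
          v-u (crossed e e′) = tame (≡-sym e′) (≡-sym e)
          v-u (disjoint _ n n′ n″) = [ n ∘ ≡-sym , [ n″ ∘ ≡-sym , n′ ∘ ≡-sym ]′ ]′ bound

          u-w : ∀ {α β} → (α ≡ y × β ≡ q) ⊎ (α ≡ q × β ≡ y) → Compatible c q α β → y ≡ c
          u-w (inj₁ (refl , refl)) (same e _) = e
          u-w (inj₁ (refl , refl)) (crossed _ e) = contradiction e q≢c
          u-w (inj₁ (refl , refl)) (disjoint _ _ _ n) = contradiction refl n
          u-w (inj₂ (refl , refl)) (same e _) = contradiction e q≢c
          u-w (inj₂ (refl , refl)) (crossed _ e) = e
          u-w (inj₂ (refl , refl)) (disjoint _ n _ _) = contradiction refl n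

          w-u : ∀ {α β} → (α ≡ y × β ≡ q) ⊎ (α ≡ q × β ≡ y) → Compatible α β c q → y ≡ c
          w-u (inj₁ (refl , refl)) (same e _) = ≡-sym e
          w-u (inj₁ (refl , refl)) (crossed e _) = contradiction (≡-sym e) q≢c
          w-u (inj₁ (refl , refl)) (disjoint _ _ _ n) = contradiction refl n
          w-u (inj₂ (refl , refl)) (same e _) = contradiction (≡-sym e) q≢c
          w-u (inj₂ (refl , refl)) (crossed e _) = ≡-sym e
          w-u (inj₂ (refl , refl)) (disjoint _ _ n _) = contradiction refl n

          no-third : ∀ {l} → l ≢ u → l ≢ w → OnA w → PendantLeaf D A l → ⊥
          no-third l≢u l≢w w∈a leaf with classify leaf
          ... | at-u e _ _ = l≢u e
          ... | at-v _ v∈a _ _ = exclusive v∈a w∈a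
          ... | at-w e _ _ = l≢w e

          -- The palettes at `u` and `w` can agree if `y` is `c`. Then all of `A` is coloured `c` or
          -- `q`, and the pendant at `v` lies across the edge `uv` of `M`, so nothing provides a
          -- foot for `u`.
          no-foot : ∀ {l} (leaf : PendantLeaf D A l) → l ≡ u → PendantLeaf.α leaf ≡ c → PendantLeaf.β leaf ≡ q →
                    y ≡ c → ¬ PendantFoot G ((u , v) ∷ []) leaf
          no-foot _ refl e e′ _ record { coloured = inj₁ (here refl) ; i≢α = n } = n (≡-sym e)
          no-foot _ refl e e′ _ record { coloured = inj₁ (there (here refl)) ; off-M = n } = n (here sameEdge-refl)
          no-foot _ refl e e′ y≡c record { coloured = inj₂ (_ , d) ; i≢α = n ; i≢β = n′ } with known d
          ... | inj₁ (_ , i≡y) = n (trans i≡y (trans y≡c (≡-sym e)))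
          ... | inj₂ (_ , i≡q) = n′ (trans i≡q (≡-sym e′))

          free : ¬ PendantObstruction G ((u , v) ∷ []) D A
          free o = go (classify leaf₁) (classify leaf₂) compatible
            where
            open PendantObstruction o
            go : Class l₁ (PendantLeaf.α leaf₁) (PendantLeaf.β leaf₁) → Class l₂ (PendantLeaf.α leaf₂) (PendantLeaf.β leaf₂) →
                 Compatible (PendantLeaf.α leaf₁) (PendantLeaf.β leaf₁) (PendantLeaf.α leaf₂) (PendantLeaf.β leaf₂) → ⊥
            go (at-u e _ _) (at-u e′ _ _) _ = l₁≢l₂ (trans e (≡-sym e′))
            go (at-v e _ _ _) (at-v e′ _ _ _) _ = l₁≢l₂ (trans e (≡-sym e′))
            go (at-w e _ _) (at-w e′ _ _) _ = l₁≢l₂ (trans e (≡-sym e′))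
            go (at-u _ e e′) (at-v _ _ e″ e‴) k = u-v (recast e e′ e″ e‴ k)
            go (at-v _ _ e″ e‴) (at-u _ e e′) k = v-u (recast e″ e‴ e e′ k)
            go (at-v _ v∈a _ _) (at-w _ w∈a _) _ = exclusive v∈a w∈a
            go (at-w _ w∈a _) (at-v _ v∈a _ _) _ = exclusive v∈a w∈a
            go (at-u refl e e′) (at-w refl w∈a r) k =
              [ (λ (_ , n , n′ , leaf) → no-third n n′ w∈a leaf)
              , (λ (foot , _) → no-foot leaf₁ refl e e′ (u-w r (recast e e′ refl refl k)) foot) ]′ obstacle
            go (at-w refl w∈a r) (at-u refl e e′) k =
              [ (λ (_ , n , n′ , leaf) → no-third n′ n w∈a leaf)
              , (λ (_ , foot) → no-foot leaf₂ refl e e′ (w-u r (recast refl refl e e′ k)) foot) ]′ obstacle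

        touched : Solution G ((u , c) ∷ []) A A′
        touched = case rich (here refl) (w ∷ mate ∷ []) (s≤s (s≤s z≤n)) of λ (v , uv , v∉) →
          finish uv (v∉ ∘ here) (excl (v∉ ∘ here) (v∉ ∘ there ∘ here)) (y ≟ᶠ c) (y ≟ᶠ q)
          where
          -- Avoiding both `w` and `mate` keeps `v` off `a₁a₂` whenever `w` lies on it.
          mate : V
          mate with w ≟ a₁
          ... | yes _ = a₂
          ... | no _ = a₁
          excl : ∀ {v} → v ≢ w → v ≢ mate → OnA v → ¬ OnA w
          excl v≢w v≢m v∈ w∈ with w ≟ a₁
          excl v≢w v≢m (inj₁ refl) w∈ | yes refl = v≢w refl
          excl v≢w v≢m (inj₂ refl) w∈ | yes refl = v≢m refl
          excl v≢w v≢m _ (inj₁ w≡a₁) | no n = n w≡a₁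
          excl v≢w v≢m (inj₁ refl) _ | no n = v≢m refl
          excl v≢w v≢m (inj₂ refl) (inj₂ refl) | no n = v≢w refl
          finish : ∀ {v} → Adj G u v → v ≢ w → (OnA v → ¬ OnA w) → Dec (y ≡ c) → Dec (y ≡ q) → Solution G ((u , c) ∷ []) A A′
          finish {v} uv v≢w exclusive y≟c y≟q = choose y≟c y≟q
            where
            off : ¬ ∃ (Coloured A u v)
            off (_ , d) with known d
            ... | inj₁ (e , _) = u-off-a e
            ... | inj₂ (e , _) = v≢w (≡-sym (sameEdge-cancel e))
            s≢q : s ≢ q
            s≢q refl = no-s (inj₁ cᵤ)
            with-s : y ≡ c ⊎ y ≡ q → Solution G ((u , c) ∷ []) A A′
            with-s bound = assemble uv (s∉ ∘ here) off (no-s ∘ inj₁) (no-s ∘ inj₂)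
              (free uv v≢w exclusive (s∉ ∘ there ∘ here) (λ s≡q _ → s≢q s≡q) (map₂ inj₁ bound))
            choose : Dec (y ≡ c) → Dec (y ≡ q) → Solution G ((u , c) ∷ []) A A′
            choose (yes y≡c) _ = with-s (inj₁ y≡c)
            choose (no _) (yes y≡q) = with-s (inj₂ y≡q)
            -- A spare pendant colour would leave the palettes at `u` and `v` disjoint; `q` makes
            -- them meet in exactly one colour. It is available at `v` in the other layer because
            -- `shape` now says that all of `A′` is coloured `c`.
            choose (no y≢c) (no y≢q) = assemble uv (clash base∉ (palette (inj₁ cᵤ))) off avoid avoid′
              (free uv v≢w exclusive q≢c (λ _ → y≢c) (inj₂ (inj₂ refl)))
              where
              avoid : ∀ {x} → ¬ Coloured A v x q
              avoid d with known d
              ... | inj₁ (_ , e) = y≢q (≡-sym e)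
              ... | inj₂ (e , _) with on-uw e
              ... | inj₁ e′ = adj⇒≢ G uv (≡-sym e′)
              ... | inj₂ e′ = v≢w e′
              avoid′ : ∀ {x} → ¬ Coloured A′ v x q
              avoid′ d = [ y≢c , (λ all-c → q≢c (all-c d)) ]′ shape

    shared-colour-edge : Solution G ((u , c) ∷ []) A A′
    shared-colour-edge with search (λ w → coloured? {P = A} _≟_ u w)
    ... | yes (_ , _ , d) = touched d
    ... | no none = untouched λ d → none (_ , _ , d)

  Untouched : Precoloring V 5 → V → Set
  Untouched P u = ∀ {v i} → ¬ Coloured P u v i

  sole-two : ∀ {P P′} → length P ≤ 1 → length P′ ≤ 1 → ∀ u → Untouched P u ⊎ Untouched P′ u →
             ∃ λ w → ∀ {v i} → Coloured P u v i ⊎ Coloured P′ u v i → v ≡ w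
  sole-two one one′ u (inj₁ none) = let w , only = sole F one′ u in w , [ (λ d → contradiction d none) , only ]′
  sole-two one one′ u (inj₂ none) = let w , only = sole F one u in w , [ only , (λ d → contradiction d none) ]′

  module _ {u₁ c₁ u₂ c₂ P₀ P₁} (given : Consistent G ((u₁ , c₁) ∷ (u₂ , c₂) ∷ []) P₀ P₁) (u₁≢u₂ : u₁ ≢ u₂)
           (one₀ : length P₀ ≤ 1) (one₁ : length P₁ ≤ 1)
           (free₁ : Untouched P₀ u₁ ⊎ Untouched P₁ u₁) (free₂ : Untouched P₀ u₂ ⊎ Untouched P₁ u₂)
           (apart : ∀ {i} → ¬ (Coloured P₀ u₁ u₂ i ⊎ Coloured P₁ u₁ u₂ i))
           (z₁ z₂ : Fin 5) (c₁∈ : c₁ ∈ z₁ ∷ z₂ ∷ []) (c₂∈ : c₂ ∈ z₁ ∷ z₂ ∷ [])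
           (palette : ∀ {x y i} → Coloured P₀ x y i ⊎ Coloured P₁ x y i → i ∈ z₁ ∷ z₂ ∷ []) where
    open Consistent given

    -- Two prescribed colours leave a base and pendant colours `r₁`, `r₂`. If `u₁u₂` is an edge, it
    -- serves as `M` and costs only two pendants. Otherwise each vertex gets its own edge of `M`; of
    -- the four pendants only those at `u₁` and `u₂` may agree in colour, and no precoloured edge
    -- joins these, so `unobstructed-one` applies.
    two-verticals-two-colours : Solution G ((u₁ , c₁) ∷ (u₂ , c₂) ∷ []) P₀ P₁
    two-verticals-two-colours
      with fresh (z₁ ∷ z₂ ∷ []) (s≤s (s≤s z≤n))
    ... | base , base∉ with fresh (base ∷ z₁ ∷ z₂ ∷ []) (s≤s (s≤s (s≤s z≤n)))
    ... | r₁ , r₁∉ with fresh (r₁ ∷ base ∷ z₁ ∷ z₂ ∷ []) (s≤s (s≤s (s≤s (s≤s z≤n))))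
    ... | r₂ , r₂∉ with adj? G u₁ u₂
    ... | yes uv = stack F (layer proper₀ clear₀ one₀ (λ d → base∉ (palette (inj₁ d))) (λ d → apart (inj₁ d)))
                           (layer proper₁ clear₁ one₁ (λ d → base∉ (palette (inj₂ d))) (λ d → apart (inj₂ d)))
                           (Matched.functional matched) ends-one inj₁
      where
      matched : Matched G base ((u₁ , u₂) ∷ []) ((u₁ , c₁) ∷ (u₂ , c₂) ∷ [])
      matched = matched-one uv (clash base∉ c₁∈) (clash base∉ c₂∈)
      layer : ∀ {P} → IsProperPrecoloring G P → (∀ {u v c} → (u , c) ∈ (u₁ , c₁) ∷ (u₂ , c₂) ∷ [] → ¬ Coloured P u v c) →
              length P ≤ 1 → (∀ {x y} → ¬ Coloured P x y base) → (∀ {i} → ¬ Coloured P u₁ u₂ i) →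
              LayerColouring G base ((u₁ , u₂) ∷ []) ((u₁ , c₁) ∷ (u₂ , c₂) ∷ []) P
      layer proper clear one no-base off = Layer.layer-few F G deg
        (pendants matched proper no-base ((λ (_ , d) → off d) ∷ []) (clear (here refl) ∷ clear (there (here refl)) ∷ []))
        (ℕ.+-monoˡ-≤ 2 one)
    ... | no ¬uv with sole-two one₀ one₁ u₁ free₁ | sole-two one₀ one₁ u₂ free₂
    ... | w₁ , only₁ | w₂ , only₂ with rich (here refl) (w₁ ∷ []) (s≤s z≤n)
    ... | v₁ , uv₁ , v₁∉ with rich (there (here refl)) (w₂ ∷ v₁ ∷ []) (s≤s (s≤s z≤n))
    ... | v₂ , uv₂ , v₂∉ =
      stack F (layer proper₀ clear₀ one₀ (λ d → palette (inj₁ d)) (λ d → apart (inj₁ d)) (λ d → only₁ (inj₁ d)) (λ d → only₂ (inj₁ d)))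
              (layer proper₁ clear₁ one₁ (λ d → palette (inj₂ d)) (λ d → apart (inj₂ d)) (λ d → only₁ (inj₂ d)) (λ d → only₂ (inj₂ d)))
              (Matched.functional matched) ends B⊆
      where
      M = (u₁ , v₁) ∷ (u₂ , v₂) ∷ []
      D = (u₁ , c₁) ∷ (u₂ , c₂) ∷ (v₁ , r₁) ∷ (v₂ , r₂) ∷ []
      u₁≢v₂ : u₁ ≢ v₂
      u₁≢v₂ refl = ¬uv (adj-sym G uv₂)
      u₂≢v₁ : u₂ ≢ v₁
      u₂≢v₁ refl = ¬uv uv₁
      v₁≢v₂ : v₁ ≢ v₂
      v₁≢v₂ refl = v₂∉ (there (here refl))
      in-z : ∀ {i} → i ∈ z₁ ∷ z₂ ∷ [] → i ≢ r₁ × i ≢ r₂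
      in-z i∈ = clash r₁∉ (there i∈) , clash r₂∉ (there (there i∈))
      matched : Matched G base M D
      matched = record
        { edges = uv₁ ∷ uv₂ ∷ []
        ; apart = (nonmeeting u₁≢u₂ u₁≢v₂ (≢-sym u₂≢v₁) v₁≢v₂ ∷ []) ∷ [] ∷ []
        ; colours = clash base∉ c₁∈ ∷ clash base∉ c₂∈ ∷ (r₁∉ ∘ here) ∷ (r₂∉ ∘ there ∘ here) ∷ []
        ; keys = (u₁≢u₂ ∷ adj⇒≢ G uv₁ ∷ u₁≢v₂ ∷ []) ∷ (u₂≢v₁ ∷ adj⇒≢ G uv₂ ∷ []) ∷ (v₁≢v₂ ∷ []) ∷ [] ∷ []
        ; covered = (_ , here sameEdge-refl) ∷ (_ , there (here sameEdge-refl)) ∷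
                    (_ , here (sameEdge-flip sameEdge-refl)) ∷ (_ , there (here (sameEdge-flip sameEdge-refl))) ∷ [] }
      ends : ∀ {x y} → On M x y → ∃ λ t → (x , t) ∈ D
      ends (here (inj₁ (refl , _))) = _ , here refl
      ends (here (inj₂ (_ , refl))) = _ , there (there (here refl))
      ends (there (here (inj₁ (refl , _)))) = _ , there (here refl)
      ends (there (here (inj₂ (_ , refl)))) = _ , there (there (there (here refl)))
      B⊆ : ∀ {u c} → (u , c) ∈ (u₁ , c₁) ∷ (u₂ , c₂) ∷ [] → (u , c) ∈ D ⊎ (c ≡ base × ∀ {t} → (u , t) ∉ D)
      B⊆ (here e) = inj₁ (here e)
      B⊆ (there (here e)) = inj₁ (there (here e))
      layer : ∀ {P} → IsProperPrecoloring G P → (∀ {u v c} → (u , c) ∈ (u₁ , c₁) ∷ (u₂ , c₂) ∷ [] → ¬ Coloured P u v c) →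
              length P ≤ 1 → (∀ {x y i} → Coloured P x y i → i ∈ z₁ ∷ z₂ ∷ []) → (∀ {i} → ¬ Coloured P u₁ u₂ i) →
              (∀ {v i} → Coloured P u₁ v i → v ≡ w₁) → (∀ {v i} → Coloured P u₂ v i → v ≡ w₂) →
              LayerColouring G base M D P
      layer proper clear one colours off only₁ only₂ = Layer.layer-unobstructed F G deg
        (pendants matched proper (λ d → base∉ (colours d))
          ((λ (_ , d) → v₁∉ (here (only₁ d))) ∷ (λ (_ , d) → v₂∉ (here (only₂ d))) ∷ [])
          (clear (here refl) ∷ clear (there (here refl)) ∷ (λ d → proj₁ (in-z (colours d)) refl) ∷
           (λ d → proj₂ (in-z (colours d)) refl) ∷ []))
        (unobstructed-one _≟_ proper one
          ((inj₂ (λ (_ , d) → off d) ∷ inj₁ (proj₁ (in-z c₁∈)) ∷ inj₁ (proj₂ (in-z c₁∈)) ∷ []) ∷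
           (inj₁ (proj₁ (in-z c₂∈)) ∷ inj₁ (proj₂ (in-z c₂∈)) ∷ []) ∷ (inj₁ (≢-sym (r₂∉ ∘ here)) ∷ []) ∷ [] ∷ []))

  consistent-mono : ∀ {B B′ P₀ P₁} → (∀ {x} → x ∈ B′ → x ∈ B) → Consistent G B P₀ P₁ → Consistent G B′ P₀ P₁
  consistent-mono sub given = record
    { functional = λ b b′ → functional (sub b) (sub b′) ; rich = λ b → rich (sub b) ; proper₀ = proper₀
    ; proper₁ = proper₁ ; clear₀ = λ b → clear₀ (sub b) ; clear₁ = λ b → clear₁ (sub b) }
    where open Consistent given

  solution-mono : ∀ {B B′ P₀ P₁} → (∀ {x} → x ∈ B′ → x ∈ B) → Solution G B P₀ P₁ → Solution G B′ P₀ P₁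
  solution-mono sub s = record
    { φ₀ = φ₀ ; φ₁ = φ₁ ; τ = τ ; proper₀ = proper₀ ; proper₁ = proper₁ ; extends₀ = extends₀ ; extends₁ = extends₁
    ; extends = λ b → extends (sub b) ; free₀ = free₀ ; free₁ = free₁ }
    where open Solution s

  swap-two : ∀ {A : Set} {a b x : A} → x ∈ a ∷ b ∷ [] → x ∈ b ∷ a ∷ []
  swap-two (here e) = there (here e)
  swap-two (there (here e)) = here e

  colours-of : Precoloring V 5 → List (Fin 5)
  colours-of = map proj₂

  colours-length : ∀ P P′ → length (colours-of P ++ colours-of P′) ≡ length P + length P′
  colours-length P P′ = trans (length-++ (colours-of P)) (cong₂ _+_ (length-map proj₂ P) (length-map proj₂ P′))

  coloured-∈ : ∀ {P : Precoloring V 5} {u v i} → Coloured P u v i → i ∈ colours-of P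
  coloured-∈ (_ , m , _) = ∈-map⁺ proj₂ m

  module _ {u₁ c₁ u₂ c₂ P₀ P₁} (given : Consistent G ((u₁ , c₁) ∷ (u₂ , c₂) ∷ []) P₀ P₁) (u₁≢u₂ : u₁ ≢ u₂)
           (c₁≢c₂ : c₁ ≢ c₂) (one₀ : length P₀ ≤ 1) (one₁ : length P₁ ≤ 1)
           (no-c₁ : ∀ {x y} → ¬ (Coloured P₀ x y c₁ ⊎ Coloured P₁ x y c₁))
           {v} (uv : Adj G u₂ v) (v≢u₁ : v ≢ u₁) (off : ∀ {i} → ¬ (Coloured P₀ u₂ v i ⊎ Coloured P₁ u₂ v i)) where
    open Consistent given

    -- With `c₁` as base the vertical edge at `u₁` is free of charge, provided that the edge of `M`
    -- at `u₂` misses `u₁`.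
    first-colour-as-base : Solution G ((u₁ , c₁) ∷ (u₂ , c₂) ∷ []) P₀ P₁
    first-colour-as-base with fresh (c₁ ∷ colours-of P₀ ++ colours-of P₁) (s≤s (short one₀ one₁))
      where
      short : length P₀ ≤ 1 → length P₁ ≤ 1 → length (colours-of P₀ ++ colours-of P₁) ≤ 3
      short p q = subst (_≤ 3) (≡-sym (colours-length P₀ P₁))
                    (ℕ.≤-trans (ℕ.+-mono-≤ p q) (s≤s (s≤s z≤n)))
    ... | t , t∉ = stack F
        (layer proper₀ clear₀ one₀ (λ d → no-c₁ (inj₁ d)) (λ d → off (inj₁ d)) (λ d → t∉ (there (∈-++⁺ˡ (coloured-∈ d)))))
        (layer proper₁ clear₁ one₁ (λ d → no-c₁ (inj₂ d)) (λ d → off (inj₂ d)) (λ d → t∉ (there (∈-++⁺ʳ (colours-of P₀) (coloured-∈ d)))))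
        (Matched.functional matched) ends-one B⊆
      where
      matched : Matched G c₁ ((u₂ , v) ∷ []) ((u₂ , c₂) ∷ (v , t) ∷ [])
      matched = matched-one uv (≢-sym c₁≢c₂) (t∉ ∘ here)
      B⊆ : ∀ {u c} → (u , c) ∈ (u₁ , c₁) ∷ (u₂ , c₂) ∷ [] →
           (u , c) ∈ (u₂ , c₂) ∷ (v , t) ∷ [] ⊎ (c ≡ c₁ × ∀ {s} → (u , s) ∉ (u₂ , c₂) ∷ (v , t) ∷ [])
      B⊆ (here refl) = inj₂ (refl , λ { (here refl) → u₁≢u₂ refl ; (there (here refl)) → v≢u₁ refl })
      B⊆ (there (here e)) = inj₁ (here e)
      layer : ∀ {P} → IsProperPrecoloring G P → (∀ {u v c} → (u , c) ∈ (u₁ , c₁) ∷ (u₂ , c₂) ∷ [] → ¬ Coloured P u v c) →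
              length P ≤ 1 → (∀ {x y} → ¬ Coloured P x y c₁) → (∀ {i} → ¬ Coloured P u₂ v i) → (∀ {x y} → ¬ Coloured P x y t) →
              LayerColouring G c₁ ((u₂ , v) ∷ []) ((u₂ , c₂) ∷ (v , t) ∷ []) P
      layer proper clear one no-base off no-t = Layer.layer-few F G deg
        (pendants matched proper no-base ((λ (_ , d) → off d) ∷ []) (clear (there (here refl)) ∷ no-t ∷ []))
        (ℕ.+-monoˡ-≤ 2 one)

  module _ {u₁ c₁ u₂ c₂ P₀ P₁} (given : Consistent G ((u₁ , c₁) ∷ (u₂ , c₂) ∷ []) P₀ P₁) (u₁≢u₂ : u₁ ≢ u₂)
           (c₁≢c₂ : c₁ ≢ c₂) (one₀ : length P₀ ≤ 1) (one₁ : length P₁ ≤ 1) where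
    open Consistent given
    private
      touched? : ∀ (P : Precoloring V 5) u → Dec (∃ λ v → ∃ (Coloured P u v))
      touched? P u = search λ v → coloured? _≟_ u v

    -- The edge of `M` at `u₂` must avoid `u₁` and every precoloured edge. Three neighbours suffice
    -- for this unless both layers have a precoloured edge at `u₂`.
    base-or-touched : (∀ {x y} → ¬ (Coloured P₀ x y c₁ ⊎ Coloured P₁ x y c₁)) → Solution G ((u₁ , c₁) ∷ (u₂ , c₂) ∷ []) P₀ P₁ ⊎
                      ((∃ λ v → ∃ (Coloured P₀ u₂ v)) × (∃ λ v → ∃ (Coloured P₁ u₂ v)))
    base-or-touched no-c₁ with touched? P₀ u₂ | touched? P₁ u₂
    ... | yes t₀ | yes t₁ = inj₂ (t₀ , t₁)
    ... | no n | _ = inj₁ (go (sole-two one₀ one₁ u₂ (inj₁ λ d → n (_ , _ , d))))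
      where
      go : (∃ λ w → ∀ {v i} → Coloured P₀ u₂ v i ⊎ Coloured P₁ u₂ v i → v ≡ w) → Solution G ((u₁ , c₁) ∷ (u₂ , c₂) ∷ []) P₀ P₁
      go (w , only) with rich (there (here refl)) (u₁ ∷ w ∷ []) (s≤s (s≤s z≤n))
      ... | v , uv , v∉ = first-colour-as-base given u₁≢u₂ c₁≢c₂ one₀ one₁ no-c₁ uv (v∉ ∘ here) (λ d → v∉ (there (here (only d))))
    ... | yes _ | no n = inj₁ (go (sole-two one₀ one₁ u₂ (inj₂ λ d → n (_ , _ , d))))
      where
      go : (∃ λ w → ∀ {v i} → Coloured P₀ u₂ v i ⊎ Coloured P₁ u₂ v i → v ≡ w) → Solution G ((u₁ , c₁) ∷ (u₂ , c₂) ∷ []) P₀ P₁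
      go (w , only) with rich (there (here refl)) (u₁ ∷ w ∷ []) (s≤s (s≤s z≤n))
      ... | v , uv , v∉ = first-colour-as-base given u₁≢u₂ c₁≢c₂ one₀ one₁ no-c₁ uv (v∉ ∘ here) (λ d → v∉ (there (here (only d))))

  single-colour : ∀ {e : V × V} {x : Fin 5} {u v i} → Coloured ((e , x) ∷ []) u v i → i ≡ x
  single-colour (_ , here refl , _) = refl

  single-edge : ∀ {e : V × V} {x : Fin 5} {u v u′ v′ i j} → Coloured ((e , x) ∷ []) u v i →
                Coloured ((e , x) ∷ []) u′ v′ j → SameEdge (u , v) (u′ , v′)
  single-edge (_ , here refl , s) (_ , here refl , s′) = sameEdge-trans (sameEdge-sym s) s′

  -- If both precoloured edges end at `u₂`, neither has colour `c₂`, which can then be the base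
  -- instead; an edge at `u₁` that does not lead to `u₂` is uncoloured in both layers.
  first-colour-unused : ∀ {u₁ c₁ u₂ c₂ e₀ x e₁ y} →
    Consistent G ((u₁ , c₁) ∷ (u₂ , c₂) ∷ []) ((e₀ , x) ∷ []) ((e₁ , y) ∷ []) → u₁ ≢ u₂ → c₁ ≢ c₂ → x ≢ c₁ → y ≢ c₁ →
    Solution G ((u₁ , c₁) ∷ (u₂ , c₂) ∷ []) ((e₀ , x) ∷ []) ((e₁ , y) ∷ [])
  first-colour-unused {u₁} {c₁} {u₂} {c₂} {e₀} {x} {e₁} {y} given u₁≢u₂ c₁≢c₂ x≢ y≢
    with base-or-touched given u₁≢u₂ c₁≢c₂ (s≤s z≤n) (s≤s z≤n)
           (λ { (inj₁ d) → x≢ (≡-sym (single-colour d)) ; (inj₂ d) → y≢ (≡-sym (single-colour d)) })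
  ... | inj₁ s = s
  ... | inj₂ ((_ , _ , ca) , (_ , _ , cb)) with Consistent.rich given (here refl) (u₂ ∷ []) (s≤s z≤n)
  ... | v , uv , v∉ = solution-mono swap-two
      (first-colour-as-base (consistent-mono swap-two given) (≢-sym u₁≢u₂) (≢-sym c₁≢c₂) (s≤s z≤n) (s≤s z≤n)
        (λ { (inj₁ d) → clear₀ (there (here refl)) (subst (Coloured _ _ _) (trans (single-colour ca) (≡-sym (single-colour d))) ca)
           ; (inj₂ d) → clear₁ (there (here refl)) (subst (Coloured _ _ _) (trans (single-colour cb) (≡-sym (single-colour d))) cb) })
        uv (v∉ ∘ here)
        (λ { (inj₁ d) → v∉ (here (ends (single-edge ca d))) ; (inj₂ d) → v∉ (here (ends (single-edge cb d))) }))
    where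
    open Consistent given
    ends : ∀ {w} → SameEdge (u₂ , w) (u₁ , v) → v ≡ u₂
    ends (inj₁ (e , _)) = contradiction (≡-sym e) u₁≢u₂
    ends (inj₂ (e , _)) = ≡-sym e

  -- Each vertical colour recurs in one layer, so neither is convenient as base, but only two
  -- colours occur at all.
  crossing-verticals : ∀ {u₁ c₁ u₂ c₂ e₀ e₁} →
    Consistent G ((u₁ , c₁) ∷ (u₂ , c₂) ∷ []) ((e₀ , c₁) ∷ []) ((e₁ , c₂) ∷ []) → u₁ ≢ u₂ →
    Solution G ((u₁ , c₁) ∷ (u₂ , c₂) ∷ []) ((e₀ , c₁) ∷ []) ((e₁ , c₂) ∷ [])
  crossing-verticals {u₁} {c₁} {u₂} {c₂} {e₀} {e₁} given u₁≢u₂ =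
    two-verticals-two-colours given u₁≢u₂ (s≤s z≤n) (s≤s z≤n) (inj₁ off₁) (inj₂ off₂)
      (λ { (inj₁ d) → off₁ d ; (inj₂ d) → off₂ (coloured-flip d) })
      c₁ c₂ (here refl) (there (here refl))
      (λ { (inj₁ d) → here (single-colour d) ; (inj₂ d) → there (here (single-colour d)) })
    where
    open Consistent given
    off₁ : Untouched ((e₀ , c₁) ∷ []) u₁
    off₁ d = clear₀ (here refl) (subst (Coloured _ _ _) (single-colour d) d)
    off₂ : Untouched ((e₁ , c₂) ∷ []) u₂
    off₂ d = clear₁ (there (here refl)) (subst (Coloured _ _ _) (single-colour d) d)

  two-different-verticals : ∀ {u₁ c₁ u₂ c₂ e₀ x e₁ y} →
    Consistent G ((u₁ , c₁) ∷ (u₂ , c₂) ∷ []) ((e₀ , x) ∷ []) ((e₁ , y) ∷ []) → u₁ ≢ u₂ → c₁ ≢ c₂ →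
    Solution G ((u₁ , c₁) ∷ (u₂ , c₂) ∷ []) ((e₀ , x) ∷ []) ((e₁ , y) ∷ [])
  two-different-verticals {u₁} {c₁} {u₂} {c₂} {e₀} {x} {e₁} {y} given u₁≢u₂ c₁≢c₂
    with x ≟ᶠ c₁ | y ≟ᶠ c₁ | x ≟ᶠ c₂ | y ≟ᶠ c₂
  ... | no p | no q | _ | _ = first-colour-unused given u₁≢u₂ c₁≢c₂ p q
  ... | _ | _ | no p | no q = solution-mono swap-two
          (first-colour-unused (consistent-mono swap-two given) (≢-sym u₁≢u₂) (≢-sym c₁≢c₂) p q)
  ... | yes refl | _ | yes refl | _ = contradiction refl c₁≢c₂
  ... | _ | yes refl | _ | yes refl = contradiction refl c₁≢c₂
  ... | yes refl | _ | _ | yes refl = crossing-verticals given u₁≢u₂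
  ... | _ | yes refl | yes refl | _ = solution-swap (crossing-verticals (consistent-swap given) u₁≢u₂)

  -- No vertical edge, or vertical edges of a single colour

  class : Fin 5 → Precoloring V 5 → List (V × V)
  class c P = map proj₁ (filter (λ q → proj₂ q ≟ᶠ c) P)

  others : Fin 5 → Precoloring V 5 → Precoloring V 5
  others c P = filter (λ q → ¬? (proj₂ q ≟ᶠ c)) P

  on-class : ∀ {c P u v} → On (class c P) u v → Coloured P u v c
  on-class {c} {P} m with find m
  ... | e , e∈ , s with ∈-map⁻ proj₁ e∈
  ... | (_ , i) , q∈ , refl with ∈-filter⁻ (λ q → proj₂ q ≟ᶠ c) {xs = P} q∈
  ... | q∈′ , refl = e , q∈′ , s

  class-on : ∀ {c P u v} → Coloured P u v c → On (class c P) u v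
  class-on {c} (e , m , s) = lose (∈-map⁺ proj₁ (∈-filter⁺ (λ q → proj₂ q ≟ᶠ c) m refl)) s

  others-⊆ : ∀ {c} P {u v i} → Coloured (others c P) u v i → Coloured P u v i × i ≢ c
  others-⊆ {c} P (e , m , s) with ∈-filter⁻ (λ q → ¬? (proj₂ q ≟ᶠ c)) {xs = P} m
  ... | m′ , i≢c = (e , m′ , s) , i≢c

  others-proper : ∀ {c P} → IsProperPrecoloring G P → IsProperPrecoloring G (others c P)
  others-proper {c} {P} proper = record
    { areEdges = λ m → areEdges (sub m) ; consistent = λ m m′ → consistent (sub m) (sub m′)
    ; proper = λ x y z m m′ → IsProperPrecoloring.proper proper x y z (sub m) (sub m′) }
    where
    open IsProperPrecoloring proper using (areEdges; consistent)
    sub : ∀ {q} → q ∈ others c P → q ∈ P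
    sub m = proj₁ (∈-filter⁻ (λ q → ¬? (proj₂ q ≟ᶠ c)) {xs = P} m)

  others-length : ∀ c P → length (others c P) ≤ length P
  others-length c P = length-filter (λ q → ¬? (proj₂ q ≟ᶠ c)) P

  -- Taking the colour of one of the four entries as base leaves at most three others.
  single-layer : ∀ {P} → IsProperPrecoloring G P → length P ≤ 4 → Solution G [] P []
  single-layer {[]} proper _ = mirror F deg {base = zero} {M = []} {D = []}
    (Layer.layer-few F G deg (pendants (record { edges = [] ; apart = [] ; colours = [] ; keys = [] ; covered = [] })
      proper (λ ()) [] []) z≤n) (λ ()) (λ ()) (λ ())
  single-layer {P@((e , c) ∷ P′)} proper (s≤s short) = mirror F deg {base = c} {M = class c P} {D = []}
    (Layer.layer-few F G deg record
      { M-edges = λ m → coloured-adj proper (on-class {P = P} m)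
      ; M-matching = λ m m′ → decidable-stable (_ ≟ _) λ v≢w →
          coloured-proper proper (on-class {P = P} m) (on-class {P = P} m′) v≢w refl
      ; D-colours = λ () ; D-functional = λ () ; D-degree = λ ()
      ; P-proper = others-proper proper
      ; P-colours = λ m → proj₂ (others-⊆ P (_ , m , sameEdge-refl))
      ; P-off-M = λ d m → let d′ , i≢c = others-⊆ P d in i≢c (coloured-functional proper d′ (on-class {P = P} m))
      ; P-D = λ _ () }
      (subst (_≤ 3) (≡-sym (ℕ.+-identityʳ _)) (ℕ.≤-trans (ℕ.≤-pred (filter-notAll (λ q → ¬? (proj₂ q ≟ᶠ c)) P (here λ n → n refl))) short)))
    (λ ()) (λ m → class-on {P = P} (_ , m , sameEdge-refl)) (λ ())

  unmatched : ∀ {base} → Matched G base [] []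
  unmatched = record { edges = [] ; apart = [] ; colours = [] ; keys = [] ; covered = [] }

  -- If both layers have entries, each has at most three, and a fifth colour is left for the
  -- vertical edges; `M` is empty.
  no-verticals : ∀ {P₀ P₁} → Consistent G [] P₀ P₁ → length P₀ + length P₁ ≤ 4 → Solution G [] P₀ P₁
  no-verticals {P₀} {[]} given short = single-layer (Consistent.proper₀ given) (subst (_≤ 4) (ℕ.+-identityʳ _) short)
  no-verticals {[]} {P₁@(_ ∷ _)} given short = solution-swap (single-layer (Consistent.proper₁ given) short)
  no-verticals {P₀@(_ ∷ P₀′)} {P₁@(_ ∷ P₁′)} given short
    with fresh (colours-of P₀ ++ colours-of P₁) (subst (_≤ 4) (≡-sym (colours-length P₀ P₁)) short)
  ... | base , base∉ = stack F {base = base} {M = []} {D = []}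
      (layer (Consistent.proper₀ given) (λ d → base∉ (∈-++⁺ˡ (coloured-∈ d)))
        (ℕ.≤-pred (ℕ.≤-trans (s≤s (s≤s (ℕ.m≤m+n (length P₀′) (length P₁′)))) (subst (_≤ 4) (cong suc (ℕ.+-suc (length P₀′) (length P₁′))) short))))
      (layer (Consistent.proper₁ given) (λ d → base∉ (∈-++⁺ʳ (colours-of P₀) (coloured-∈ d)))
        (ℕ.≤-pred (ℕ.≤-trans (s≤s (ℕ.m≤n+m (length P₁) (length P₀′))) short)))
      (λ ()) (λ ()) (λ ())
    where
    layer : ∀ {P} → IsProperPrecoloring G P → (∀ {x y} → ¬ Coloured P x y base) → length P ≤ 3 → LayerColouring G base [] [] P
    layer proper no-base few = Layer.layer-few F G deg (pendants unmatched proper no-base [] [])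
      (subst (_≤ 3) (≡-sym (ℕ.+-identityʳ _)) few)

  -- All vertical edges get c except over the edges of E = class c P₀; these are first coloured
  -- with an unused colour d, which is then exchanged with c along the four-cycles over E.
  module _ {B P₀ P₁ c} (given : Consistent G B P₀ P₁) (monochrome : ∀ {u c′} → (u , c′) ∈ B → c′ ≡ c)
           (few : length P₀ + length P₁ ≤ 3) (no-c : ∀ {x y} → ¬ Coloured P₁ x y c)
           (single : ∀ {x y} → Coloured P₀ x y c → ¬ ∃ (Coloured P₁ x y)) where
    open Consistent given
    private
      used : List (Fin 5)
      used = c ∷ colours-of P₀ ++ colours-of P₁

      used-short : length used ≤ 4
      used-short = s≤s (subst (_≤ 3) (≡-sym (colours-length P₀ P₁)) few)

    module Exchange {d} (d∉ : d ∉ used) where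
      d≢c : d ≢ c
      d≢c e = d∉ (here e)

      E : List (V × V)
      E = class c P₀

      mark : V × V → (V × V) × Fin 5
      mark e = e , d

      -- `E` is prescribed in colour `d` in both layers, so each four-cycle over it is coloured
      -- alternately `d` and `c` and can be exchanged.
      Q : Precoloring V 5 → Precoloring V 5
      Q P = P ++ map mark E

      marked : ∀ P {u v i} → Coloured (Q P) u v i → Coloured P u v i ⊎ (i ≡ d × Coloured P₀ u v c)
      marked P (e , m , s) with ∈-++⁻ P m
      ... | inj₁ m′ = inj₁ (e , m′ , s)
      ... | inj₂ m′ with ∈-map⁻ mark m′
      ... | _ , e∈ , refl = inj₂ (refl , on-class {P = P₀} (lose e∈ s))

      mark-∈ : ∀ P {u v} → Coloured P₀ u v c → Coloured (Q P) u v d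
      mark-∈ P c₀ with find (class-on {P = P₀} c₀)
      ... | e , e∈ , s = e , ∈-++⁺ʳ P (∈-map⁺ mark e∈) , s

      module _ {P} (proper : IsProperPrecoloring G P) (no-c : ∀ {x y} → ¬ Coloured P x y c)
               (no-d : ∀ {x y} → ¬ Coloured P x y d) (single : ∀ {x y} → Coloured P₀ x y c → ¬ ∃ (Coloured P x y))
               (short : length P + length E ≤ 3) where
        Q-proper : IsProperPrecoloring G (Q P)
        Q-proper = record
          { areEdges = λ m → edge (marked P (_ , m , sameEdge-refl))
          ; consistent = λ m m′ s → agree (marked P (_ , m , sameEdge-refl)) (marked P (_ , m′ , sameEdge-sym s))
          ; proper = λ _ _ _ m m′ s s′ → differ (marked P (_ , m , s)) (marked P (_ , m′ , s′)) }
          where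
          Mark : V → V → Fin 5 → Set
          Mark u v i = Coloured P u v i ⊎ (i ≡ d × Coloured P₀ u v c)
          edge : ∀ {u v i} → Mark u v i → Adj G u v
          edge (inj₁ p) = coloured-adj proper p
          edge (inj₂ (_ , p)) = coloured-adj proper₀ p
          agree : ∀ {u v i j} → Mark u v i → Mark u v j → i ≡ j
          agree (inj₁ p) (inj₁ q) = coloured-functional proper p q
          agree (inj₁ p) (inj₂ (_ , q)) = contradiction (_ , p) (single q)
          agree (inj₂ (_ , p)) (inj₁ q) = contradiction (_ , q) (single p)
          agree (inj₂ (e , _)) (inj₂ (e′ , _)) = trans e (≡-sym e′)
          differ : ∀ {u v w i j} → Mark u v i → Mark u w j → v ≢ w → i ≢ j
          differ (inj₁ p) (inj₁ q) v≢w = coloured-proper proper p q v≢w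
          differ (inj₁ p) (inj₂ (refl , _)) _ refl = no-d p
          differ (inj₂ (refl , _)) (inj₁ q) _ refl = no-d q
          differ (inj₂ (_ , p)) (inj₂ (_ , q)) v≢w _ = coloured-proper proper₀ p q v≢w refl

        layer : LayerColouring G c [] [] (Q P)
        layer = Layer.layer-few F G deg (pendants unmatched Q-proper
          (λ m → [ no-c , (λ (e , _) → d≢c (≡-sym e)) ]′ (marked P m)) [] [])
          (subst (_≤ 3) (≡-sym (trans (ℕ.+-identityʳ _) (trans (length-++ P) (cong (length P +_) (length-map mark E))))) short)

      class-length : length (others c P₀) + length E ≤ length P₀
      class-length = subst (λ n → length (others c P₀) + n ≤ length P₀) (≡-sym (length-map proj₁ (filter (λ q → proj₂ q ≟ᶠ c) P₀))) (split P₀)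
        where
        split : ∀ P → length (others c P) + length (filter (λ q → proj₂ q ≟ᶠ c) P) ≤ length P
        split [] = z≤n
        split ((e , i) ∷ P) with i ≟ᶠ c
        ... | yes _ = subst (_≤ suc (length P)) (≡-sym (ℕ.+-suc (length (others c P)) _)) (s≤s (split P))
        ... | no _ = s≤s (split P)

      L₀ : LayerColouring G c [] [] (Q (others c P₀))
      L₀ = layer (others-proper proper₀) (λ m → proj₂ (others-⊆ P₀ m) refl)
        (λ m → d∉ (there (∈-++⁺ˡ (coloured-∈ (proj₁ (others-⊆ P₀ m))))))
        (λ p (i , q) → proj₂ (others-⊆ P₀ q) (coloured-functional proper₀ (proj₁ (others-⊆ P₀ q)) p))
        (ℕ.≤-trans class-length (ℕ.≤-trans (ℕ.m≤m+n _ _) few))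

      L₁ : LayerColouring G c [] [] (Q P₁)
      L₁ = layer proper₁ no-c (λ m → d∉ (there (∈-++⁺ʳ (colours-of P₀) (coloured-∈ m)))) single
        (ℕ.≤-trans (ℕ.≤-trans (ℕ.+-monoʳ-≤ (length P₁) (ℕ.≤-trans (ℕ.m≤n+m _ _) class-length))
          (ℕ.≤-reflexive (ℕ.+-comm (length P₁) (length P₀)))) few)

      over? : ∀ u → Dec (∃ λ v → On E u v)
      over? u = search λ v → on? _≟_ E u v

      τ : V → Fin 5
      τ u with over? u
      ... | yes _ = d
      ... | no _ = c

      module Swap {P} (L : LayerColouring G c [] [] (Q P)) where
        open LayerColouring L renaming (φ to ψ)
        φ : V → V → Fin 5
        φ u v with on? _≟_ E u v
        ... | yes _ = c
        ... | no _ = ψ u v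

        φ-on : ∀ {u v} → Coloured P₀ u v c → φ u v ≡ c
        φ-on {u} {v} p with on? _≟_ E u v
        ... | yes _ = refl
        ... | no n = contradiction (class-on {P = P₀} p) n

        on-d : ∀ {u v} → On E u v → ψ u v ≡ d
        on-d m with mark-∈ P (on-class {P = P₀} m)
        ... | e , m′ , inj₁ (refl , refl) = extends m′
        ... | e , m′ , inj₂ (refl , refl) =
          trans (IsProperEdgeColoring.symmetric proper _ _ (coloured-adj proper₀ (on-class {P = P₀} m))) (extends m′)

        φ-proper : IsProperEdgeColoring G 5 φ
        φ-proper = record { symmetric = symm ; proper = ok }
          where
          symm : ∀ u v → Adj G u v → φ u v ≡ φ v u
          symm u v uv with on? _≟_ E u v | on? _≟_ E v u
          ... | yes _ | yes _ = refl
          ... | yes m | no n = contradiction (on-flip m) n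
          ... | no n | yes m = contradiction (on-flip m) n
          ... | no _ | no _ = IsProperEdgeColoring.symmetric proper _ _ uv
          ok : ∀ u v w → Adj G u v → Adj G u w → v ≢ w → φ u v ≢ φ u w
          ok u v w uv uw v≢w e with on? _≟_ E u v | on? _≟_ E u w
          ... | yes m | yes m′ = coloured-proper proper₀ (on-class {P = P₀} m) (on-class {P = P₀} m′) v≢w refl
          ... | yes _ | no _ = off-M (λ ()) (≡-sym e)
          ... | no _ | yes _ = off-M (λ ()) e
          ... | no _ | no _ = IsProperEdgeColoring.proper proper _ _ _ uv uw v≢w e

        free : ∀ {u v} → Adj G u v → φ u v ≢ τ u
        free {u} {v} uv e with over? u | on? _≟_ E u v
        ... | yes _ | yes _ = d≢c (≡-sym e)
        ... | yes (w , uw) | no n = IsProperEdgeColoring.proper proper u v w uv (coloured-adj proper₀ (on-class {P = P₀} uw))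
                (λ { refl → n uw }) (trans e (≡-sym (on-d uw)))
        ... | no n | yes m = n (v , m)
        ... | no _ | no _ = off-M (λ ()) e

        φ-off : ∀ {u v} → ¬ Coloured P₀ u v c → φ u v ≡ ψ u v
        φ-off {u} {v} n with on? _≟_ E u v
        ... | yes m = contradiction (on-class {P = P₀} m) n
        ... | no _ = refl

      solution : Solution G B P₀ P₁
      solution = record
        { φ₀ = S₀.φ ; φ₁ = S₁.φ ; τ = τ ; proper₀ = S₀.φ-proper ; proper₁ = S₁.φ-proper
        ; extends₀ = ext₀ ; extends₁ = ext₁ ; extends = τ-B ; free₀ = S₀.free ; free₁ = S₁.free }
        where
        module S₀ = Swap L₀
        module S₁ = Swap L₁
        ext₀ : Extends S₀.φ P₀
        ext₀ {i = i} m with i ≟ᶠ c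
        ... | yes refl = S₀.φ-on (_ , m , sameEdge-refl)
        ... | no i≢c = trans (S₀.φ-off λ p → i≢c (coloured-functional proper₀ (_ , m , sameEdge-refl) p))
                (LayerColouring.extends L₀ (∈-++⁺ˡ (∈-filter⁺ (λ q → ¬? (proj₂ q ≟ᶠ c)) m i≢c)))
        ext₁ : Extends S₁.φ P₁
        ext₁ m = trans (S₁.φ-off λ p → single p (_ , _ , m , sameEdge-refl)) (LayerColouring.extends L₁ (∈-++⁺ˡ m))
        τ-B : ∀ {u c′} → (u , c′) ∈ B → τ u ≡ c′
        τ-B {u} b with monochrome b
        ... | refl with over? u
        ... | yes (_ , m) = contradiction (on-class {P = P₀} m) (clear₀ b)
        ... | no _ = refl

    one-vertical-colour : Solution G B P₀ P₁
    one-vertical-colour with fresh used used-short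
    ... | d , d∉ = Exchange.solution d∉

  -- The edge u₂v can be added to the class of c₁ so that a matching avoiding u₁ results.
  record Partner (u₁ : V) (c₁ : Fin 5) (u₂ : V) (P : Precoloring V 5) (v : V) : Set where
    field
      adjacent : Adj G u₂ v
      v≢u₁ : v ≢ u₁
      join : Coloured P u₂ v c₁ ⊎
             (¬ ∃ (Coloured P u₂ v) × ¬ (∃ λ x → Coloured P u₂ x c₁) × ¬ (∃ λ x → Coloured P v x c₁))

  has-colour? : ∀ P u v (c : Fin 5) → Dec (Coloured P u v c)
  has-colour? P u v c = map′ unpack (λ (e , m , s) → lose m (s , refl))
    (any? (λ q → sameEdge? _≟_ (proj₁ q) (u , v) ×-dec (proj₂ q ≟ᶠ c)) P)
    where
    unpack : Any (λ q → SameEdge (proj₁ q) (u , v) × proj₂ q ≡ c) P → Coloured P u v c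
    unpack a with find a
    ... | (e , _) , m , s , refl = e , m , s

  partner? : ∀ u₁ c₁ u₂ P v → Dec (Partner u₁ c₁ u₂ P v)
  partner? u₁ c₁ u₂ P v = map′ (λ (a , n , j) → record { adjacent = a ; v≢u₁ = n ; join = j })
    (λ p → Partner.adjacent p , Partner.v≢u₁ p , Partner.join p)
    (adj? G u₂ v ×-dec (¬? (v ≟ u₁) ×-dec (has-colour? P u₂ v c₁ ⊎-dec (¬? (coloured? _≟_ u₂ v) ×-dec
      (¬? (search λ x → has-colour? P u₂ x c₁) ×-dec ¬? (search λ x → has-colour? P v x c₁))))))

  module _ {u₁ c₁ u₂ c₂ P} (given : Consistent G ((u₁ , c₁) ∷ (u₂ , c₂) ∷ []) P []) (u₁≢u₂ : u₁ ≢ u₂)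
           (c₁≢c₂ : c₁ ≢ c₂) (two : length P ≤ 2) where
    open Consistent given

    -- The base is `c₁`, which suits `u₁`. The edges precoloured `c₁` are absorbed by `M`, so at
    -- most two entries and one pendant at `u₂` remain; `mirror` asks for no pendant at the other
    -- vertices of `M`.
    with-partner : ∀ {v} → Partner u₁ c₁ u₂ P v → Solution G ((u₁ , c₁) ∷ (u₂ , c₂) ∷ []) P []
    with-partner {v} partner = mirror F deg {D = (u₂ , c₂) ∷ []} (Layer.layer-few F G deg record
        { M-edges = M-edges ; M-matching = M-matching
        ; D-colours = λ { (here refl) → ≢-sym c₁≢c₂ }
        ; D-functional = λ { (here refl) (here refl) → refl }
        ; D-degree = λ { (here refl) → inj₂ (v , here sameEdge-refl) }
        ; P-proper = others-proper proper₀
        ; P-colours = λ m → proj₂ (others-⊆ P (_ , m , sameEdge-refl))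
        ; P-off-M = λ d m → off (others-⊆ P d) m
        ; P-D = λ { d (here refl) refl → clear₀ (there (here refl)) (proj₁ (others-⊆ P d)) } }
        (ℕ.+-monoˡ-≤ 1 (ℕ.≤-trans (others-length c₁ P) two)))
      functional (λ m → there (class-on {P = P} (_ , m , sameEdge-refl)))
      (λ { (here refl) → inj₂ (refl , avoids) ; (there (here e)) → inj₁ (here e) })
      where
      open Partner partner
      M = (u₂ , v) ∷ class c₁ P
      Edge : V → V → Set
      Edge x y = SameEdge (u₂ , v) (x , y) ⊎ Coloured P x y c₁
      edge : ∀ {x y} → On M x y → Edge x y
      edge (here s) = inj₁ s
      edge (there m) = inj₂ (on-class {P = P} m)
      M-edges : ∀ {x y} → On M x y → Adj G x y
      M-edges m = [ (λ s → adj-sameEdge G s adjacent) , coloured-adj proper₀ ]′ (edge m)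
      along : ∀ {e x y} → SameEdge e (x , y) → Coloured P (proj₁ e) (proj₂ e) c₁ → Coloured P x y c₁
      along s (e , m , s′) = e , m , sameEdge-trans s′ s
      mixed : ∀ {x y z} → SameEdge (u₂ , v) (x , y) → Coloured P x z c₁ → y ≡ z
      mixed {y = y} {z} s p with join
      ... | inj₁ q = decidable-stable (y ≟ z) λ y≢z → coloured-proper proper₀ (along s q) p y≢z refl
      mixed (inj₁ (refl , _)) p | inj₂ (_ , n , _) = contradiction (_ , p) n
      mixed (inj₂ (_ , refl)) p | inj₂ (_ , _ , n) = contradiction (_ , p) n
      M-matching : ∀ {x y z} → On M x y → On M x z → y ≡ z
      M-matching {y = y} {z} m m′ with edge m | edge m′
      ... | inj₁ s | inj₁ s′ = sameEdge-cancel (sameEdge-trans (sameEdge-sym s) s′)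
      ... | inj₁ s | inj₂ p = mixed s p
      ... | inj₂ p | inj₁ s = ≡-sym (mixed s p)
      ... | inj₂ p | inj₂ q = decidable-stable (y ≟ z) λ y≢z → coloured-proper proper₀ p q y≢z refl
      off : ∀ {x y i} → Coloured P x y i × i ≢ c₁ → ¬ On M x y
      off (d , i≢c₁) m with edge m | join
      ... | inj₂ p | _ = i≢c₁ (coloured-functional proper₀ d p)
      ... | inj₁ s | inj₁ q = i≢c₁ (coloured-functional proper₀ d (along s q))
      ... | inj₁ (inj₁ (refl , refl)) | inj₂ (n , _) = n (_ , d)
      ... | inj₁ (inj₂ (refl , refl)) | inj₂ (n , _) = n (_ , coloured-flip d)
      avoids : ∀ {x} → ¬ On M u₁ x
      avoids m with edge m
      ... | inj₁ (inj₁ (e , _)) = u₁≢u₂ (≡-sym e)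
      ... | inj₁ (inj₂ (_ , e)) = v≢u₁ e
      ... | inj₂ p = clear₀ (here refl) p

  record Blocker (u₂ : V) (c₁ : Fin 5) (P : Precoloring V 5) (v : V) : Set where
    constructor blocker
    field
      {a b} : V
      {i} : Fin 5
      coloured : Coloured P a b i
      why : (a ≡ u₂ × b ≡ v) ⊎ (a ≡ v × i ≡ c₁)

  module _ {u₁ c₁ u₂ c₂ P} (given : Consistent G ((u₁ , c₁) ∷ (u₂ , c₂) ∷ []) P []) (u₁≢u₂ : u₁ ≢ u₂)
           (none : ¬ ∃ (Partner u₁ c₁ u₂ P)) where
    open Consistent given

    clear-of-c₁ : ∀ {x} → ¬ Coloured P u₂ x c₁
    clear-of-c₁ {x} p = none (x , record { adjacent = coloured-adj proper₀ p
      ; v≢u₁ = λ { refl → clear₀ (here refl) (coloured-flip p) } ; join = inj₁ p })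

    block : ∀ {v} → Adj G u₂ v → v ≢ u₁ → Blocker u₂ c₁ P v
    block {v} uv v≢u₁ with coloured? {P = P} _≟_ u₂ v | search (λ x → has-colour? P v x c₁)
    ... | yes (_ , p) | _ = blocker p (inj₁ (refl , refl))
    ... | no _ | yes (_ , p) = blocker p (inj₂ (refl , refl))
    ... | no n | no n′ = contradiction
      (v , record { adjacent = uv ; v≢u₁ = v≢u₁ ; join = inj₂ (n , (λ (_ , p) → clear-of-c₁ p) , n′) }) none

    -- An edge that blocked for both prescribed vertices would join them, or have both colours, or
    -- meet a vertical edge of its own colour.
    blockers-apart : ∀ {c₂ v w} → (b : Blocker u₂ c₁ P v) (b′ : Blocker u₁ c₂ P w) → v ≢ u₁ → c₁ ≢ c₂ →
                     (∀ {x} → ¬ Coloured P u₂ x c₂) → ¬ SameEdge (Blocker.a b , Blocker.b b) (Blocker.a b′ , Blocker.b b′)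
    blockers-apart (blocker p why) (blocker p′ why′) v≢u₁ c₁≢c₂ clear s
      with coloured-along _≟_ proper₀ s p p′ | why | why′ | s
    ... | refl | inj₁ (refl , refl) | inj₁ (refl , refl) | inj₁ (e , _) = u₁≢u₂ (≡-sym e)
    ... | refl | inj₁ (refl , refl) | inj₁ (refl , refl) | inj₂ (_ , e) = v≢u₁ e
    ... | refl | inj₁ (refl , refl) | inj₂ (refl , refl) | _ = clear p
    ... | refl | inj₂ (refl , refl) | inj₁ (refl , refl) | _ = clear₀ (here refl) p′
    ... | refl | inj₂ (_ , e) | inj₂ (_ , e′) | _ = c₁≢c₂ (trans (≡-sym e) e′)

    -- A precoloured edge at `u₂` blocks only its other end. A common blocker of `v` and `v′`
    -- therefore blocks both through its colour, and joins them.
    same-blocker : ∀ {v v′} (b : Blocker u₂ c₁ P v) (b′ : Blocker u₂ c₁ P v′) → v ≢ v′ →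
                   SameEdge (Blocker.a b , Blocker.b b) (Blocker.a b′ , Blocker.b b′) →
                   Coloured P v v′ c₁ × Blocker.i b ≡ c₁ × SameEdge (v , v′) (Blocker.a b , Blocker.b b)
    same-blocker (blocker p why) (blocker p′ why′) v≢v′ s
      with coloured-along _≟_ proper₀ s p p′ | why | why′ | s
    ... | refl | inj₁ (refl , refl) | inj₁ (refl , refl) | s = contradiction (sameEdge-cancel s) v≢v′
    ... | refl | inj₁ (refl , refl) | inj₂ (_ , refl) | _ = contradiction p clear-of-c₁
    ... | refl | inj₂ (_ , refl) | inj₁ (refl , refl) | _ = contradiction p′ clear-of-c₁
    ... | refl | inj₂ (refl , refl) | inj₂ (refl , _) | inj₁ (e , _) = contradiction e v≢v′
    ... | refl | inj₂ (refl , refl) | inj₂ (refl , _) | inj₂ (_ , refl) = p , refl , sameEdge-refl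

  module _ {u₁ c₁ u₂ c₂ P} (given : Consistent G ((u₁ , c₁) ∷ (u₂ , c₂) ∷ []) P []) (u₁≢u₂ : u₁ ≢ u₂)
           (c₁≢c₂ : c₁ ≢ c₂) (two : length P ≤ 2)
           (none₂ : ¬ ∃ (Partner u₁ c₁ u₂ P)) (none₁ : ¬ ∃ (Partner u₂ c₂ u₁ P)) where
    open Consistent given
    private
      swapped : Consistent G ((u₂ , c₂) ∷ (u₁ , c₁) ∷ []) P []
      swapped = consistent-mono swap-two given

    -- Four edges v, v′ at u₂ and w, w′ at u₁ are blocked by only two precoloured edges, which
    -- must therefore be vv′ and ww′.
    doubly-blocked : Solution G ((u₁ , c₁) ∷ (u₂ , c₂) ∷ []) P []
    doubly-blocked
      with rich (there (here refl)) (u₁ ∷ []) (s≤s z≤n) | rich (here refl) (u₂ ∷ []) (s≤s z≤n)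
    ... | v , uv , v∉ | w , uw , w∉
      with rich (there (here refl)) (u₁ ∷ v ∷ []) (s≤s (s≤s z≤n)) | rich (here refl) (u₂ ∷ w ∷ []) (s≤s (s≤s z≤n))
    ... | v′ , uv′ , v′∉ | w′ , uw′ , w′∉ = finish
      where
      b = block given u₁≢u₂ none₂ uv (v∉ ∘ here)
      b′ = block given u₁≢u₂ none₂ uv′ (v′∉ ∘ here)
      d = block swapped (≢-sym u₁≢u₂) none₁ uw (w∉ ∘ here)
      d′ = block swapped (≢-sym u₁≢u₂) none₁ uw′ (w′∉ ∘ here)
      apart : ∀ {x y} → (β : Blocker u₂ c₁ P x) (δ : Blocker u₁ c₂ P y) → x ≢ u₁ →
              ¬ SameEdge (Blocker.a β , Blocker.b β) (Blocker.a δ , Blocker.b δ)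
      apart β δ x≢u₁ = blockers-apart given u₁≢u₂ none₂ β δ x≢u₁ c₁≢c₂ (clear₀ (there (here refl)))
      known : ∀ {x y k} → Coloured P x y k →
              (SameEdge (Blocker.a b , Blocker.b b) (x , y) × k ≡ Blocker.i b) ⊎
              (SameEdge (Blocker.a d , Blocker.b d) (x , y) × k ≡ Blocker.i d)
      known = two-known _≟_ proper₀ two (apart b d (v∉ ∘ here)) (Blocker.coloured b) (Blocker.coloured d)
      b~b′ : SameEdge (Blocker.a b , Blocker.b b) (Blocker.a b′ , Blocker.b b′)
      b~b′ with known (Blocker.coloured b′)
      ... | inj₁ (s , _) = s
      ... | inj₂ (s , _) = contradiction (sameEdge-sym s) (apart b′ d (v′∉ ∘ here))
      d~d′ : SameEdge (Blocker.a d , Blocker.b d) (Blocker.a d′ , Blocker.b d′)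
      d~d′ with known (Blocker.coloured d′)
      ... | inj₂ (s , _) = s
      ... | inj₁ (s , _) = contradiction s (apart b d′ (v∉ ∘ here))
      edge-b = same-blocker given u₁≢u₂ none₂ b b′ (λ e → v′∉ (there (here (≡-sym e)))) b~b′
      edge-d = same-blocker swapped (≢-sym u₁≢u₂) none₁ d d′ (λ e → w′∉ (there (here (≡-sym e)))) d~d′
      listed : ∀ {x y k} → Coloured P x y k → (SameEdge (v , v′) (x , y) × k ≡ c₁) ⊎ (SameEdge (w , w′) (x , y) × k ≡ c₂)
      listed p with known p
      ... | inj₁ (s , e) = inj₁ (sameEdge-trans (proj₂ (proj₂ edge-b)) s , trans e (proj₁ (proj₂ edge-b)))
      ... | inj₂ (s , e) = inj₂ (sameEdge-trans (proj₂ (proj₂ edge-d)) s , trans e (proj₁ (proj₂ edge-d)))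
      end : ∀ {x a a′ y : V} → SameEdge (a , a′) (x , y) → x ≡ a ⊎ x ≡ a′
      end (inj₁ (e , _)) = inj₁ (≡-sym e)
      end (inj₂ (_ , e)) = inj₂ (≡-sym e)
      off₁ : ∀ {y i} → ¬ Coloured P u₁ y i
      off₁ p with listed p
      ... | inj₁ (_ , refl) = clear₀ (here refl) p
      ... | inj₂ (s , _) = [ adj⇒≢ G uw , adj⇒≢ G uw′ ]′ (end s)
      off₂ : ∀ {y i} → ¬ Coloured P u₂ y i
      off₂ p with listed p
      ... | inj₂ (_ , refl) = clear₀ (there (here refl)) p
      ... | inj₁ (s , _) = [ adj⇒≢ G uv , adj⇒≢ G uv′ ]′ (end s)
      -- Were `u₁` not a neighbour of `u₂`, a third neighbour of `u₂` would need a blocker too, but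
      -- `vv′` reaches only `v` and `v′`.
      adjacent : Adj G u₁ u₂
      adjacent = decidable-stable (adj? G u₁ u₂) λ ¬uu →
        let v″ , uv″ , v″∉ = rich (there (here refl)) (v ∷ v′ ∷ []) (s≤s (s≤s z≤n))
            v″≢u₁ = λ e → ¬uu (adj-sym G (subst (Adj G u₂) e uv″))
            β = block given u₁≢u₂ none₂ uv″ v″≢u₁
        in third β v″∉ (listed (Blocker.coloured β))
           (λ s → apart β d v″≢u₁ (sameEdge-trans (sameEdge-sym s) (proj₂ (proj₂ edge-d))))
        where
        third : ∀ {x} (β : Blocker u₂ c₁ P x) → x ∉ v ∷ v′ ∷ [] →
                (SameEdge (v , v′) (Blocker.a β , Blocker.b β) × Blocker.i β ≡ c₁) ⊎
                (SameEdge (w , w′) (Blocker.a β , Blocker.b β) × Blocker.i β ≡ c₂) →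
                ¬ SameEdge (w , w′) (Blocker.a β , Blocker.b β) → ⊥
        third _ _ (inj₂ (s , _)) n = n s
        third (blocker p (inj₁ (refl , refl))) _ (inj₁ _) _ = off₂ p
        third (blocker p (inj₂ (refl , _))) x∉ (inj₁ (s , _)) _ = [ (λ e → x∉ (here e)) , (λ e → x∉ (there (here e))) ]′ (end s)
      finish : Solution G ((u₁ , c₁) ∷ (u₂ , c₂) ∷ []) P []
      -- Both precoloured edges miss `u₁` and `u₂`, so the single edge `u₁u₂` can be `M`, and no
      -- leaf involves a pendant.
      finish with fresh (c₁ ∷ c₂ ∷ []) (s≤s (s≤s z≤n))
      ... | base , base∉ = mirror F deg (Layer.layer-unobstructed F G deg
          (pendants (matched-one adjacent (clash base∉ (here refl)) (clash base∉ (there (here refl)))) (others-proper proper₀)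
            (λ p → proj₂ (others-⊆ P p) refl) ((λ (_ , p) → off₁ (proj₁ (others-⊆ P p))) ∷ [])
            ((λ p → off₁ (proj₁ (others-⊆ P p))) ∷ (λ p → off₂ (proj₁ (others-⊆ P p))) ∷ []))
          (unobstructed-two _≟_ (others-proper proper₀) (ℕ.≤-trans (others-length base P) two) u₁ base
            (λ p → proj₂ (others-⊆ P p) refl)
            (inj₁ (λ p → off₁ (proj₁ (others-⊆ P p))) ∷ inj₁ (λ p → off₂ (proj₁ (others-⊆ P p))) ∷ [])))
        functional (λ m → ⊥-elim (unused (listed (_ , m , sameEdge-refl)))) inj₁
        where
        unused : ∀ {x y} → (SameEdge (v , v′) (x , y) × base ≡ c₁) ⊎ (SameEdge (w , w′) (x , y) × base ≡ c₂) → ⊥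
        unused (inj₁ (_ , e)) = base∉ (here e)
        unused (inj₂ (_ , e)) = base∉ (there (here e))

  two-verticals-one-layer : ∀ {u₁ c₁ u₂ c₂ P} → Consistent G ((u₁ , c₁) ∷ (u₂ , c₂) ∷ []) P [] → u₁ ≢ u₂ → c₁ ≢ c₂ →
                            length P ≤ 2 → Solution G ((u₁ , c₁) ∷ (u₂ , c₂) ∷ []) P []
  two-verticals-one-layer {u₁} {c₁} {u₂} {c₂} {P} given u₁≢u₂ c₁≢c₂ two
    with search (partner? u₁ c₁ u₂ P) | search (partner? u₂ c₂ u₁ P)
  ... | yes (_ , p) | _ = with-partner given u₁≢u₂ c₁≢c₂ two p
  ... | no _ | yes (_ , p) = solution-mono swap-two (with-partner (consistent-mono swap-two given) (≢-sym u₁≢u₂) (≢-sym c₁≢c₂) two p)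
  ... | no none₂ | no none₁ = doubly-blocked given u₁≢u₂ c₁≢c₂ two none₂ none₁

  -- Matchings that cover the prescribed vertices

  record Cover (us : List V) (P : Precoloring V 5) : Set where
    field
      M : List (V × V)
      edges : All (λ e → Adj G (proj₁ e) (proj₂ e)) M
      apart : AllPairs (λ e e′ → ¬ Meet e e′) M
      allowed : All (λ e → ¬ ∃ (Coloured P (proj₁ e) (proj₂ e))) M
      covered : ∀ {u} → u ∈ us → ∃ (On M u)

  cover-mono : ∀ {us us′ P} → (∀ {u} → u ∈ us′ → u ∈ us) → Cover us P → Cover us′ P
  cover-mono sub c = record { M = M ; edges = edges ; apart = apart ; allowed = allowed ; covered = λ u∈ → covered (sub u∈) }
    where open Cover c

  start : ∀ {a b : V} → SameEdge (a , b) (a , b)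
  start = sameEdge-refl

  stop : ∀ {a b : V} → SameEdge (a , b) (b , a)
  stop = sameEdge-flip sameEdge-refl

  -- An available edge among the three vertices serves two of them at once. Otherwise neighbours are
  -- chosen greedily; `u₃` comes last because it has no precoloured edge to avoid, so that only `v₁`
  -- and `v₂` are excluded for it.
  cover-three-ordered : ∀ {P u₁ u₂ u₃ w₁ w₂} → Rich G u₁ → Rich G u₂ → Rich G u₃ → u₁ ≢ u₂ → u₁ ≢ u₃ → u₂ ≢ u₃ →
    (∀ {v i} → Coloured P u₁ v i → v ≡ w₁) → (∀ {v i} → Coloured P u₂ v i → v ≡ w₂) → Untouched P u₃ →
    Cover (u₁ ∷ u₂ ∷ u₃ ∷ []) P
  cover-three-ordered {P} {u₁} {u₂} {u₃} {w₁} {w₂} rich₁ rich₂ rich₃ n₁₂ n₁₃ n₂₃ only₁ only₂ none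
    with adj? G u₁ u₂ ×-dec ¬? (coloured? {P = P} _≟_ u₁ u₂)
  ... | yes (a , free) with rich₃ (u₁ ∷ u₂ ∷ []) (s≤s (s≤s z≤n))
  ... | z , uz , z∉ = record
      { M = (u₁ , u₂) ∷ (u₃ , z) ∷ [] ; edges = a ∷ uz ∷ []
      ; apart = (nonmeeting n₁₃ (λ e → z∉ (here (≡-sym e))) n₂₃ (λ e → z∉ (there (here (≡-sym e)))) ∷ []) ∷ [] ∷ []
      ; allowed = free ∷ (λ (_ , c) → none c) ∷ []
      ; covered = λ { (here refl) → _ , here start ; (there (here refl)) → _ , here stop
                    ; (there (there (here refl))) → _ , there (here start) } }
  cover-three-ordered {P} {u₁} {u₂} {u₃} {w₁} {w₂} rich₁ rich₂ rich₃ n₁₂ n₁₃ n₂₃ only₁ only₂ none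
      | no blocked with adj? G u₁ u₃
  ... | yes a with rich₂ (u₃ ∷ w₂ ∷ []) (s≤s (s≤s z≤n))
  ... | z , uz , z∉ = record
      { M = (u₁ , u₃) ∷ (u₂ , z) ∷ [] ; edges = a ∷ uz ∷ []
      ; apart = (nonmeeting n₁₂ u₁≢z (≢-sym n₂₃) (λ e → z∉ (here (≡-sym e))) ∷ []) ∷ [] ∷ []
      ; allowed = (λ (_ , c) → none (coloured-flip c)) ∷ (λ (_ , c) → z∉ (there (here (only₂ c)))) ∷ []
      ; covered = λ { (here refl) → _ , here start ; (there (here refl)) → _ , there (here start)
                    ; (there (there (here refl))) → _ , here stop } }
      where
      u₁≢z : u₁ ≢ z
      u₁≢z refl = blocked (adj-sym G uz , λ (_ , c) → z∉ (there (here (only₂ (coloured-flip c)))))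
  cover-three-ordered {P} {u₁} {u₂} {u₃} {w₁} {w₂} rich₁ rich₂ rich₃ n₁₂ n₁₃ n₂₃ only₁ only₂ none
      | no blocked | no ¬a₁₃ with adj? G u₂ u₃
  ... | yes a with rich₁ (u₃ ∷ w₁ ∷ []) (s≤s (s≤s z≤n))
  ... | z , uz , z∉ = record
      { M = (u₂ , u₃) ∷ (u₁ , z) ∷ [] ; edges = a ∷ uz ∷ []
      ; apart = (nonmeeting (≢-sym n₁₂) u₂≢z (≢-sym n₁₃) (λ e → z∉ (here (≡-sym e))) ∷ []) ∷ [] ∷ []
      ; allowed = (λ (_ , c) → none (coloured-flip c)) ∷ (λ (_ , c) → z∉ (there (here (only₁ c)))) ∷ []
      ; covered = λ { (here refl) → _ , there (here start) ; (there (here refl)) → _ , here start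
                    ; (there (there (here refl))) → _ , here stop } }
      where
      u₂≢z : u₂ ≢ z
      u₂≢z refl = blocked (uz , λ (_ , c) → z∉ (there (here (only₁ c))))
  cover-three-ordered {P} {u₁} {u₂} {u₃} {w₁} {w₂} rich₁ rich₂ rich₃ n₁₂ n₁₃ n₂₃ only₁ only₂ none
      | no blocked | no ¬a₁₃ | no ¬a₂₃ with rich₁ (w₁ ∷ []) (s≤s z≤n)
  ... | v₁ , uv₁ , v₁∉ with rich₂ (w₂ ∷ v₁ ∷ []) (s≤s (s≤s z≤n))
  ... | v₂ , uv₂ , v₂∉ with rich₃ (v₁ ∷ v₂ ∷ []) (s≤s (s≤s z≤n))
  ... | v₃ , uv₃ , v₃∉ = record
      { M = (u₁ , v₁) ∷ (u₂ , v₂) ∷ (u₃ , v₃) ∷ [] ; edges = uv₁ ∷ uv₂ ∷ uv₃ ∷ []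
      ; apart = (nonmeeting n₁₂ u₁≢v₂ (≢-sym u₂≢v₁) (λ e → v₂∉ (there (here (≡-sym e)))) ∷
                 nonmeeting n₁₃ (λ { refl → ¬a₁₃ (adj-sym G uv₃) }) (λ { refl → ¬a₁₃ uv₁ }) (λ e → v₃∉ (here (≡-sym e))) ∷ []) ∷
                (nonmeeting n₂₃ (λ { refl → ¬a₂₃ (adj-sym G uv₃) }) (λ { refl → ¬a₂₃ uv₂ }) (λ e → v₃∉ (there (here (≡-sym e)))) ∷ []) ∷
                [] ∷ []
      ; allowed = (λ (_ , c) → v₁∉ (here (only₁ c))) ∷ (λ (_ , c) → v₂∉ (here (only₂ c))) ∷ (λ (_ , c) → none c) ∷ []
      ; covered = λ { (here refl) → _ , here start ; (there (here refl)) → _ , there (here start)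
                    ; (there (there (here refl))) → _ , there (there (here start)) } }
      where
      u₁≢v₂ : u₁ ≢ v₂
      u₁≢v₂ refl = blocked (adj-sym G uv₂ , λ (_ , c) → v₂∉ (here (only₂ (coloured-flip c))))
      u₂≢v₁ : u₂ ≢ v₁
      u₂≢v₁ refl = blocked (uv₁ , λ (_ , c) → v₁∉ (here (only₁ c)))

  rotate₃ : ∀ {a b c x : V} → x ∈ a ∷ b ∷ c ∷ [] → x ∈ b ∷ c ∷ a ∷ []
  rotate₃ (here e) = there (there (here e))
  rotate₃ (there (here e)) = here e
  rotate₃ (there (there (here e))) = there (here e)

  -- A single precoloured edge misses one of the three vertices, which takes the place of `u₃`
  -- above.
  cover-three : ∀ {P u₁ u₂ u₃} → length P ≤ 1 → Rich G u₁ → Rich G u₂ → Rich G u₃ → u₁ ≢ u₂ → u₁ ≢ u₃ → u₂ ≢ u₃ →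
                Cover (u₁ ∷ u₂ ∷ u₃ ∷ []) P
  cover-three {P} {u₁} {u₂} {u₃} one r₁ r₂ r₃ n₁₂ n₁₃ n₂₃ with touched? u₁ | touched? u₂ | touched? u₃
    where
    touched? : ∀ u → Dec (∃ λ v → ∃ (Coloured P u v))
    touched? u = search λ v → coloured? _≟_ u v
  ... | _ | _ | no n = cover-three-ordered r₁ r₂ r₃ n₁₂ n₁₃ n₂₃ (proj₂ (sole F one u₁)) (proj₂ (sole F one u₂))
                         (λ c → n (_ , _ , c))
  ... | _ | no n | _ = cover-mono (rotate₃ ∘ rotate₃) (cover-three-ordered r₃ r₁ r₂ (≢-sym n₁₃) (≢-sym n₂₃) n₁₂
                         (proj₂ (sole F one u₃)) (proj₂ (sole F one u₁)) (λ c → n (_ , _ , c)))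
  ... | no n | _ | _ = cover-mono rotate₃ (cover-three-ordered r₂ r₃ r₁ n₂₃ (≢-sym n₁₂) (≢-sym n₁₃)
                         (proj₂ (sole F one u₂)) (proj₂ (sole F one u₃)) (λ c → n (_ , _ , c)))
  ... | yes (v₁ , _ , c₁) | yes (v₂ , _ , c₂) | yes (v₃ , _ , c₃) = ⊥-elim (n₂₃ (trans (≡-sym (end n₁₂ c₂)) (end n₁₃ c₃)))
    where
    end : ∀ {u v i} → u₁ ≢ u → Coloured P u v i → v₁ ≡ u
    end {u} {v} n c = decidable-stable (v₁ ≟ u) λ v₁≢u → ℕ.<⇒≱ (s≤s one) (distinct-entries (entry c₁ ∷ entry c ∷ [])
      (((λ { (inj₁ (e , _)) → n e ; (inj₂ (_ , e)) → v₁≢u e }) ∷ []) ∷ [] ∷ []))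

  -- Beside `u₁u₂`, the other two vertices need distinct neighbours outside it. Richness permits two
  -- exclusions at each, and the third exclusion at one of them is saved if `u₃u₁` or `u₄u₂` is no
  -- edge; if both are edges, they form the matching.
  cover-four-adjacent : ∀ {u₁ u₂ u₃ u₄} → Rich G u₁ → Rich G u₂ → Rich G u₃ → Rich G u₄ → u₁ ≢ u₂ → u₁ ≢ u₃ → u₁ ≢ u₄ →
    u₂ ≢ u₃ → u₂ ≢ u₄ → u₃ ≢ u₄ → Adj G u₁ u₂ → Cover (u₁ ∷ u₂ ∷ u₃ ∷ u₄ ∷ []) []
  cover-four-adjacent {u₁} {u₂} {u₃} {u₄} r₁ r₂ r₃ r₄ n₁₂ n₁₃ n₁₄ n₂₃ n₂₄ n₃₄ a₁₂ with adj? G u₃ u₄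
  ... | yes a₃₄ = record
      { M = (u₁ , u₂) ∷ (u₃ , u₄) ∷ [] ; edges = a₁₂ ∷ a₃₄ ∷ [] ; apart = (nonmeeting n₁₃ n₁₄ n₂₃ n₂₄ ∷ []) ∷ [] ∷ []
      ; allowed = (λ ()) ∷ (λ ()) ∷ []
      ; covered = λ { (here refl) → _ , here start ; (there (here refl)) → _ , here stop
                    ; (there (there (here refl))) → _ , there (here start)
                    ; (there (there (there (here refl)))) → _ , there (here stop) } }
  ... | no ¬a₃₄ = case adj? G u₃ u₁ of λ where
      (no ¬a₃₁) →
        let w , uw , w∉ = r₄ (u₁ ∷ u₂ ∷ []) (s≤s (s≤s z≤n))
            z , uz , z∉ = r₃ (u₂ ∷ w ∷ []) (s≤s (s≤s z≤n))
        in three uz uw (λ e → ¬a₃₁ (subst (Adj G u₃) e uz)) (z∉ ∘ here) (w∉ ∘ here) (w∉ ∘ there ∘ here) (z∉ ∘ there ∘ here)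
      (yes a₃₁) → case adj? G u₄ u₂ of λ where
        (no ¬a₄₂) →
          let z , uz , z∉ = r₃ (u₁ ∷ u₂ ∷ []) (s≤s (s≤s z≤n))
              w , uw , w∉ = r₄ (u₁ ∷ z ∷ []) (s≤s (s≤s z≤n))
          in three uz uw (z∉ ∘ here) (z∉ ∘ there ∘ here) (w∉ ∘ here) (λ e → ¬a₄₂ (subst (Adj G u₄) e uw))
               (λ e → w∉ (there (here (≡-sym e))))
        (yes a₄₂) → record
          { M = (u₃ , u₁) ∷ (u₄ , u₂) ∷ [] ; edges = a₃₁ ∷ a₄₂ ∷ []
          ; apart = (nonmeeting n₃₄ (≢-sym n₂₃) n₁₄ n₁₂ ∷ []) ∷ [] ∷ [] ; allowed = (λ ()) ∷ (λ ()) ∷ []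
          ; covered = λ { (here refl) → _ , here stop ; (there (here refl)) → _ , there (here stop)
                        ; (there (there (here refl))) → _ , here start
                        ; (there (there (there (here refl)))) → _ , there (here start) } }
    where
    three : ∀ {z w} → Adj G u₃ z → Adj G u₄ w → z ≢ u₁ → z ≢ u₂ → w ≢ u₁ → w ≢ u₂ → z ≢ w → Cover (u₁ ∷ u₂ ∷ u₃ ∷ u₄ ∷ []) []
    three {z} {w} uz uw z≢₁ z≢₂ w≢₁ w≢₂ z≢w = record
      { M = (u₁ , u₂) ∷ (u₃ , z) ∷ (u₄ , w) ∷ [] ; edges = a₁₂ ∷ uz ∷ uw ∷ []
      ; apart = (nonmeeting n₁₃ (≢-sym z≢₁) n₂₃ (≢-sym z≢₂) ∷ nonmeeting n₁₄ (≢-sym w≢₁) n₂₄ (≢-sym w≢₂) ∷ []) ∷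
                (nonmeeting n₃₄ (λ { refl → ¬a₃₄ (adj-sym G uw) }) (λ { refl → ¬a₃₄ uz }) z≢w ∷ []) ∷ [] ∷ []
      ; allowed = (λ ()) ∷ (λ ()) ∷ (λ ()) ∷ []
      ; covered = λ { (here refl) → _ , here start ; (there (here refl)) → _ , here stop
                    ; (there (there (here refl))) → _ , there (here start)
                    ; (there (there (there (here refl)))) → _ , there (there (here start)) } }

  module _ {u₁ u₂ u₃ u₄} (r₁ : Rich G u₁) (r₂ : Rich G u₂) (r₃ : Rich G u₃) (r₄ : Rich G u₄)
           (n₁₂ : u₁ ≢ u₂) (n₁₃ : u₁ ≢ u₃) (n₁₄ : u₁ ≢ u₄) (n₂₃ : u₂ ≢ u₃) (n₂₄ : u₂ ≢ u₄) (n₃₄ : u₃ ≢ u₄)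
           (a₁₂ : ¬ Adj G u₁ u₂) (a₁₃ : ¬ Adj G u₁ u₃) (a₁₄ : ¬ Adj G u₁ u₄)
           (a₂₃ : ¬ Adj G u₂ u₃) (a₂₄ : ¬ Adj G u₂ u₄) (a₃₄ : ¬ Adj G u₃ u₄) where
    private
      representatives : ∀ {v₁ v₂ v₃ v₄} → Adj G u₁ v₁ → Adj G u₂ v₂ → Adj G u₃ v₃ → Adj G u₄ v₄ →
        v₁ ≢ v₂ → v₁ ≢ v₃ → v₁ ≢ v₄ → v₂ ≢ v₃ → v₂ ≢ v₄ → v₃ ≢ v₄ → Cover (u₁ ∷ u₂ ∷ u₃ ∷ u₄ ∷ []) []
      representatives e₁ e₂ e₃ e₄ m₁₂ m₁₃ m₁₄ m₂₃ m₂₄ m₃₄ = record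
        { M = (u₁ , _) ∷ (u₂ , _) ∷ (u₃ , _) ∷ (u₄ , _) ∷ [] ; edges = e₁ ∷ e₂ ∷ e₃ ∷ e₄ ∷ []
        ; apart = (separate n₁₂ a₁₂ e₁ e₂ m₁₂ ∷ separate n₁₃ a₁₃ e₁ e₃ m₁₃ ∷ separate n₁₄ a₁₄ e₁ e₄ m₁₄ ∷ []) ∷
                  (separate n₂₃ a₂₃ e₂ e₃ m₂₃ ∷ separate n₂₄ a₂₄ e₂ e₄ m₂₄ ∷ []) ∷ (separate n₃₄ a₃₄ e₃ e₄ m₃₄ ∷ []) ∷ [] ∷ []
        ; allowed = (λ ()) ∷ (λ ()) ∷ (λ ()) ∷ (λ ()) ∷ []
        ; covered = λ { (here refl) → _ , here start ; (there (here refl)) → _ , there (here start)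
                      ; (there (there (here refl))) → _ , there (there (here start))
                      ; (there (there (there (here refl)))) → _ , there (there (there (here start))) } }
        where
        separate : ∀ {u u′ v v′} → u ≢ u′ → ¬ Adj G u u′ → Adj G u v → Adj G u′ v′ → v ≢ v′ → ¬ Meet (u , v) (u′ , v′)
        separate n a e e′ m = nonmeeting n (λ { refl → a (adj-sym G e′) }) (λ { refl → a e }) m

      new? : ∀ u (vs : List V) → Dec (∃ λ v → Adj G u v × v ∉ vs)
      new? u vs = search λ v → adj? G u v ×-dec ¬? (v ∈? vs)

    -- Hall's condition: if N(u₄) = {v₁, v₂, v₃}, then some u_i with i ≤ 3 has a neighbour outside
    -- and can give up v_i, for otherwise v₁ would have four neighbours.
    cover-four-independent : Cover (u₁ ∷ u₂ ∷ u₃ ∷ u₄ ∷ []) []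
    cover-four-independent
      with r₁ [] z≤n
    ... | v₁ , e₁ , _ with r₂ (v₁ ∷ []) (s≤s z≤n)
    ... | v₂ , e₂ , v₂∉ with r₃ (v₁ ∷ v₂ ∷ []) (s≤s (s≤s z≤n))
    ... | v₃ , e₃ , v₃∉ = go (new? u₄ vs) (new? u₁ vs) (new? u₂ vs) (new? u₃ vs)
      where
      vs = v₁ ∷ v₂ ∷ v₃ ∷ []
      m₂₁ : v₂ ≢ v₁
      m₂₁ = v₂∉ ∘ here
      m₃₁ : v₃ ≢ v₁
      m₃₁ = v₃∉ ∘ here
      m₃₂ : v₃ ≢ v₂
      m₃₂ = v₃∉ ∘ there ∘ here
      hit : ∀ {u x y z} → Rich G u → (∀ {v} → Adj G u v → v ∈ x ∷ y ∷ z ∷ []) → Adj G u x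
      hit {u} {x} {y} {z} r inside with r (y ∷ z ∷ []) (s≤s (s≤s z≤n))
      ... | v , uv , v∉ with inside uv
      ... | here refl = uv
      ... | there v∈ = contradiction v∈ v∉
      closed : ∀ {u} → ¬ (∃ λ v → Adj G u v × v ∉ vs) → ∀ {v} → Adj G u v → v ∈ vs
      closed n {v} uv = decidable-stable (v ∈? vs) λ v∉ → n (v , uv , v∉)
      go : Dec (∃ λ v → Adj G u₄ v × v ∉ vs) → Dec (∃ λ v → Adj G u₁ v × v ∉ vs) → Dec (∃ λ v → Adj G u₂ v × v ∉ vs) →
           Dec (∃ λ v → Adj G u₃ v × v ∉ vs) → Cover (u₁ ∷ u₂ ∷ u₃ ∷ u₄ ∷ []) []
      go (yes (v , e , v∉)) _ _ _ = representatives e₁ e₂ e₃ e (≢-sym m₂₁) (≢-sym m₃₁) (λ x → v∉ (here (≡-sym x)))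
        (≢-sym m₃₂) (λ x → v∉ (there (here (≡-sym x)))) (λ x → v∉ (there (there (here (≡-sym x)))))
      go (no n) (yes (v , e , v∉)) _ _ = representatives e e₂ e₃ (hit r₄ (closed n)) (v∉ ∘ there ∘ here)
        (v∉ ∘ there ∘ there ∘ here) (v∉ ∘ here) (≢-sym m₃₂) m₂₁ m₃₁
      go (no n) _ (yes (v , e , v∉)) _ = representatives e₁ e e₃ (hit r₄ (rotate₃ ∘ closed n)) (λ x → v∉ (here (≡-sym x)))
        (≢-sym m₃₁) (≢-sym m₂₁) (v∉ ∘ there ∘ there ∘ here) (v∉ ∘ there ∘ here) m₃₂
      go (no n) _ _ (yes (v , e , v∉)) = representatives e₁ e₂ e (hit r₄ (rotate₃ ∘ rotate₃ ∘ closed n)) (≢-sym m₂₁)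
        (λ x → v∉ (here (≡-sym x))) (≢-sym m₃₁) (λ x → v∉ (there (here (≡-sym x)))) (≢-sym m₃₂) (v∉ ∘ there ∘ there ∘ here)
      go (no n₄) (no n₁) (no n₂) (no n₃) = ⊥-elim (neighbours≤3 G (deg v₁) (adj-sym G e₁) (adj-sym G (hit r₂ (closed n₂)))
        (adj-sym G (hit r₃ (closed n₃))) (adj-sym G (hit r₄ (closed n₄))) n₁₂ n₁₃ n₁₄ n₂₃ n₂₄ n₃₄)

  cover-four : ∀ {u₁ u₂ u₃ u₄} → Rich G u₁ → Rich G u₂ → Rich G u₃ → Rich G u₄ → u₁ ≢ u₂ → u₁ ≢ u₃ → u₁ ≢ u₄ →
    u₂ ≢ u₃ → u₂ ≢ u₄ → u₃ ≢ u₄ → Cover (u₁ ∷ u₂ ∷ u₃ ∷ u₄ ∷ []) []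
  cover-four {u₁} {u₂} {u₃} {u₄} r₁ r₂ r₃ r₄ n₁₂ n₁₃ n₁₄ n₂₃ n₂₄ n₃₄
    with adj? G u₁ u₂ | adj? G u₁ u₃ | adj? G u₁ u₄ | adj? G u₂ u₃ | adj? G u₂ u₄ | adj? G u₃ u₄
  ... | yes a | _ | _ | _ | _ | _ = cover-four-adjacent r₁ r₂ r₃ r₄ n₁₂ n₁₃ n₁₄ n₂₃ n₂₄ n₃₄ a
  ... | _ | yes a | _ | _ | _ | _ = cover-mono (λ
          { (here e) → here e ; (there (here e)) → there (there (here e)) ; (there (there (here e))) → there (here e)
          ; (there (there (there e))) → there (there (there e)) })
          (cover-four-adjacent r₁ r₃ r₂ r₄ n₁₃ n₁₂ n₁₄ (≢-sym n₂₃) n₃₄ n₂₄ a)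
  ... | _ | _ | yes a | _ | _ | _ = cover-mono (λ
          { (here e) → here e ; (there (here e)) → there (there (here e)) ; (there (there (here e))) → there (there (there (here e)))
          ; (there (there (there (here e)))) → there (here e) })
          (cover-four-adjacent r₁ r₄ r₂ r₃ n₁₄ n₁₂ n₁₃ (≢-sym n₂₄) (≢-sym n₃₄) n₂₃ a)
  ... | _ | _ | _ | yes a | _ | _ = cover-mono (λ
          { (here e) → there (there (here e)) ; (there (here e)) → here e ; (there (there (here e))) → there (here e)
          ; (there (there (there e))) → there (there (there e)) })
          (cover-four-adjacent r₂ r₃ r₁ r₄ n₂₃ (≢-sym n₁₂) n₂₄ (≢-sym n₁₃) n₃₄ n₁₄ a)
  ... | _ | _ | _ | _ | yes a | _ = cover-mono (λ
          { (here e) → there (there (here e)) ; (there (here e)) → here e ; (there (there (here e))) → there (there (there (here e)))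
          ; (there (there (there (here e)))) → there (here e) })
          (cover-four-adjacent r₂ r₄ r₁ r₃ n₂₄ (≢-sym n₁₂) n₂₃ (≢-sym n₁₄) (≢-sym n₃₄) n₁₃ a)
  ... | _ | _ | _ | _ | _ | yes a = cover-mono (λ
          { (here e) → there (there (here e)) ; (there (here e)) → there (there (there (here e))) ; (there (there (here e))) → here e
          ; (there (there (there (here e)))) → there (here e) })
          (cover-four-adjacent r₃ r₄ r₁ r₂ n₃₄ (≢-sym n₁₃) (≢-sym n₂₃) (≢-sym n₁₄) (≢-sym n₂₄) n₁₂ a)
  ... | no a₁₂ | no a₁₃ | no a₁₄ | no a₂₃ | no a₂₄ | no a₃₄ =
          cover-four-independent r₁ r₂ r₃ r₄ n₁₂ n₁₃ n₁₄ n₂₃ n₂₄ n₃₄ a₁₂ a₁₃ a₁₄ a₂₃ a₂₄ a₃₄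

  -- Three and four vertical edges

  Keys : List (V × Fin 5) → Set
  Keys = AllPairs (λ b b′ → proj₁ b ≢ proj₁ b′)

  -- `B` itself serves as `D`: the prescribed vertices lie on the matching, and `mirror` asks for no
  -- further pendants.
  covered-verticals : ∀ {B P} → Consistent G B P [] → Keys B → length P ≤ 1 → Cover (map proj₁ B) P →
    AllPairs (λ d d′ → proj₂ d ≢ proj₂ d′ ⊎ ¬ ∃ (Coloured P (proj₁ d) (proj₁ d′))) B →
    (∃ λ base → base ∉ colours-of P × base ∉ map proj₂ B) → Solution G B P []
  covered-verticals {B} {P} given keys one cover clean (base , base∉P , base∉B) = mirror F deg
    (Layer.layer-unobstructed F G deg
      (pendants record
          { edges = edges ; apart = apart ; colours = All.tabulate (λ { d∈ refl → base∉B (∈-map⁺ proj₂ d∈) }) ; keys = keys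
          ; covered = All.tabulate λ d∈ → covered (∈-map⁺ proj₁ d∈) }
        (others-proper proper₀) (λ p → proj₂ (others-⊆ P p) refl)
        (All.map (λ n (_ , p) → n (_ , proj₁ (others-⊆ P p))) allowed)
        (All.tabulate λ d∈ p → clear₀ d∈ (proj₁ (others-⊆ P p))))
      (unobstructed-one _≟_ (others-proper proper₀) (ℕ.≤-trans (others-length base P) one)
        (AllPairs.map (map₂ λ n (_ , p) → n (_ , proj₁ (others-⊆ P p))) clean)))
    functional (λ m → contradiction (∈-map⁺ proj₂ m) base∉P) inj₁
    where
    open Consistent given
    open Cover cover

  four-verticals : ∀ {u₁ c₁ u₂ c₂ u₃ c₃ u₄ c₄} → let B = (u₁ , c₁) ∷ (u₂ , c₂) ∷ (u₃ , c₃) ∷ (u₄ , c₄) ∷ [] in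
    Consistent G B [] [] → Keys B → Solution G B [] []
  four-verticals {u₁} {c₁} {u₂} {c₂} {u₃} {c₃} {u₄} {c₄} given
    keys@((n₁₂ ∷ n₁₃ ∷ n₁₄ ∷ []) ∷ (n₂₃ ∷ n₂₄ ∷ []) ∷ (n₃₄ ∷ []) ∷ [] ∷ []) =
    covered-verticals given keys z≤n
      (cover-four (rich (here refl)) (rich (there (here refl))) (rich (there (there (here refl))))
        (rich (there (there (there (here refl))))) n₁₂ n₁₃ n₁₄ n₂₃ n₂₄ n₃₄)
      ((inj₂ none ∷ inj₂ none ∷ inj₂ none ∷ []) ∷ (inj₂ none ∷ inj₂ none ∷ []) ∷ (inj₂ none ∷ []) ∷ [] ∷ [])
      (let base , base∉ = fresh (c₁ ∷ c₂ ∷ c₃ ∷ c₄ ∷ []) (s≤s (s≤s (s≤s (s≤s z≤n)))) in base , (λ ()) , base∉)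
    where
    open Consistent given
    none : ∀ {u v} → ¬ ∃ (Coloured [] u v)
    none ()

  module _ {u₁ u₂ c u₃ c₃ P} (given : Consistent G ((u₁ , c) ∷ (u₂ , c) ∷ (u₃ , c₃) ∷ []) P [])
           (n₁₃ : u₁ ≢ u₃) (n₂₃ : u₂ ≢ u₃) (c₃≢c : c₃ ≢ c) (one : length P ≤ 1) {p} (e : Coloured P u₁ u₂ p) where
    open Consistent given
    private
      known : ∀ {x y i} → Coloured P x y i → SameEdge (u₁ , u₂) (x , y) × i ≡ p
      known {x} {y} d with decidable-stable (sameEdge? _≟_ (u₁ , u₂) (x , y))
        (λ n → ℕ.<⇒≱ (s≤s one) (distinct-entries (entry e ∷ entry d ∷ []) ((n ∷ []) ∷ [] ∷ [])))
      ... | s = s , ≡-sym (coloured-along _≟_ proper₀ s e d)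

      no-c : ∀ {x y} → ¬ Coloured P x y c
      no-c d = clear₀ (here refl) (subst (Coloured P u₁ u₂) (≡-sym (proj₂ (known d))) e)

    -- The exception to `unobstructed-one`: equal pendant colours at both ends of the precoloured
    -- edge. That edge is the only entry and its colour is not `c`, so `c` can be the base, which
    -- frees both twins; only `u₃` needs an edge of `M`, chosen away from them.
    joined-twins : Solution G ((u₁ , c) ∷ (u₂ , c) ∷ (u₃ , c₃) ∷ []) P []
    joined-twins with rich (there (there (here refl))) (u₁ ∷ u₂ ∷ []) (s≤s (s≤s z≤n))
    ... | v , uv , v∉ = mirror F deg (Layer.layer-few F G deg
        (pendants {D = (u₃ , c₃) ∷ []} (record
          { edges = uv ∷ [] ; apart = [] ∷ [] ; colours = c₃≢c ∷ [] ; keys = [] ∷ [] ; covered = (_ , here start) ∷ [] })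
          (others-proper proper₀) (λ d → proj₂ (others-⊆ P d) refl)
          ((λ (_ , d) → off (proj₁ (known (proj₁ (others-⊆ P d))))) ∷ [])
          ((λ d → clear₀ (there (there (here refl))) (proj₁ (others-⊆ P d))) ∷ []))
        (ℕ.≤-trans (ℕ.+-monoˡ-≤ 1 (ℕ.≤-trans (others-length c P) one)) (s≤s (s≤s z≤n))))
      functional (λ m → contradiction (_ , m , sameEdge-refl) no-c)
      (λ { (here refl) → inj₂ (refl , λ { (here (inj₁ (e , _))) → n₁₃ (≡-sym e) ; (here (inj₂ (_ , e))) → v∉ (here e) })
         ; (there (here refl)) → inj₂ (refl , λ { (here (inj₁ (e , _))) → n₂₃ (≡-sym e) ; (here (inj₂ (_ , e))) → v∉ (there (here e)) })
         ; (there (there (here refl))) → inj₁ (here refl) })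
      where
      off : ¬ SameEdge (u₁ , u₂) (u₃ , v)
      off (inj₁ (e , _)) = n₁₃ e
      off (inj₂ (_ , e)) = n₂₃ e

  three-verticals : ∀ {u₁ c₁ u₂ c₂ u₃ c₃ P} → let B = (u₁ , c₁) ∷ (u₂ , c₂) ∷ (u₃ , c₃) ∷ [] in
    Consistent G B P [] → Keys B → length P ≤ 1 → ¬ (c₂ ≡ c₁ × c₃ ≡ c₁) → Solution G B P []
  three-verticals {u₁} {c₁} {u₂} {c₂} {u₃} {c₃} {P} given keys@((n₁₂ ∷ n₁₃ ∷ []) ∷ (n₂₃ ∷ []) ∷ [] ∷ []) one differ
    with c₁ ≟ᶠ c₂ ×-dec coloured? {P = P} _≟_ u₁ u₂ | c₁ ≟ᶠ c₃ ×-dec coloured? {P = P} _≟_ u₁ u₃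
       | c₂ ≟ᶠ c₃ ×-dec coloured? {P = P} _≟_ u₂ u₃
  ... | yes (refl , _ , d) | _ | _ = joined-twins given n₁₃ n₂₃ (λ e → differ (refl , e)) one d
  ... | _ | yes (refl , _ , d) | _ = solution-mono sub (joined-twins (consistent-mono sub given) n₁₂ (≢-sym n₂₃) (λ e → differ (e , refl)) one d)
    where
    sub : ∀ {A : Set} {a b c x : A} → x ∈ a ∷ b ∷ c ∷ [] → x ∈ a ∷ c ∷ b ∷ []
    sub (here e) = here e
    sub (there (here e)) = there (there (here e))
    sub (there (there (here e))) = there (here e)
  ... | _ | _ | yes (refl , _ , d) = solution-mono sub (joined-twins (consistent-mono sub′ given) (≢-sym n₁₂) (≢-sym n₁₃) (λ e → differ (≡-sym e , ≡-sym e)) one d)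
    where
    sub : ∀ {A : Set} {a b c x : A} → x ∈ a ∷ b ∷ c ∷ [] → x ∈ b ∷ c ∷ a ∷ []
    sub (here e) = there (there (here e))
    sub (there (here e)) = here e
    sub (there (there (here e))) = there (here e)
    sub′ : ∀ {A : Set} {a b c x : A} → x ∈ b ∷ c ∷ a ∷ [] → x ∈ a ∷ b ∷ c ∷ []
    sub′ (here e) = there (here e)
    sub′ (there (here e)) = there (there (here e))
    sub′ (there (there (here e))) = here e
  ... | no a | no b | no c = covered-verticals given keys one
      (cover-three one (rich (here refl)) (rich (there (here refl))) (rich (there (there (here refl)))) n₁₂ n₁₃ n₂₃)
      ((clean a ∷ clean b ∷ []) ∷ (clean c ∷ []) ∷ [] ∷ []) base
    where
    open Consistent given
    clean : ∀ {i j u v} → ¬ (i ≡ j × ∃ (Coloured P u v)) → i ≢ j ⊎ ¬ ∃ (Coloured P u v)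
    clean {i} {j} n with i ≟ᶠ j
    ... | no i≢j = inj₁ i≢j
    ... | yes i≡j = inj₂ λ d → n (i≡j , d)
    base : ∃ λ base → base ∉ colours-of P × base ∉ c₁ ∷ c₂ ∷ c₃ ∷ []
    base with fresh (colours-of P ++ c₁ ∷ c₂ ∷ c₃ ∷ []) (subst (_≤ 4) (≡-sym (trans (length-++ (colours-of P))
                (cong (_+ 3) (length-map proj₂ P)))) (ℕ.+-monoˡ-≤ 3 one))
    ... | b , b∉ = b , b∉ ∘ ∈-++⁺ˡ , b∉ ∘ ∈-++⁺ʳ (colours-of P)

  -- Vertical edges of one colour, and the dispatch by number

  nonempty : ∀ {P : Precoloring V 5} {u v i} → Coloured P u v i → 1 ≤ length P
  nonempty {_ ∷ _} _ = s≤s z≤n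

  only-entry : ∀ {P : Precoloring V 5} → length P ≤ 1 → ∀ {u v i x y j} → Coloured P u v i → Coloured P x y j →
               SameEdge (u , v) (x , y) × j ≡ i
  only-entry {_ ∷ []} _ (_ , here refl , s) (_ , here refl , s′) = sameEdge-trans (sameEdge-sym s) s′ , refl
  only-entry {_ ∷ _ ∷ _} (s≤s ())

  two-colours : ∀ {P : Precoloring V 5} → length P ≤ 2 → ∀ {u v i} → Coloured P u v i →
                ∃ λ q → ∀ {x y j} → Coloured P x y j → j ≡ i ⊎ j ≡ q
  two-colours {(_ , i) ∷ []} _ (_ , here refl , _) = i , λ { (_ , here refl , _) → inj₁ refl }
  two-colours {_ ∷ (_ , q) ∷ []} _ (_ , here refl , _) =
    q , λ { (_ , here refl , _) → inj₁ refl ; (_ , there (here refl) , _) → inj₂ refl }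
  two-colours {(_ , q) ∷ _ ∷ []} _ (_ , there (here refl) , _) =
    q , λ { (_ , here refl , _) → inj₂ refl ; (_ , there (here refl) , _) → inj₁ refl }
  two-colours {_ ∷ _ ∷ _ ∷ _} (s≤s (s≤s ()))

  split-three : ∀ m n → 1 ≤ m → 1 ≤ n → m + n ≤ 3 → (m ≤ 2 × n ≤ 1) ⊎ (m ≤ 1 × n ≤ 2)
  split-three 1 n _ _ (s≤s n≤2) = inj₂ (s≤s z≤n , n≤2)
  split-three 2 n _ _ (s≤s (s≤s n≤1)) = inj₁ (s≤s (s≤s z≤n) , n≤1)
  split-three (suc (suc (suc m))) (suc n) _ _ (s≤s (s≤s (s≤s h))) with m + suc n | ℕ.+-suc m n
  split-three (suc (suc (suc m))) (suc n) _ _ (s≤s (s≤s (s≤s ()))) | _ | refl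

  split-two : ∀ m n → 1 ≤ m → 1 ≤ n → m + n ≤ 2 → m ≤ 1 × n ≤ 1
  split-two 1 n _ _ (s≤s n≤1) = s≤s z≤n , n≤1
  split-two (suc (suc m)) (suc n) _ _ (s≤s (s≤s h)) with m + suc n | ℕ.+-suc m n
  split-two (suc (suc m)) (suc n) _ _ (s≤s (s≤s ())) | _ | refl

  too-many : ∀ k {m n} → 1 ≤ m → 1 ≤ n → k + (m + n) ≤ 1 → ⊥
  too-many k p q h = ℕ.<⇒≱ (ℕ.≤-trans (ℕ.+-mono-≤ p q) (ℕ.m≤n+m _ k)) h

  end-of : ∀ {u v x y : V} → SameEdge (u , v) (x , y) → x ≡ u ⊎ x ≡ v
  end-of (inj₁ (e , _)) = inj₁ (≡-sym e)
  end-of (inj₂ (_ , e)) = inj₂ (≡-sym e)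

  module _ {u c B P₀ P₁} (given : Consistent G ((u , c) ∷ B) P₀ P₁) (keys : Keys ((u , c) ∷ B))
           (monochrome : ∀ {v d} → (v , d) ∈ (u , c) ∷ B → d ≡ c)
           (few : length B + (length P₀ + length P₁) ≤ 3) where
    open Consistent given
    away : ∀ {P x y v d} → (∀ {u′ v c′} → (u′ , c′) ∈ (u , c) ∷ B → ¬ Coloured P u′ v c′) → (v , d) ∈ (u , c) ∷ B →
           Coloured P x y c → v ≢ x × v ≢ y
    away {P} clear b p with monochrome b
    ... | refl = (λ { refl → clear b p }) , (λ { refl → clear b (coloured-flip p) })

    -- Both layers have an entry, so there are at most two vertical edges. With one,
    -- `shared-colour-edge` applies to the layer that may have two entries; with two, each layer has
    -- a single entry and only the colours `c` and `i` occur.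
    mixed-layers : ∀ {x y x′ y′ i} → Coloured P₀ x y c → Coloured P₁ x′ y′ i →
                   (∀ {v d} → (v , d) ∈ (u , c) ∷ B → v ≢ x′ × v ≢ y′) → Solution G ((u , c) ∷ B) P₀ P₁
    mixed-layers {x} {y} {x′} {y′} {i} p₀ p₁ off =
      go B given keys few monochrome (away clear₀ (here refl) p₀) (off (here refl))
      where
      go : ∀ B → Consistent G ((u , c) ∷ B) P₀ P₁ → Keys ((u , c) ∷ B) → length B + (length P₀ + length P₁) ≤ 3 →
           (∀ {v d} → (v , d) ∈ (u , c) ∷ B → d ≡ c) → u ≢ x × u ≢ y → u ≢ x′ × u ≢ y′ → Solution G ((u , c) ∷ B) P₀ P₁
      go [] given _ few _ (u≢x , u≢y) (u≢x′ , u≢y′) with split-three _ _ (nonempty p₀) (nonempty p₁) few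
      ... | inj₁ (two , one) with two-colours two p₀
      ...   | q , palette = shared-colour-edge given two one p₀ (≢-sym u≢x) (≢-sym u≢y)
                (λ d → [ u≢x′ , u≢y′ ]′ (end-of (proj₁ (only-entry one p₁ d)))) (inj₁ refl) q i
                (λ { (inj₁ d) → [ here , there ∘ here ]′ (palette d)
                   ; (inj₂ d) → there (there (here (proj₂ (only-entry one p₁ d)))) })
      go [] given _ few _ (u≢x , u≢y) (u≢x′ , u≢y′) | inj₂ (one , two) with two-colours two p₁
      ...   | q , palette = solution-swap (shared-colour-edge (consistent-swap given) two one p₁ (≢-sym u≢x′) (≢-sym u≢y′)
                (λ d → [ u≢x , u≢y ]′ (end-of (proj₁ (only-entry one p₀ d)))) (inj₂ λ d → proj₂ (only-entry one p₀ d)) i q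
                (λ { (inj₁ d) → [ there ∘ here , there ∘ there ∘ here ]′ (palette d)
                   ; (inj₂ d) → here (proj₂ (only-entry one p₀ d)) }))
      go ((u₂ , c₂) ∷ []) given ((u≢u₂ ∷ []) ∷ _) (s≤s few) mono _ (u≢x′ , u≢y′)
        with split-two _ _ (nonempty p₀) (nonempty p₁) few | mono (there (here refl))
      ... | one₀ , one₁ | refl = two-verticals-two-colours given u≢u₂ one₀ one₁
          (inj₁ λ d → at₀ (here refl) (only-entry one₀ p₀ d) d)
          (inj₁ λ d → at₀ (there (here refl)) (only-entry one₀ p₀ d) d)
          (λ { (inj₁ d) → at₀ (here refl) (only-entry one₀ p₀ d) d
             ; (inj₂ d) → [ u≢x′ , u≢y′ ]′ (end-of (proj₁ (only-entry one₁ p₁ d))) })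
          c i (here refl) (here refl)
          (λ { (inj₁ d) → here (proj₂ (only-entry one₀ p₀ d)) ; (inj₂ d) → there (here (proj₂ (only-entry one₁ p₁ d))) })
        where
        at₀ : ∀ {v w i} {S : Set} → (v , c) ∈ (u , c) ∷ (u₂ , c) ∷ [] → S × i ≡ c → ¬ Coloured P₀ v w i
        at₀ b (_ , refl) d = Consistent.clear₀ given b d
      go (_ ∷ _ ∷ B′) _ _ (s≤s (s≤s few)) _ _ _ =
        ⊥-elim (too-many (length B′) (nonempty p₀) (nonempty p₁) few)

    -- The exchange needs the edges coloured `c` in `P₀` to be uncoloured in `P₁`. If one of them is
    -- not, its ends still miss all prescribed vertices, and it is a witness for `mixed-layers`.
    one-sided : (∀ {x y} → ¬ Coloured P₁ x y c) → Solution G ((u , c) ∷ B) P₀ P₁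
    one-sided no-c with search (λ x → search λ y → has-colour? P₀ x y c ×-dec coloured? {P = P₁} _≟_ x y)
    ... | yes (_ , _ , p₀ , _ , p₁) = mixed-layers p₀ p₁ (λ b → away clear₀ b p₀)
    ... | no n = one-vertical-colour given monochrome (ℕ.≤-trans (ℕ.m≤n+m _ (length B)) few) no-c (λ p₀ p₁ → n (_ , _ , p₀ , p₁))

  monochrome-verticals : ∀ {u c B P₀ P₁} → Consistent G ((u , c) ∷ B) P₀ P₁ → Keys ((u , c) ∷ B) →
    (∀ {v d} → (v , d) ∈ (u , c) ∷ B → d ≡ c) → length B + (length P₀ + length P₁) ≤ 3 → Solution G ((u , c) ∷ B) P₀ P₁
  monochrome-verticals {c = c} {B} {P₀} {P₁} given keys mono few
    with has? P₀ | has? P₁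
    where
    has? : ∀ P → Dec (∃ λ x → ∃ λ y → Coloured P x y c)
    has? P = search λ x → search λ y → has-colour? P x y c
  ... | yes (_ , _ , p₀) | yes (_ , _ , p₁) = mixed-layers given keys mono few p₀ p₁ (λ b → away given keys mono few (Consistent.clear₁ given) b p₁)
  ... | _ | no n = one-sided given keys mono few (λ p → n (_ , _ , p))
  ... | no n | _ = solution-swap (one-sided (consistent-swap given) keys mono
                     (subst (λ k → length B + k ≤ 3) (ℕ.+-comm (length P₀) (length P₁)) few) (λ p → n (_ , _ , p)))

  solve-distinct : ∀ B {P₀ P₁} → Consistent G B P₀ P₁ → Keys B → length B + (length P₀ + length P₁) ≤ 4 → Solution G B P₀ P₁
  solve-distinct [] given _ few = no-verticals given few
  solve-distinct (_ ∷ []) given keys (s≤s few) = monochrome-verticals given keys (λ { (here refl) → refl }) few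
  solve-distinct ((u₁ , c₁) ∷ (u₂ , c₂) ∷ []) {P₀} {P₁} given keys@((n ∷ []) ∷ _) (s≤s few) with c₁ ≟ᶠ c₂
  ... | yes refl = monochrome-verticals given keys (λ { (here refl) → refl ; (there (here refl)) → refl }) few
  ... | no c₁≢c₂ = go P₀ P₁ given few
    where
    go : ∀ P₀ P₁ → Consistent G ((u₁ , c₁) ∷ (u₂ , c₂) ∷ []) P₀ P₁ → 1 + (length P₀ + length P₁) ≤ 3 →
         Solution G ((u₁ , c₁) ∷ (u₂ , c₂) ∷ []) P₀ P₁
    go P₀ [] given (s≤s few) = two-verticals-one-layer given n c₁≢c₂ (subst (_≤ 2) (ℕ.+-identityʳ _) few)
    go [] P₁@(_ ∷ _) given (s≤s few) = solution-swap (two-verticals-one-layer (consistent-swap given) n c₁≢c₂ few)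
    go (_ ∷ []) (_ ∷ []) given _ = two-different-verticals given n c₁≢c₂
    go (_ ∷ []) (_ ∷ _ ∷ _) given (s≤s (s≤s (s≤s ())))
    go (_ ∷ _ ∷ P) (_ ∷ P′) given (s≤s (s≤s (s≤s few))) with subst (_≤ 0) (ℕ.+-suc (length P) (length P′)) few
    ... | ()
  solve-distinct ((u₁ , c₁) ∷ (u₂ , c₂) ∷ (u₃ , c₃) ∷ []) {P₀} {P₁} given keys (s≤s few) with c₂ ≟ᶠ c₁ ×-dec c₃ ≟ᶠ c₁
  ... | yes (refl , refl) = monochrome-verticals given keys
          (λ { (here refl) → refl ; (there (here refl)) → refl ; (there (there (here refl))) → refl }) few
  ... | no differ = go P₀ P₁ given few
    where
    go : ∀ P₀ P₁ → Consistent G ((u₁ , c₁) ∷ (u₂ , c₂) ∷ (u₃ , c₃) ∷ []) P₀ P₁ → 2 + (length P₀ + length P₁) ≤ 3 →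
         Solution G ((u₁ , c₁) ∷ (u₂ , c₂) ∷ (u₃ , c₃) ∷ []) P₀ P₁
    go P₀ [] given (s≤s (s≤s few)) = three-verticals given keys (subst (_≤ 1) (ℕ.+-identityʳ _) few) differ
    go [] P₁@(_ ∷ _) given (s≤s (s≤s few)) = solution-swap (three-verticals (consistent-swap given) keys few differ)
    go (_ ∷ P) (_ ∷ P′) given (s≤s (s≤s (s≤s few))) with subst (_≤ 0) (ℕ.+-suc (length P) (length P′)) few
    ... | ()
  solve-distinct (_ ∷ _ ∷ _ ∷ _ ∷ []) {[]} {[]} given keys _ = four-verticals given keys
  solve-distinct (_ ∷ _ ∷ _ ∷ _ ∷ []) {[]} {_ ∷ _} _ _ (s≤s (s≤s (s≤s (s≤s ()))))
  solve-distinct (_ ∷ _ ∷ _ ∷ _ ∷ []) {_ ∷ _} _ _ (s≤s (s≤s (s≤s (s≤s ()))))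
  solve-distinct (_ ∷ _ ∷ _ ∷ _ ∷ _ ∷ _) _ _ (s≤s (s≤s (s≤s (s≤s ()))))

  -- A vertical edge may be listed repeatedly, also once from each end, whereas pendants need one
  -- entry per vertex.
  distinct-keys : ∀ B → ∃ λ B′ → Keys B′ × (∀ {b} → b ∈ B′ → b ∈ B) × (∀ {u c} → (u , c) ∈ B → ∃ λ c′ → (u , c′) ∈ B′) ×
                  length B′ ≤ length B
  distinct-keys [] = [] , [] , id , (λ ()) , z≤n
  distinct-keys ((u , c) ∷ B) with distinct-keys B
  ... | B′ , keys , sub , sup , short with any? (λ b → proj₁ b ≟ u) B′
  ... | no new = (u , c) ∷ B′ , All.tabulate (λ b∈ e → new (lose b∈ (≡-sym e))) ∷ keys
          , (λ { (here e) → here e ; (there b∈) → there (sub b∈) })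
          , (λ { (here refl) → c , here refl ; (there b∈) → let c′ , m = sup b∈ in c′ , there m }) , s≤s short
  ... | yes old with find old
  ... | (_ , c′) , m , refl = B′ , keys , there ∘ sub , (λ { (here refl) → c′ , m ; (there b∈) → sup b∈ }) , ℕ.m≤n⇒m≤1+n short

  solve : ∀ {B P₀ P₁} → Consistent G B P₀ P₁ → length B + (length P₀ + length P₁) ≤ 4 → Solution G B P₀ P₁
  solve {B} given few with distinct-keys B
  ... | B′ , keys , sub , sup , short = solution-mono grow
          (solve-distinct B′ (consistent-mono sub given) keys (ℕ.≤-trans (ℕ.+-monoˡ-≤ _ short) few))
    where
    grow : ∀ {b} → b ∈ B → b ∈ B′
    grow b∈ with sup b∈
    ... | c′ , m with Consistent.functional given b∈ (sub m)
    ... | refl = m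

-- The prism over a subcubic graph

×-finite : ∀ {V W : Set} → Finite V → Finite W → Finite (V × W)
×-finite FV FW = record
  { _≟_ = Product.≡-dec V._≟_ W._≟_ ; elements = cartesianProduct V.elements W.elements
  ; complete = λ (v , w) → ∈-cartesianProduct⁺ (V.complete v) (W.complete w) }
  where
  module V = Finite FV
  module W = Finite FW

-- Leaves are attached until every vertex of the given graph has degree three, so that
-- vertices of smaller degree need no separate treatment.
module Pad {n : ℕ} (G : Graph (Fin n)) (subcubic : Subcubic G) where
  W : Set
  W = Fin n ⊎ (Fin n × Fin 3)

  W-finite : Finite W
  W-finite = ⊎-finite (fin-finite n) (×-finite (fin-finite n) (fin-finite 3))

  -- As many of the three indices qualify as `u` lacks neighbours, so the leaves raise its degree to
  -- exactly three.
  Extra : Fin n → Fin 3 → Set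
  Extra u j = toℕ j + degree G u < 3

  data Link : W → W → Set where
    old : ∀ {u v} → Adj G u v → Link (inj₁ u) (inj₁ v)
    out : ∀ {u j} → Extra u j → Link (inj₁ u) (inj₂ (u , j))
    back : ∀ {u j} → Extra u j → Link (inj₂ (u , j)) (inj₁ u)

  link? : ∀ x y → Dec (Link x y)
  link? (inj₁ u) (inj₁ v) = map′ old (λ { (old a) → a }) (adj? G u v)
  link? (inj₁ u) (inj₂ (v , j)) with u ≟ᶠ v
  ... | no u≢v = no λ { (out _) → u≢v refl }
  ... | yes refl = map′ out (λ { (out h) → h }) (_ ℕ.<? _)
  link? (inj₂ (v , j)) (inj₁ u) with v ≟ᶠ u
  ... | no v≢u = no λ { (back _) → v≢u refl }
  ... | yes refl = map′ back (λ { (back h) → h }) (_ ℕ.<? _)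
  link? (inj₂ _) (inj₂ _) = no λ ()

  link-sym : ∀ {x y} → Link x y → Link y x
  link-sym (old a) = old (adj-sym G a)
  link-sym (out h) = back h
  link-sym (back h) = out h

  link-irrefl : ∀ {x} → ¬ Link x x
  link-irrefl (old a) = adj⇒≢ G a refl

  padded : Graph W
  padded = relationGraph Link link? link-sym link-irrefl

  link : ∀ x y → Adj padded x y → Link x y
  link x y = does⇒ (link? x y)

  padded-adj : ∀ {x y} → Link x y → Adj padded x y
  padded-adj {x} {y} = dec-true (link? x y)

  extras : ℕ → List (Fin 3)
  extras d = filter (λ j → toℕ j + d ℕ.<? 3) (allFin 3)

  extras-length : ∀ d → d ≤ 3 → d + length (extras d) ≡ 3
  extras-length 0 _ = refl
  extras-length 1 _ = refl
  extras-length 2 _ = refl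
  extras-length 3 _ = refl
  extras-length (suc (suc (suc (suc d)))) (s≤s (s≤s (s≤s ())))

  attach : Fin n → Fin 3 → W
  attach u j = inj₂ (u , j)

  near : Fin n → List W
  near u = map inj₁ (filterᵇ (adj G u) (allFin n)) ++ map (attach u) (extras (degree G u))

  near-length : ∀ u → length (near u) ≡ 3
  near-length u = trans (length-++ (map inj₁ (filterᵇ (adj G u) (allFin n))))
    (trans (cong₂ _+_ (length-map inj₁ (filterᵇ (adj G u) (allFin n))) (length-map (attach u) (extras (degree G u))))
           (extras-length (degree G u) (subcubic u)))

  near-unique : ∀ u → Unique (near u)
  near-unique u = Unique.++⁺ (Unique.map⁺ inj₁-injective (Unique.filter⁺ (λ v → T? (adj G u v)) (Unique.allFin⁺ n)))
    (Unique.map⁺ (λ e → Product.,-injectiveʳ (inj₂-injective e)) (Unique.filter⁺ (λ j → toℕ j + degree G u ℕ.<? 3) (Unique.allFin⁺ 3)))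
    (λ (m , m′) → apart (∈-map⁻ inj₁ m) (∈-map⁻ (attach u) m′))
    where
    apart : ∀ {x} → (∃ λ v → v ∈ filterᵇ (adj G u) (allFin n) × x ≡ inj₁ v) →
            (∃ λ j → j ∈ extras (degree G u) × x ≡ attach u j) → ⊥
    apart (_ , _ , refl) (_ , _ , ())

  near-adj : ∀ {u x} → x ∈ near u → Adj padded (inj₁ u) x
  near-adj {u} m with ∈-++⁻ (map inj₁ (filterᵇ (adj G u) (allFin n))) m
  ... | inj₁ m′ with ∈-map⁻ inj₁ m′
  ...   | v , v∈ , refl = padded-adj (old (Equivalence.to T-≡ (proj₂ (∈-filter⁻ (λ v → T? (adj G u v)) {xs = allFin n} v∈))))
  near-adj {u} m | inj₂ m′ with ∈-map⁻ (attach u) m′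
  ...   | j , j∈ , refl = padded-adj (out (proj₂ (∈-filter⁻ (λ j → toℕ j + degree G u ℕ.<? 3) {xs = allFin 3} j∈)))

  adj-near : ∀ {u x} → Link (inj₁ u) x → x ∈ near u
  adj-near {u} (old a) = ∈-++⁺ˡ (∈-map⁺ inj₁ (∈-filter⁺ (λ v → T? (adj G u v)) (∈-allFin _) (Equivalence.from T-≡ a)))
  adj-near {u} (out {j = j} h) = ∈-++⁺ʳ (map inj₁ (filterᵇ (adj G u) (allFin n)))
    (∈-map⁺ (attach u) (∈-filter⁺ (λ j → toℕ j + degree G u ℕ.<? 3) (∈-allFin j) h))

  padded-degree : ∀ x → DegreeAtMost 3 padded x
  padded-degree (inj₁ u) vs uniq adjs = subst (length vs ≤_) (near-length u)
    (unique-⊆-length uniq λ {x} x∈ → adj-near (link (inj₁ u) x (All.lookup adjs x∈)))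
  padded-degree (inj₂ (u , j)) vs uniq adjs = ℕ.≤-trans
    (unique-⊆-length {ys = inj₁ u ∷ []} uniq λ {x} x∈ → leaf (link (inj₂ (u , j)) x (All.lookup adjs x∈))) (s≤s z≤n)
    where
    leaf : ∀ {x} → Link (inj₂ (u , j)) x → x ∈ inj₁ u ∷ []
    leaf (back _) = here refl

  padded-rich : ∀ u → Rich padded (inj₁ u)
  padded-rich u xs short with search (λ v → adj? padded (inj₁ u) v ×-dec ¬? (v ∈? xs))
    where open Finite W-finite
  ... | yes found = found
  ... | no none = ⊥-elim (ℕ.<⇒≱ (s≤s short) (subst (_≤ length xs) (near-length u) (unique-⊆-length (near-unique u)
    λ {x} x∈ → decidable-stable (Finite._∈?_ W-finite x xs) λ x∉ → none (x , near-adj x∈ , x∉))))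

module Prism {n : ℕ} (G : Graph (Fin n)) where
  data Link : Fin n × Fin 2 → Fin n × Fin 2 → Set where
    horizontal : ∀ {x y s} → Adj G x y → Link (x , s) (y , s)
    vertical : ∀ {x s t} → s ≢ t → Link (x , s) (x , t)

  private
    -- Once the layers are concrete, adjacency in `G □ K₂` computes to one of two Boolean
    -- expressions, across or within a layer; this lemma and the next two are stated on these normal
    -- forms.
    eq : ∀ {x y : Fin n} {b} → (does (x ≟ᶠ y) ∧ true) ∨ false ≡ b → does (x ≟ᶠ y) ≡ b
    eq {x} {y} h with does (x ≟ᶠ y)
    ... | true = h
    ... | false = h

    across : ∀ {x y : Fin n} {s t} → s ≢ t → (does (x ≟ᶠ y) ∧ true) ∨ false ≡ true → Link (x , s) (y , t)
    across {x} {y} s≢t h with does⇒ (x ≟ᶠ y) (eq {x} {y} h)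
    ... | refl = vertical s≢t

    along : ∀ {x y : Fin n} {s} → (does (x ≟ᶠ y) ∧ false) ∨ adj G x y ≡ true → Link (x , s) (y , s)
    along {x} {y} h = horizontal (subst (λ b → b ∨ adj G x y ≡ true) (∧-zeroʳ (does (x ≟ᶠ y))) h)

  link : ∀ p q → Adj (G □ K₂) p q → Link p q
  link (x , zero) (y , zero) = along
  link (x , zero) (y , suc zero) = across (λ ())
  link (x , suc zero) (y , zero) = across (λ ())
  link (x , suc zero) (y , suc zero) = along

  two-layers : ∀ {s t r : Fin 2} → s ≢ t → s ≢ r → t ≡ r
  two-layers {zero} {zero} n _ = contradiction refl n
  two-layers {zero} {suc zero} {zero} _ n = contradiction refl n
  two-layers {zero} {suc zero} {suc zero} _ _ = refl
  two-layers {suc zero} {zero} {zero} _ _ = refl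
  two-layers {suc zero} {zero} {suc zero} _ n = contradiction refl n
  two-layers {suc zero} {suc zero} n _ = contradiction refl n

-- Splitting a precolouring of the prism into layers and vertical edges

module Assemble (n : ℕ) (G : Graph (Fin n)) (subcubic : Subcubic G) where
  open Pad G subcubic
  open Prism G renaming (link to prism-link; Link to PrismLink)

  Item : Set
  Item = ((Fin n × Fin 2) × (Fin n × Fin 2)) × Fin 5

  layer : Fin 2 → List Item → Precoloring W 5
  layer s [] = []
  layer s ((((x , a) , (y , b)) , i) ∷ P) with a ≟ᶠ s | b ≟ᶠ s
  ... | yes _ | yes _ = ((inj₁ x , inj₁ y) , i) ∷ layer s P
  ... | yes _ | no _ = layer s P
  ... | no _ | _ = layer s P

  -- An entry between different layers is an edge only if its ends lie over the same vertex, so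
  -- keeping the first end loses nothing.
  verticals : List Item → List (W × Fin 5)
  verticals [] = []
  verticals ((((x , a) , (y , b)) , i) ∷ P) with a ≟ᶠ b
  ... | yes _ = verticals P
  ... | no _ = (inj₁ x , i) ∷ verticals P

  layer-∈ : ∀ s {x y i P} → (((x , s) , (y , s)) , i) ∈ P → ((inj₁ x , inj₁ y) , i) ∈ layer s P
  layer-∈ s (here refl) with s ≟ᶠ s
  ... | yes _ = here refl
  ... | no n = contradiction refl n
  layer-∈ s {P = (((_ , a) , (_ , b)) , _) ∷ _} (there m) with a ≟ᶠ s | b ≟ᶠ s
  ... | yes _ | yes _ = there (layer-∈ s m)
  ... | yes _ | no _ = layer-∈ s m
  ... | no _ | _ = layer-∈ s m

  data FromLayer (s : Fin 2) (P : List Item) : W × W → Fin 5 → Set where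
    from : ∀ {x y i} → (((x , s) , (y , s)) , i) ∈ P → FromLayer s P (inj₁ x , inj₁ y) i

  later : ∀ {s P e i q} → FromLayer s P e i → FromLayer s (q ∷ P) e i
  later (from m) = from (there m)

  layer-from : ∀ s P {e i} → (e , i) ∈ layer s P → FromLayer s P e i
  layer-from s ((((x , a) , (y , b)) , i) ∷ P) m with a ≟ᶠ s | b ≟ᶠ s
  layer-from s (_ ∷ P) (here refl) | yes refl | yes refl = from (here refl)
  layer-from s (_ ∷ P) (there m) | yes _ | yes _ = later (layer-from s P m)
  layer-from s (_ ∷ P) m | yes _ | no _ = later (layer-from s P m)
  layer-from s (_ ∷ P) m | no _ | _ = later (layer-from s P m)

  verticals-∈ : ∀ {x a y b i P} → a ≢ b → (((x , a) , (y , b)) , i) ∈ P → (inj₁ x , i) ∈ verticals P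
  verticals-∈ {a = a} {b = b} a≢b (here refl) with a ≟ᶠ b
  ... | yes e = contradiction e a≢b
  ... | no _ = here refl
  verticals-∈ {P = (((_ , c) , (_ , d)) , _) ∷ _} a≢b (there m) with c ≟ᶠ d
  ... | yes _ = verticals-∈ a≢b m
  ... | no _ = there (verticals-∈ a≢b m)

  data FromVertical (P : List Item) : W → Fin 5 → Set where
    from : ∀ {x a y b i} → a ≢ b → (((x , a) , (y , b)) , i) ∈ P → FromVertical P (inj₁ x) i

  verticals-from : ∀ P {v i} → (v , i) ∈ verticals P → FromVertical P v i
  verticals-from ((((x , a) , (y , b)) , i) ∷ P) m with a ≟ᶠ b
  ... | yes _ with verticals-from P m
  ...   | from n m′ = from n (there m′)
  verticals-from (_ ∷ P) (here refl) | no n = from n (here refl)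
  verticals-from (_ ∷ P) (there m) | no _ with verticals-from P m
  ...   | from n m′ = from n (there m′)

  parts-length : ∀ P → length (verticals P) + (length (layer zero P) + length (layer (suc zero) P)) ≤ length P
  parts-length [] = z≤n
  parts-length ((((_ , zero) , (_ , zero)) , _) ∷ P) =
    ℕ.≤-trans (ℕ.≤-reflexive (ℕ.+-suc (length (verticals P)) _)) (s≤s (parts-length P))
  parts-length ((((_ , zero) , (_ , suc zero)) , _) ∷ P) = s≤s (parts-length P)
  parts-length ((((_ , suc zero) , (_ , zero)) , _) ∷ P) = s≤s (parts-length P)
  parts-length ((((_ , suc zero) , (_ , suc zero)) , _) ∷ P) =
    ℕ.≤-trans (ℕ.≤-reflexive (trans (cong (length (verticals P) +_) (ℕ.+-suc (length (layer zero P)) _))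
      (ℕ.+-suc (length (verticals P)) _))) (s≤s (parts-length P))

  module _ (P : Precoloring (Fin n × Fin 2) 5) (few : length P ≤ 4) (precoloring : IsProperPrecoloring (G □ K₂) P) where
    private
      module P = IsProperPrecoloring precoloring

      lift : ∀ {s : Fin 2} {x y x′ y′} → SameEdge {W} (inj₁ x , inj₁ y) (inj₁ x′ , inj₁ y′) →
             SameEdge ((x , s) , (y , s)) ((x′ , s) , (y′ , s))
      lift (inj₁ (refl , refl)) = inj₁ (refl , refl)
      lift (inj₂ (refl , refl)) = inj₂ (refl , refl)

      layer-adj : ∀ {s x y i} → (((x , s) , (y , s)) , i) ∈ P → Adj G x y
      layer-adj {s} {x} {y} m with prism-link (x , s) (y , s) (P.areEdges m)
      ... | horizontal a = a
      ... | vertical s≢s = contradiction refl s≢s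

      straight : ∀ {x a y b i} → a ≢ b → (((x , a) , (y , b)) , i) ∈ P → x ≡ y
      straight {x} {a} {y} {b} a≢b m with prism-link (x , a) (y , b) (P.areEdges m)
      ... | horizontal _ = contradiction refl a≢b
      ... | vertical _ = refl

      layer-proper : ∀ s → IsProperPrecoloring padded (layer s P)
      layer-proper s = record
        { areEdges = λ m → edge (layer-from s P m)
        ; consistent = λ m m′ → agree (layer-from s P m) (layer-from s P m′)
        ; proper = λ _ _ _ m m′ → differ (layer-from s P m) (layer-from s P m′) }
        where
        edge : ∀ {u v i} → FromLayer s P (u , v) i → Adj padded u v
        edge (from m) = padded-adj (old (layer-adj m))
        agree : ∀ {e e′ i j} → FromLayer s P e i → FromLayer s P e′ j → SameEdge e e′ → i ≡ j
        agree (from m) (from m′) h = P.consistent m m′ (lift {s} h)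
        differ : ∀ {e e′ x y z i j} → FromLayer s P e i → FromLayer s P e′ j → SameEdge e (x , y) → SameEdge e′ (x , z) →
                 y ≢ z → i ≢ j
        differ (from m) (from m′) (inj₁ (refl , refl)) (inj₁ (refl , refl)) y≢z =
          P.proper _ _ _ m m′ (inj₁ (refl , refl)) (inj₁ (refl , refl)) (λ { refl → y≢z refl })
        differ (from m) (from m′) (inj₁ (refl , refl)) (inj₂ (refl , refl)) y≢z =
          P.proper _ _ _ m m′ (inj₁ (refl , refl)) (inj₂ (refl , refl)) (λ { refl → y≢z refl })
        differ (from m) (from m′) (inj₂ (refl , refl)) (inj₁ (refl , refl)) y≢z =
          P.proper _ _ _ m m′ (inj₂ (refl , refl)) (inj₁ (refl , refl)) (λ { refl → y≢z refl })
        differ (from m) (from m′) (inj₂ (refl , refl)) (inj₂ (refl , refl)) y≢z =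
          P.proper _ _ _ m m′ (inj₂ (refl , refl)) (inj₂ (refl , refl)) (λ { refl → y≢z refl })

      at-layer : ∀ {x a y b i} s → a ≢ b → (((x , a) , (y , b)) , i) ∈ P →
                 ∃ λ t → s ≢ t × SameEdge ((x , a) , (y , b)) ((x , s) , (x , t))
      at-layer {a = a} {b = b} s a≢b m with straight a≢b m | a ≟ᶠ s
      ... | refl | yes refl = b , a≢b , sameEdge-refl
      ... | refl | no a≢s with two-layers a≢b a≢s
      ... | refl = a , ≢-sym a≢s , sameEdge-flip sameEdge-refl

      -- A vertical edge over `u` meets layer `s` in the copy of `u` there, and at this vertex the
      -- prism precolouring is proper.
      clear : ∀ s {u v c} → (u , c) ∈ verticals P → ¬ Coloured (layer s P) u v c
      clear s b (_ , m , h) with verticals-from P b | layer-from s P m | h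
      ... | from a≢b m₁ | from m₂ | inj₁ (refl , refl) with at-layer s a≢b m₁
      ... | t , s≢t , h₁ = P.proper _ _ _ m₁ m₂ h₁ (inj₁ (refl , refl)) (λ { refl → s≢t refl }) refl
      clear s b (_ , m , h) | from a≢b m₁ | from m₂ | inj₂ (refl , refl) with at-layer s a≢b m₁
      ... | t , s≢t , h₁ = P.proper _ _ _ m₁ m₂ h₁ (inj₂ (refl , refl)) (λ { refl → s≢t refl }) refl

      functional : ∀ {u c c′} → (u , c) ∈ verticals P → (u , c′) ∈ verticals P → c ≡ c′
      functional b b′ with verticals-from P b | verticals-from P b′
      ... | from a≢b m | from a′≢b′ m′ with at-layer zero a≢b m | at-layer zero a′≢b′ m′
      ... | t , n , h | t′ , n′ , h′ with two-layers n n′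
      ... | refl = P.consistent m m′ (sameEdge-trans h (sameEdge-sym h′))

      rich : ∀ {u c} → (u , c) ∈ verticals P → Rich padded u
      rich b with verticals-from P b
      ... | from _ _ = padded-rich _

      solution : Solution padded (verticals P) (layer zero P) (layer (suc zero) P)
      solution = Cases.solve W-finite padded padded-degree record
        { functional = functional ; rich = rich ; proper₀ = layer-proper zero ; proper₁ = layer-proper (suc zero)
        ; clear₀ = clear zero ; clear₁ = clear (suc zero) } (ℕ.≤-trans (parts-length P) few)

      open Solution solution

      φ : Fin 2 → W → W → Fin 5
      φ zero = φ₀
      φ (suc zero) = φ₁

      φ-proper : ∀ s → IsProperEdgeColoring padded 5 (φ s)
      φ-proper zero = proper₀
      φ-proper (suc zero) = proper₁

      φ-extends : ∀ s → Extends (φ s) (layer s P)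
      φ-extends zero = extends₀
      φ-extends (suc zero) = extends₁

      φ-free : ∀ s {u v} → Adj padded u v → φ s u v ≢ τ u
      φ-free zero = free₀
      φ-free (suc zero) = free₁

    colouring : Fin n × Fin 2 → Fin n × Fin 2 → Fin 5
    colouring (x , s) (y , t) with s ≟ᶠ t
    ... | yes _ = φ s (inj₁ x) (inj₁ y)
    ... | no _ = τ (inj₁ x)

    colouring-level : ∀ {x y} s → colouring (x , s) (y , s) ≡ φ s (inj₁ x) (inj₁ y)
    colouring-level s with s ≟ᶠ s
    ... | yes _ = refl
    ... | no n = contradiction refl n

    colouring-across : ∀ {x y s t} → s ≢ t → colouring (x , s) (y , t) ≡ τ (inj₁ x)
    colouring-across {s = s} {t} s≢t with s ≟ᶠ t
    ... | yes e = contradiction e s≢t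
    ... | no _ = refl

    colouring-symmetric : ∀ {p q} → PrismLink p q → colouring p q ≡ colouring q p
    colouring-symmetric (horizontal {s = s} a) = trans (colouring-level s)
      (trans (IsProperEdgeColoring.symmetric (φ-proper s) _ _ (padded-adj (old a))) (≡-sym (colouring-level s)))
    colouring-symmetric (vertical {x} s≢t) = trans (colouring-across {x} {x} s≢t) (≡-sym (colouring-across {x} {x} (≢-sym s≢t)))

    colouring-proper : ∀ {p q r} → PrismLink p q → PrismLink p r → q ≢ r → colouring p q ≢ colouring p r
    colouring-proper (horizontal {s = s} a) (horizontal a′) q≢r e =
      IsProperEdgeColoring.proper (φ-proper s) _ _ _ (padded-adj (old a)) (padded-adj (old a′)) (λ { refl → q≢r refl })
        (trans (≡-sym (colouring-level s)) (trans e (colouring-level s)))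
    colouring-proper (horizontal {x} {s = s} a) (vertical s≢t) _ e =
      φ-free s (padded-adj (old a)) (trans (≡-sym (colouring-level s)) (trans e (colouring-across {x} {x} s≢t)))
    colouring-proper (vertical {x} s≢t) (horizontal {s = s} a) _ e =
      φ-free s (padded-adj (old a)) (trans (≡-sym (colouring-level s)) (trans (≡-sym e) (colouring-across {x} {x} s≢t)))
    colouring-proper (vertical s≢t) (vertical s≢r) q≢r _ = q≢r (cong (_ ,_) (two-layers s≢t s≢r))

    colouring-extends : Extends colouring P
    colouring-extends {x , s} {y , t} m with s ≟ᶠ t
    ... | yes refl = φ-extends s (layer-∈ s m)
    ... | no s≢t = extends (verticals-∈ s≢t m)

theorem5 : (n : ℕ) (G : Graph (Fin n)) → Subcubic G →
    (P : Precoloring (Fin n × Fin 2) 5) →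
    length P ≤ 4 →
    IsProperPrecoloring (G □ K₂) P →
    Σ (Fin n × Fin 2 → Fin n × Fin 2 → Fin 5) (λ c →
    IsProperEdgeColoring (G □ K₂) 5 c × Extends c P)
theorem5 n G subcubic P few precoloring = colouring P few precoloring
  , record { symmetric = λ p q a → colouring-symmetric P few precoloring (prism-link p q a)
           ; proper = λ p q r a a′ → colouring-proper P few precoloring (prism-link p q a) (prism-link p r a′) }
  , colouring-extends P few precoloring
  where
  open Assemble n G subcubic
  open Prism G renaming (link to prism-link)
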